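{- For every $\varepsilon>0$ and every integer $p\ge 2$, any (possibly randomized) $p$-player protocol for Max-Card-$k$ (in the $p$-player model described in the context) with an approximation guarantee of $$\frac{p+(H_p)^2}{2p-H_p}\cdot(1+\varepsilon)$$ must have communication complexity $\Omega\!\left(\frac{N\varepsilon}{p^3}\right)$, where $N=|W|$. Furthermore, this holds even in the special case in which the objective function $f$ is a (weighted) coverage function and $k=p$.
   Context: $H_p=1+\frac12+\cdots+\frac1p$ is the $p$-th harmonic number. The $p$-player model for Max-Card-$k$: the global information known to all players is a positive integer $k$, a finite ground set $W$ and a partition of $W$ into disjoint sets $W_1,\dots,W_p$. Player $i\in[p]$ privately receives a set $V_i\subseteq W_i$ and a value oracle for a non-negative monotone submodular function $f:2^W\to\mathbb{R}_{\ge0}$ that can evaluate $f$ on every subset of $W_1\cup\cdots\cup W_i$. A protocol consists of $p$ possibly randomized algorithms: player 1 computes a message $m_1$ from the global information and its private information; for $i=2,\dots,p-1$, player $i$ computes $m_i$ from the global information, its private information and $m_{i-1}$; player $p$ computes from the global information, its private information and $m_{p-1}$ an output $S\subseteq V_1\cup\cdots\cup V_p$ with $|S|\le k$. The communication complexity is the maximum length in bits of any of $m_1,\dots,m_{p-1}$ over all inputs and randomness. The approximation guarantee is $\rho$ if for every instance $\mathbb{E}[f(S)]\ge\rho\cdot\max\{f(T):T\subseteq V_1\cup\cdots\cup V_p,\ |T|\le k\}$. A weighted coverage function is $f(S)=\sum_{u\in\bigcup_{v\in S}v} a(u)$ where each element of $W$ is a subset of a finite universe $U$ with weights $a:U\to\mathbb{R}_{\ge0}$.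 The constant in $\Omega$ is absolute. -}

module Defs where

open import Algebra.Bundles using (CommutativeRing)
import Algebra.Definitions.RawMonoid as RawMonoidDefs
open import Data.Bool using (Bool)
open import Data.Fin using (Fin; fromℕ; fromℕ<; inject₁)
open import Data.Fin.Properties using (_≟_; _≤?_)
open import Data.Fin.Subset using (Subset; _⊆_; _∪_; _∩_; ⋃; ∣_∣)
open import Data.Fin.Subset.Properties using (_∈?_)
open import Data.List using (List; []; [_]; map; foldr; filter; length; concatMap; allFin; tabulate)
open import Data.List.Membership.Propositional using (_∈_)
open import Data.List.Relation.Unary.All using (All)
open import Data.Nat as ℕ using (ℕ; zero; suc; NonZero)
import Data.Nat.Properties as ℕₚ
open import Data.Product using (∃; _×_; _,_; proj₁; proj₂)
import Data.Vec as Vec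
open import Level using (0ℓ)
open import Relation.Binary.Core using (Rel)
open import Relation.Binary.Definitions using (Antisymmetric; Cotransitive)
open import Relation.Binary.PropositionalEquality using (_≡_)
open import Relation.Binary.Structures using (IsStrictPartialOrder)
open import Relation.Nullary using (¬_)
open import Relation.Nullary.Decidable using (does)

-- The real numbers, given by the axioms of a Cauchy-complete archimedean
-- ordered field.  Classically these determine ℝ up to isomorphism.  They are
-- phrased (cotransitivity of _<_ instead of trichotomy, inverses of positive
-- elements, moduli as Σ-types) so as to hold for constructive reals as well.
record Reals : Set₁ where
  infix 4 _<_ _≤_
  field
    commutativeRing : CommutativeRing 0ℓ 0ℓ

  open CommutativeRing commutativeRing public

  open RawMonoidDefs +-rawMonoid using () renaming (_×_ to _×#_)

  ι : ℕ → Carrier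
  ι n = n ×# 1#

  field
    _<_ : Rel Carrier 0ℓ

  _≤_ : Rel Carrier 0ℓ
  x ≤ y = ¬ (y < x)

  field
    <-isStrictPartialOrder : IsStrictPartialOrder _≈_ _<_
    <-cotransitive         : Cotransitive _<_
    ≤-antisym              : Antisymmetric _≈_ _≤_
    0<1                    : 0# < 1#
    +-monoˡ-<              : ∀ {x y} z → x < y → x + z < y + z
    *-positive             : ∀ {x y} → 0# < x → 0# < y → 0# < x * y
    recip                  : ∀ x → 0# < x → Carrier
    recip-inverse          : ∀ x (x>0 : 0# < x) → x * recip x x>0 ≈ 1#
    recip-positive         : ∀ x (x>0 : 0# < x) → 0# < recip x x>0
    archimedean            : ∀ x → ∃ λ n → x < ι n
    complete               : (x : ℕ → Carrier) →
                             (∀ ε → 0# < ε → ∃ λ n₀ → ∀ m n → n₀ ℕ.≤ m → n₀ ℕ.≤ n → x m < x n + ε) →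
                             ∃ λ l → ∀ ε → 0# < ε → ∃ λ n₀ → ∀ n → n₀ ℕ.≤ n → (x n < l + ε) × (l < x n + ε)

  open IsStrictPartialOrder <-isStrictPartialOrder public
    using (<-respʳ-≈; <-respˡ-≈)
    renaming (irrefl to <-irrefl; trans to <-trans)

module Arithmetic (ℝ : Reals) where
  open Reals ℝ

  private
    +-monoʳ-< : ∀ {x y} z → x < y → z + x < z + y
    +-monoʳ-< z x<y =
      <-respʳ-≈ (+-comm _ z) (<-respˡ-≈ (+-comm _ z) (+-monoˡ-< z x<y))

    +-mono-< : ∀ {x y u v} → x < y → u < v → x + u < y + v
    +-mono-< {y = y} {u = u} x<y u<v = <-trans (+-monoˡ-< u x<y) (+-monoʳ-< y u<v)

    x<x+y : ∀ x {y} → 0# < y → x < x + y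
    x<x+y x 0<y = <-respˡ-≈ (+-identityʳ x) (+-monoʳ-< x 0<y)

  ι-positive : ∀ n .{{_ : NonZero n}} → 0# < ι n
  ι-positive (suc zero)    = <-respʳ-≈ (sym (+-identityʳ 1#)) 0<1
  ι-positive (suc (suc n)) = <-trans 0<1 (x<x+y 1# (ι-positive (suc n)))

  infix 8 1/_

  1/_ : ∀ n .{{_ : NonZero n}} → Carrier
  1/ n = recip (ι n) (ι-positive n)

  H : ℕ → Carrier
  H zero    = 0#
  H (suc n) = H n + 1/ suc n

  private
    1<2 : 1# < ι 2
    1<2 = x<x+y 1# (ι-positive 1)

    1/n<2 : ∀ n → 1/ suc n < ι 2
    1/n<2 zero = <-respˡ-≈ (sym r≈1) 1<2
      where
      r≈1 : 1/ 1 ≈ 1#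
      r≈1 = trans (sym (*-identityˡ _))
              (trans (*-congʳ (sym (+-identityʳ 1#))) (recip-inverse (ι 1) (ι-positive 1)))
    1/n<2 (suc n) = <-trans (<-respʳ-≈ total≈1 (x<x+y r rest>0)) 1<2
      where
      r = 1/ suc (suc n)
      rest>0 : 0# < ι (suc n) * r
      rest>0 = *-positive (ι-positive (suc n)) (recip-positive _ _)
      total≈1 : r + ι (suc n) * r ≈ 1#
      total≈1 = trans (+-congʳ (sym (*-identityˡ r)))
                  (trans (sym (distribʳ r 1# (ι (suc n)))) (recip-inverse _ _))

    H<2n : ∀ n .{{_ : NonZero n}} → H n < ι 2 * ι n
    H<2n (suc zero) =
      <-respˡ-≈ (sym (+-identityˡ _))
        (<-respʳ-≈ (trans (sym (*-identityʳ _)) (*-congˡ (sym (+-identityʳ 1#)))) (1/n<2 0))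
    H<2n (suc (suc n)) = <-respʳ-≈ step (+-mono-< (H<2n (suc n)) (1/n<2 (suc n)))
      where
      step : ι 2 * ι (suc n) + ι 2 ≈ ι 2 * ι (suc (suc n))
      step = trans (+-congˡ (sym (*-identityʳ _)))
               (trans (sym (distribˡ (ι 2) _ _)) (*-congˡ (+-comm _ _)))

  2p-H-positive : ∀ p .{{_ : NonZero p}} → 0# < ι 2 * ι p - H p
  2p-H-positive p = <-respˡ-≈ (-‿inverseʳ (H p)) (+-monoˡ-< (- H p) (H<2n p))

  ratio : ∀ p .{{_ : NonZero p}} → Carrier
  ratio p = (ι p + H p * H p) * recip (ι 2 * ι p - H p) (2p-H-positive p)

  _/_³ : Carrier → ∀ p .{{_ : NonZero p}} → Carrier
  x / p ³ = x * (1/ (p ℕ.^ 3)) {{ℕₚ.m^n≢0 p 3}}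

  sum : List Carrier → Carrier
  sum = foldr _+_ 0#

  -- Finitely supported measures; an outcome may be listed more than once.
  Weighted : Set → Set
  Weighted A = List (Carrier × A)

  IsDistribution : ∀ {A} → Weighted A → Set
  IsDistribution d = All (λ wa → 0# ≤ proj₁ wa) d × sum (map proj₁ d) ≈ 1#

  𝔼 : ∀ {A} → Weighted A → (A → Carrier) → Carrier
  𝔼 d g = sum (map (λ wa → proj₁ wa * g (proj₂ wa)) d)

  -- Equality in law.
  _≈ᴰ_ : ∀ {A} → Weighted A → Weighted A → Set
  d ≈ᴰ d′ = ∀ g → 𝔼 d g ≈ 𝔼 d′ g

  Possible : ∀ {A} → Weighted A → A → Set
  Possible d a = ∃ λ w → (w , a) ∈ d × 0# < w

  point : ∀ {A} → A → Weighted A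
  point a = [ 1# , a ]

  _>>=_ : ∀ {A B} → Weighted A → (A → Weighted B) → Weighted B
  d >>= κ = concatMap (λ wa → map (λ vb → proj₁ wa * proj₁ vb , proj₂ vb) (κ (proj₂ wa))) d

-- Global information for p players on the ground set W = Fin N.  The partition
-- is given by the map sending w to the index of the part containing it; parts
-- may be empty.
record Global (p N : ℕ) : Set where
  field
    k       : ℕ
    k>0     : 0 ℕ.< k
    part-of : Fin N → Fin p

  W : Fin p → Subset N
  W i = Vec.tabulate λ w → does (part-of w ≟ i)

  -- W₁ ∪ ⋯ ∪ Wᵢ
  W≤ : Fin p → Subset N
  W≤ i = Vec.tabulate λ w → does (part-of w ≤? i)

module Model (ℝ : Reals) where
  open Reals ℝ
  open Arithmetic ℝ

  Bits : Set
  Bits = List Bool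

  SetFunction : ℕ → Set
  SetFunction N = Subset N → Carrier

  record IsMonotoneSubmodular {N} (f : SetFunction N) : Set where
    field
      nonneg     : ∀ S → 0# ≤ f S
      monotone   : ∀ S T → S ⊆ T → f S ≤ f T
      submodular : ∀ S T → f (S ∪ T) + f (S ∩ T) ≤ f S + f T

  -- The elements of W are the subsets `sets w` of U = Fin u.
  record IsWeightedCoverage {N} (f : SetFunction N) : Set where
    field
      u        : ℕ
      sets     : Fin N → Subset u
      a        : Fin u → Carrier
      a-nonneg : ∀ x → 0# ≤ a x

    covered : Subset N → Subset u
    covered S = ⋃ (map sets (filter (_∈? S) (allFin N)))

    field
      f-coverage : ∀ S → f S ≈ sum (map a (filter (_∈? covered S) (allFin u)))

  record Instance {p N} (G : Global p N) : Set where
    open Global G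
    field
      V   : Fin p → Subset N
      V⊆W : ∀ i → V i ⊆ W i
      f   : SetFunction N

    ⋃V : Subset N
    ⋃V = ⋃ (tabulate V)

    Feasible : Subset N → Set
    Feasible S = S ⊆ ⋃V × ∣ S ∣ ℕ.≤ k

    IsOptimum : Carrier → Set
    IsOptimum v = (∃ λ T → Feasible T × f T ≈ v) × (∀ T → Feasible T → f T ≤ v)

  Oracle : ∀ {p N} → Global p N → Fin p → Set
  Oracle {N = N} G i = (S : Subset N) → .(S ⊆ Global.W≤ G i) → Carrier

  _≈ᴼ_ : ∀ {p N} {G : Global p N} {i} → Oracle G i → Oracle G i → Set
  _≈ᴼ_ {G = G} {i = i} o o′ = ∀ S (S⊆W≤ : S ⊆ Global.W≤ G i) → o S S⊆W≤ ≈ o′ S S⊆W≤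

  oracle : ∀ {p N} {G : Global p N} → Instance G → (i : Fin p) → Oracle G i
  oracle I i S _ = Instance.f I S

  -- Protocols for p = s + 1 players, s of which send a message.  A randomized
  -- algorithm using private coins is given by the law of its result as a function
  -- of its inputs: the global information, Vᵢ, the oracle and the incoming message
  -- (which is [] for the first player).  The -cong fields say that the oracle
  -- matters only through the real numbers it returns.
  record Protocol (s N : ℕ) : Set where
    field
      send        : (G : Global (suc s) N) (i : Fin s) →
                    Subset N → Oracle G (inject₁ i) → Bits → Weighted Bits
      send-dist   : ∀ G i V o m → IsDistribution (send G i V o m)
      send-cong   : ∀ G i V {o o′} m → _≈ᴼ_ {G = G} {i = inject₁ i} o o′ →
                    send G i V o m ≈ᴰ send G i V o′ m
      output      : (G : Global (suc s) N) →
                    Subset N → Oracle G (fromℕ s) → Bits → Weighted (Subset N)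
      output-dist : ∀ G V o m → IsDistribution (output G V o m)
      output-cong : ∀ G V {o o′} m → _≈ᴼ_ {G = G} {i = fromℕ s} o o′ →
                    output G V o m ≈ᴰ output G V o′ m

  module Execution {s N} (Π : Protocol s N) (G : Global (suc s) N) (I : Instance G) where
    open Protocol Π
    open Instance I

    -- The law of m_j; m₀ = [] is the message handed to the first player.
    message : (j : ℕ) → j ℕ.≤ s → Weighted Bits
    message zero    _   = point []
    message (suc j) j<s = message j (ℕₚ.<⇒≤ j<s) >>= send G i (V (inject₁ i)) (oracle I (inject₁ i))
      where i = fromℕ< j<s

    result : Weighted (Subset N)
    result = message s ℕₚ.≤-refl >>= output G (V (fromℕ s)) (oracle I (fromℕ s))

  -- A restriction on the parameter k (part of the global information) and on f.
  Class : ℕ → ℕ → Set₁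
  Class p N = Global p N → SetFunction N → Set

  Submodular : ∀ {p N} → Class p N
  Submodular G f = IsMonotoneSubmodular f

  Coverage-k≡p : ∀ {p N} → Class p N
  Coverage-k≡p {p} G f = Global.k G ≡ p × IsWeightedCoverage f

  module _ {s N} (𝒞 : Class (suc s) N) (Π : Protocol s N) where

    HasGuarantee : Carrier → Set
    HasGuarantee ρ = ∀ G (I : Instance G) → 𝒞 G (Instance.f I) →
      let open Instance I
          open Execution Π G I
      in (∀ S → Possible result S → Feasible S)
       × (∀ opt → IsOptimum opt → ρ * opt ≤ 𝔼 result f)

    CommunicationAtMost : ℕ → Set
    CommunicationAtMost C = ∀ G (I : Instance G) → 𝒞 G (Instance.f I) →
      ∀ j (j≤s : j ℕ.≤ s) m → Possible (Execution.message Π G I j j≤s) m → length m ℕ.≤ C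

    -- The communication complexity (possibly infinite) is at least x.
    CommunicationAtLeast : Carrier → Set
    CommunicationAtLeast x = ∀ C → CommunicationAtMost C → x ≤ ι C

{-# OPTIONS --safe #-}

-- Feasibility must hold with certainty, so a special element can be output only if the messages
-- certify that its owner has it.  A message of C bits certifies on average at most C + 2 elements
-- of a random subset of n elements, because the subsets compatible with a message that certifies
-- k elements are a fraction 2^-k of all subsets.  Hence, choosing player by player a set and a
-- special element of it, all special elements remain uncertified except with probability
-- O(p C / n), and otherwise the output contains none of the special elements of the senders.
--
-- The objective function is a coverage function in which the special elements partition the
-- universe, while every other element of a player covers each point that is not covered by the
-- special elements of earlier players independently with probability 1/τ, the share of the
-- player's own special element of these points; this makes the special element indistinguishable
-- until a later player arrives.  If U(b) is the least fraction that b other elements leave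
-- uncovered from some player on, then picking j elements of that player gives
-- ρ^j ((1 - ρ) + ρ U′(b - j)) with ρ = 1 - 1/τ, and a bound of the form A ρ^b for U(b) is
-- inductive as soon as (1 - ρ) + ρ A′ ρ′^d ≥ A ρ^d for all d, which is the convexity of powers.
-- With τ ≈ 2 m + O(log² m) when m players remain, about half of the universe stays uncovered.

module Submission where

import Algebra.Properties.Monoid.Mult as MonoidMult
import Algebra.Properties.Ring as RingProperties
import Algebra.Properties.Semiring.Exp as SemiringExp
import Algebra.Properties.Semiring.Mult as SemiringMult
import Algebra.Solver.Ring as RingSolver
open import Algebra.Bundles using (RawRing)
open import Algebra.Solver.Ring.AlmostCommutativeRing using (fromCommutativeRing; _-Raw-AlmostCommutative⟶_)
open import Data.Bool using (Bool; true; false; not; _∧_; _∨_; if_then_else_)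
import Data.Bool.Properties as Boolₚ
open import Data.Empty using (⊥; ⊥-elim)
open import Data.Fin using (Fin; zero; suc; toℕ; fromℕ; fromℕ<; inject₁; inject≤; combine; remQuot)
import Data.Fin.Properties as Finₚ
open import Data.Fin.Subset as Subset using (Subset; ∣_∣; _⊆_; _∪_; ⋃; ⁅_⁆)
open import Data.Fin.Subset.Properties using (_∈?_; ∉⊥; x∈⁅x⁆; x∈⁅y⁆⇒x≡y; ∣⁅x⁆∣≡1; ∣⊥∣≡0; x∈p∪q⁻; x∈p∪q⁺; x∈p∩q⁻)
open import Data.Integer as ℤ using (ℤ; +_; -[1+_])
import Data.Integer.Properties as ℤₚ
open import Data.List as List using (List; []; _∷_; map; _++_; length; concatMap; filter; allFin; cartesianProduct)
open import Data.List.Membership.Propositional using (_∈_)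
open import Data.List.Membership.Propositional.Properties using (∈-++⁺ˡ; ∈-++⁺ʳ; ∈-++⁻; ∈-map⁺; ∈-map⁻; ∈-allFin; ∈-filter⁺; ∈-filter⁻; ∈-lookup; ∈-cartesianProduct⁺; ∈-tabulate⁺; ∈-tabulate⁻)
import Data.List.Properties as Listₚ
open import Data.List.Relation.Unary.All as All using (All; []; _∷_)
import Data.List.Relation.Unary.All.Properties as Allₚ
open import Data.List.Relation.Unary.Any using (here; there)
open import Data.Maybe using (Maybe; just; nothing)
open import Data.Nat as ℕ using (ℕ; zero; suc)
import Data.Nat.DivMod as ℕᵈ
import Data.Nat.Properties as ℕₚ
open import Data.Nat.Tactic.RingSolver using (solve-∀)
open import Data.Product using (∃; Σ; _×_; _,_; proj₁; proj₂; map₁)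
import Data.Product.Properties as Productₚ
open import Data.Sum using (_⊎_; inj₁; inj₂)
open import Data.Vec as Vec using ([]; _∷_; lookup; _[_]≔_)
open import Data.Vec.Functional using (updateAt)
open import Data.Vec.Functional.Properties using (updateAt-updates; updateAt-minimal)
import Data.Vec.Properties as Vecₚ
open import Function using (_∘_; const)
open import Relation.Binary.Definitions using (DecidableEquality)
open import Relation.Binary.PropositionalEquality as ≡ using (_≡_; _≢_)
open import Relation.Nullary using (¬_; yes; no; Dec)
open import Relation.Nullary.Decidable using (does; dec-true; dec-false; _×-dec_)
open import Relation.Unary using (Decidable)
open import Defs

-- No distribution over instances is fixed in advance; a single instance is built.
-- Indistinguishability makes the law of a player's message independent of its own special element,
-- so this element can be chosen once that law is known. Instances in which a sender lacks its
-- special element enter only through feasibility, hence their optimum never has to be known. The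
-- order of `Reals` is not decidable, and neither is whether a message certifies an element. Since
-- the conclusion is a negated strict inequality, existence claims are proved in the weak form that
-- their refutation is absurd. An instance with one relevant element gives `ε ≤ 1` and `C ≥ 1`; the
-- latter absorbs the additive constant in `C + 3 ≤ 4 C`. The constant 32 is the product of this 4,
-- a 2 because only half of all pairs of a set and an element are memberships, a 2 from
-- `ratio ≥ 1/2`, and a 2 from rounding `N` down to equal blocks. One factor `p` is lost to the
-- blocks, another to summing failures over the senders.

-- Ordered field arithmetic and a ring solver with integer constants.

module OrderedField (ℝ : Reals) where
  open Reals ℝ
  open RingProperties ring using (-‿distribˡ-*; -‿distribʳ-*; -‿involutive; -‿+-comm; -0#≈0#)

  ι-homo-+ : ∀ m n → ι (m ℕ.+ n) ≈ ι m + ι n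
  ι-homo-+ = MonoidMult.×-homo-+ +-monoid 1#

  ι-homo-* : ∀ m n → ι (m ℕ.* n) ≈ ι m * ι n
  ι-homo-* = SemiringMult.×1-homo-* semiring

  ι1≈1 : ι 1 ≈ 1#
  ι1≈1 = +-identityʳ 1#

  -- The values at 0 and 1 make the solver's constants literally 0#, 1# and ι n.
  ⟦_⟧ℕ : ℕ → Carrier
  ⟦ 0 ⟧ℕ = 0#
  ⟦ 1 ⟧ℕ = 1#
  ⟦ n ⟧ℕ = ι n

  ⟦_⟧ℤ : ℤ → Carrier
  ⟦ + n ⟧ℤ      = ⟦ n ⟧ℕ
  ⟦ -[1+ n ] ⟧ℤ = - ⟦ suc n ⟧ℕ

  private
    ⟦⟧ℕ≈ι : ∀ n → ⟦ n ⟧ℕ ≈ ι n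
    ⟦⟧ℕ≈ι 0             = refl
    ⟦⟧ℕ≈ι 1             = sym ι1≈1
    ⟦⟧ℕ≈ι (suc (suc n)) = refl

    cancel : ∀ x y z → (x + y) - (x + z) ≈ y - z
    cancel x y z = trans (+-cong (+-comm x y) (sym (-‿+-comm x z)))
      (trans (+-assoc y x _) (+-congˡ (trans (sym (+-assoc x (- x) (- z)))
        (trans (+-congʳ (-‿inverseʳ x)) (+-identityˡ _)))))

    ⟦⊖⟧ : ∀ m n → ⟦ m ℤ.⊖ n ⟧ℤ ≈ ι m - ι n
    ⟦⊖⟧ zero    zero    = sym (-‿inverseʳ 0#)
    ⟦⊖⟧ zero    (suc n) = trans (-‿cong (⟦⟧ℕ≈ι (suc n))) (sym (+-identityˡ _))
    ⟦⊖⟧ (suc m) zero    = trans (⟦⟧ℕ≈ι (suc m)) (trans (sym (+-identityʳ _)) (+-congˡ (sym -0#≈0#)))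
    ⟦⊖⟧ (suc m) (suc n) = trans (reflexive (≡.cong ⟦_⟧ℤ (ℤₚ.[1+m]⊖[1+n]≡m⊖n m n)))
      (trans (⟦⊖⟧ m n) (sym (cancel 1# (ι m) (ι n))))

    ⟦⟧-neg : ∀ i → ⟦ ℤ.- i ⟧ℤ ≈ - ⟦ i ⟧ℤ
    ⟦⟧-neg (+ zero)   = sym -0#≈0#
    ⟦⟧-neg (+ suc n)  = refl
    ⟦⟧-neg -[1+ n ]   = sym (-‿involutive _)

    ⟦⟧-+ : ∀ i j → ⟦ i ℤ.+ j ⟧ℤ ≈ ⟦ i ⟧ℤ + ⟦ j ⟧ℤ
    ⟦⟧-+ (+ m) (+ n) = trans (⟦⟧ℕ≈ι (m ℕ.+ n)) (trans (ι-homo-+ m n) (sym (+-cong (⟦⟧ℕ≈ι m) (⟦⟧ℕ≈ι n))))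
    ⟦⟧-+ (+ m) -[1+ n ] = trans (⟦⊖⟧ m (suc n)) (sym (+-cong (⟦⟧ℕ≈ι m) (-‿cong (⟦⟧ℕ≈ι (suc n)))))
    ⟦⟧-+ -[1+ m ] (+ n) = trans (⟦⊖⟧ n (suc m))
      (trans (+-comm _ _) (sym (+-cong (-‿cong (⟦⟧ℕ≈ι (suc m))) (⟦⟧ℕ≈ι n))))
    ⟦⟧-+ -[1+ m ] -[1+ n ] = trans (-‿cong step) (sym (-‿+-comm _ _))
      where
      step : ⟦ suc (suc (m ℕ.+ n)) ⟧ℕ ≈ ⟦ suc m ⟧ℕ + ⟦ suc n ⟧ℕ
      step = trans (reflexive (≡.cong (λ k → ι (suc k)) (≡.sym (ℕₚ.+-suc m n))))
        (trans (ι-homo-+ (suc m) (suc n)) (sym (+-cong (⟦⟧ℕ≈ι (suc m)) (⟦⟧ℕ≈ι (suc n)))))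

    ⟦⟧ℕ-* : ∀ m n → ⟦ m ℕ.* n ⟧ℕ ≈ ⟦ m ⟧ℕ * ⟦ n ⟧ℕ
    ⟦⟧ℕ-* m n = trans (⟦⟧ℕ≈ι (m ℕ.* n)) (trans (ι-homo-* m n) (sym (*-cong (⟦⟧ℕ≈ι m) (⟦⟧ℕ≈ι n))))

    pos*pos : ∀ m n → ⟦ + m ℤ.* + n ⟧ℤ ≈ ⟦ m ⟧ℕ * ⟦ n ⟧ℕ
    pos*pos m n = trans (reflexive (≡.cong ⟦_⟧ℤ (≡.sym (ℤₚ.pos-* m n)))) (⟦⟧ℕ-* m n)

    ⟦⟧-* : ∀ i j → ⟦ i ℤ.* j ⟧ℤ ≈ ⟦ i ⟧ℤ * ⟦ j ⟧ℤ
    ⟦⟧-* (+ m) (+ n) = pos*pos m n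
    ⟦⟧-* (+ m) -[1+ n ] = trans (reflexive (≡.cong ⟦_⟧ℤ (≡.sym (ℤₚ.neg-distribʳ-* (+ m) (+ suc n)))))
      (trans (⟦⟧-neg (+ m ℤ.* + suc n)) (trans (-‿cong (pos*pos m (suc n))) (-‿distribʳ-* _ _)))
    ⟦⟧-* -[1+ m ] (+ n) = trans (reflexive (≡.cong ⟦_⟧ℤ (≡.sym (ℤₚ.neg-distribˡ-* (+ suc m) (+ n)))))
      (trans (⟦⟧-neg (+ suc m ℤ.* + n)) (trans (-‿cong (pos*pos (suc m) n)) (-‿distribˡ-* _ _)))
    ⟦⟧-* -[1+ m ] -[1+ n ] = trans (⟦⟧ℕ-* (suc m) (suc n))
      (trans (sym (-‿involutive _)) (trans (-‿cong (-‿distribˡ-* _ _)) (-‿distribʳ-* _ _)))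

    ℤ-rawRing : RawRing _ _
    ℤ-rawRing = record { Carrier = ℤ ; _≈_ = _≡_ ; _+_ = ℤ._+_ ; _*_ = ℤ._*_ ; -_ = ℤ.-_ ; 0# = + 0 ; 1# = + 1 }

    ℤ-homomorphism : ℤ-rawRing -Raw-AlmostCommutative⟶ fromCommutativeRing commutativeRing
    ℤ-homomorphism = record
      { ⟦_⟧ = ⟦_⟧ℤ ; +-homo = ⟦⟧-+ ; *-homo = ⟦⟧-* ; -‿homo = ⟦⟧-neg ; 0-homo = refl ; 1-homo = refl }

    ⟦⟧-≟ : ∀ i j → Maybe (⟦ i ⟧ℤ ≈ ⟦ j ⟧ℤ)
    ⟦⟧-≟ i j with i ℤ.≟ j
    ... | yes ≡.refl = just refl
    ... | no _       = nothing

  module Solver = RingSolver ℤ-rawRing (fromCommutativeRing commutativeRing) ℤ-homomorphism ⟦⟧-≟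
  open Solver public using (solve; _:=_; _:+_; _:*_; _:-_; :-_; con)

  <-asym : ∀ {x y} → x < y → ¬ y < x
  <-asym p q = <-irrefl refl (<-trans p q)

  <⇒≤ : ∀ {x y} → x < y → x ≤ y
  <⇒≤ = <-asym

  ≈⇒≤ : ∀ {x y} → x ≈ y → x ≤ y
  ≈⇒≤ x≈y = <-irrefl (sym x≈y)

  ≤-refl : ∀ {x} → x ≤ x
  ≤-refl = ≈⇒≤ refl

  ≤-trans : ∀ {x y z} → x ≤ y → y ≤ z → x ≤ z
  ≤-trans {y = y} x≤y y≤z z<x with <-cotransitive z<x y
  ... | inj₁ z<y = y≤z z<y
  ... | inj₂ y<x = x≤y y<x

  <-≤-trans : ∀ {x y z} → x < y → y ≤ z → x < z
  <-≤-trans {z = z} x<y y≤z with <-cotransitive x<y z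
  ... | inj₁ x<z = x<z
  ... | inj₂ z<y = ⊥-elim (y≤z z<y)

  ≤-respˡ : ∀ {x y z} → x ≈ y → x ≤ z → y ≤ z
  ≤-respˡ x≈y = ≤-trans (≈⇒≤ (sym x≈y))

  ≤-respʳ : ∀ {x y z} → y ≈ z → x ≤ y → x ≤ z
  ≤-respʳ y≈z x≤y = ≤-trans x≤y (≈⇒≤ y≈z)

  -- Since x ≤ y is a negation, classical case distinctions may be used to prove it.
  ≤-cases : ∀ {x y} (P : Set) → (P → x ≤ y) → (¬ P → x ≤ y) → x ≤ y
  ≤-cases P f g y<x = g (λ p → f p y<x) y<x

  ≤-stable : ∀ {x y} → ¬ ¬ (x ≤ y) → x ≤ y
  ≤-stable nn y<x = nn λ x≤y → x≤y y<x

  private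
    cancelˡ : ∀ x z → (x + z) + - z ≈ x
    cancelˡ = solve 2 (λ x z → (x :+ z) :+ :- z := x) refl

  +-monoˡ-≤ : ∀ {x y} z → x ≤ y → x + z ≤ y + z
  +-monoˡ-≤ z x≤y y+z<x+z =
    x≤y (<-respˡ-≈ (cancelˡ _ z) (<-respʳ-≈ (cancelˡ _ z) (+-monoˡ-< (- z) y+z<x+z)))

  +-monoʳ-≤ : ∀ {x y} z → x ≤ y → z + x ≤ z + y
  +-monoʳ-≤ z x≤y = ≤-respˡ (+-comm _ z) (≤-respʳ (+-comm _ z) (+-monoˡ-≤ z x≤y))

  +-mono-≤ : ∀ {x y u v} → x ≤ y → u ≤ v → x + u ≤ y + v
  +-mono-≤ {y = y} {u = u} x≤y u≤v = ≤-trans (+-monoˡ-≤ u x≤y) (+-monoʳ-≤ y u≤v)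

  private
    x-y+y : ∀ x y → (x - y) + y ≈ x
    x-y+y = solve 2 (λ x y → (x :- y) :+ y := x) refl

  x≤y⇒0≤y-x : ∀ {x y} → x ≤ y → 0# ≤ y - x
  x≤y⇒0≤y-x {x} x≤y = ≤-respˡ (-‿inverseʳ x) (+-monoˡ-≤ (- x) x≤y)

  0≤y-x⇒x≤y : ∀ {x y} → 0# ≤ y - x → x ≤ y
  0≤y-x⇒x≤y {x} {y} p = ≤-respˡ (+-identityˡ x) (≤-respʳ (x-y+y y x) (+-monoˡ-≤ x p))

  x<y⇒0<y-x : ∀ {x y} → x < y → 0# < y - x
  x<y⇒0<y-x {x} x<y = <-respˡ-≈ (-‿inverseʳ x) (+-monoˡ-< (- x) x<y)

  ≤-by-difference : ∀ {x y} z → y - x ≈ z → 0# ≤ z → x ≤ y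
  ≤-by-difference z eq 0≤z = 0≤y-x⇒x≤y (≤-respʳ (sym eq) 0≤z)

  0≤+ : ∀ {x y} → 0# ≤ x → 0# ≤ y → 0# ≤ x + y
  0≤+ p q = ≤-respˡ (+-identityˡ 0#) (+-mono-≤ p q)

  0≤x⇒¬0<x⇒x≈0 : ∀ {x} → 0# ≤ x → ¬ (0# < x) → x ≈ 0#
  0≤x⇒¬0<x⇒x≈0 p q = ≤-antisym q p

  0≤* : ∀ {x y} → 0# ≤ x → 0# ≤ y → 0# ≤ x * y
  0≤* {x} {y} p q = ≤-cases (0# < x)
    (λ 0<x → ≤-cases (0# < y)
      (λ 0<y → <⇒≤ (*-positive 0<x 0<y))
      (λ n → ≈⇒≤ (sym (trans (*-congˡ (0≤x⇒¬0<x⇒x≈0 q n)) (zeroʳ x)))))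
    (λ n → ≈⇒≤ (sym (trans (*-congʳ (0≤x⇒¬0<x⇒x≈0 p n)) (zeroˡ y))))

  *-monoˡ-≤ : ∀ {x y} z → 0# ≤ z → x ≤ y → z * x ≤ z * y
  *-monoˡ-≤ {x} {y} z 0≤z x≤y = ≤-by-difference (z * (y - x))
    (solve 3 (λ x y z → z :* y :- z :* x := z :* (y :- x)) refl x y z) (0≤* 0≤z (x≤y⇒0≤y-x x≤y))

  *-monoʳ-≤ : ∀ {x y} z → 0# ≤ z → x ≤ y → x * z ≤ y * z
  *-monoʳ-≤ z 0≤z x≤y = ≤-respˡ (*-comm z _) (≤-respʳ (*-comm z _) (*-monoˡ-≤ z 0≤z x≤y))

  *-mono-≤ : ∀ {x y u v} → 0# ≤ u → 0# ≤ y → x ≤ y → u ≤ v → x * u ≤ y * v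
  *-mono-≤ {y = y} {u = u} 0≤u 0≤y x≤y u≤v = ≤-trans (*-monoʳ-≤ u 0≤u x≤y) (*-monoˡ-≤ y 0≤y u≤v)

  *-monoˡ-< : ∀ {x y} z → 0# < z → x < y → z * x < z * y
  *-monoˡ-< {x} {y} z 0<z x<y = <-respˡ-≈ (+-identityˡ _)
    (<-respʳ-≈ (solve 3 (λ x y z → z :* (y :- x) :+ z :* x := z :* y) refl x y z)
      (+-monoˡ-< (z * x) (*-positive 0<z (x<y⇒0<y-x x<y))))

  *-cancelˡ-≤ : ∀ {x y} z → 0# < z → z * x ≤ z * y → x ≤ y
  *-cancelˡ-≤ z 0<z zx≤zy y<x = zx≤zy (*-monoˡ-< z 0<z y<x)

  0≤1 : 0# ≤ 1#
  0≤1 = <⇒≤ 0<1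

  0≤ι : ∀ n → 0# ≤ ι n
  0≤ι zero    = ≤-refl
  0≤ι (suc n) = 0≤+ 0≤1 (0≤ι n)

  ι-mono-≤ : ∀ {m n} → m ℕ.≤ n → ι m ≤ ι n
  ι-mono-≤ {n = n} ℕ.z≤n = 0≤ι n
  ι-mono-≤ (ℕ.s≤s m≤n) = +-monoʳ-≤ 1# (ι-mono-≤ m≤n)

  0<+ : ∀ {x y} → 0# < x → 0# ≤ y → 0# < x + y
  0<+ {x} 0<x 0≤y = <-≤-trans 0<x (≤-respˡ (+-identityʳ x) (+-monoʳ-≤ x 0≤y))

-- Finite sums.

module Sums (ℝ : Reals) where
  open Reals ℝ hiding (zero)
  open Arithmetic ℝ using (sum)
  open OrderedField ℝ

  private variable
    A B : Set

  ∑ : List A → (A → Carrier) → Carrier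
  ∑ xs g = sum (map g xs)

  ∑-cong : (xs : List A) {g h : A → Carrier} → (∀ x → g x ≈ h x) → ∑ xs g ≈ ∑ xs h
  ∑-cong []       e = refl
  ∑-cong (x ∷ xs) e = +-cong (e x) (∑-cong xs e)

  ∑-mono : (xs : List A) {g h : A → Carrier} → (∀ {x} → x ∈ xs → g x ≤ h x) → ∑ xs g ≤ ∑ xs h
  ∑-mono []       e = ≤-refl
  ∑-mono (x ∷ xs) e = +-mono-≤ (e (here ≡.refl)) (∑-mono xs λ i → e (there i))

  ∑-nonneg : (xs : List A) {g : A → Carrier} → (∀ {x} → x ∈ xs → 0# ≤ g x) → 0# ≤ ∑ xs g
  ∑-nonneg []       e = ≤-refl
  ∑-nonneg (x ∷ xs) e = 0≤+ (e (here ≡.refl)) (∑-nonneg xs λ i → e (there i))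

  ∑-0 : (xs : List A) → ∑ xs (λ _ → 0#) ≈ 0#
  ∑-0 []       = refl
  ∑-0 (x ∷ xs) = trans (+-identityˡ _) (∑-0 xs)

  ∑-+ : (xs : List A) (g h : A → Carrier) → ∑ xs (λ x → g x + h x) ≈ ∑ xs g + ∑ xs h
  ∑-+ []       g h = sym (+-identityˡ 0#)
  ∑-+ (x ∷ xs) g h = trans (+-congˡ (∑-+ xs g h))
    (solve 4 (λ a b c d → (a :+ b) :+ (c :+ d) := (a :+ c) :+ (b :+ d)) refl (g x) (h x) (∑ xs g) (∑ xs h))

  ∑-*ˡ : (xs : List A) (c : Carrier) (g : A → Carrier) → ∑ xs (λ x → c * g x) ≈ c * ∑ xs g
  ∑-*ˡ []       c g = sym (zeroʳ c)
  ∑-*ˡ (x ∷ xs) c g = trans (+-congˡ (∑-*ˡ xs c g)) (sym (distribˡ c _ _))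

  ∑-const : (xs : List A) (c : Carrier) → ∑ xs (λ _ → c) ≈ ι (length xs) * c
  ∑-const []       c = sym (zeroˡ c)
  ∑-const (x ∷ xs) c = trans (+-cong (sym (*-identityˡ c)) (∑-const xs c)) (sym (distribʳ c 1# _))

  ∑-++ : (xs ys : List A) (g : A → Carrier) → ∑ (xs ++ ys) g ≈ ∑ xs g + ∑ ys g
  ∑-++ []       ys g = sym (+-identityˡ _)
  ∑-++ (x ∷ xs) ys g = trans (+-congˡ (∑-++ xs ys g)) (sym (+-assoc _ _ _))

  ∑-map : (k : A → B) (xs : List A) (g : B → Carrier) → ∑ (map k xs) g ≡ ∑ xs (λ x → g (k x))
  ∑-map k xs g = ≡.cong sum (≡.sym (Listₚ.map-∘ xs))

  ∑-concatMap : (k : A → List B) (xs : List A) (g : B → Carrier) → ∑ (concatMap k xs) g ≈ ∑ xs (λ x → ∑ (k x) g)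
  ∑-concatMap k []       g = refl
  ∑-concatMap k (x ∷ xs) g = trans (∑-++ (k x) (concatMap k xs) g) (+-congˡ (∑-concatMap k xs g))

  ∑-swap : (xs : List A) (ys : List B) (g : A → B → Carrier) →
           ∑ xs (λ x → ∑ ys (g x)) ≈ ∑ ys (λ y → ∑ xs (λ x → g x y))
  ∑-swap []       ys g = sym (∑-0 ys)
  ∑-swap (x ∷ xs) ys g = trans (+-congˡ (∑-swap xs ys g)) (sym (∑-+ ys _ _))

  ∑-allFin-suc : ∀ n (g : Fin (suc n) → Carrier) → ∑ (allFin (suc n)) g ≡ g zero + ∑ (allFin n) (λ x → g (suc x))
  ∑-allFin-suc n g = ≡.cong (λ xs → g zero + sum xs)
    (≡.trans (Listₚ.map-tabulate suc g) (≡.sym (Listₚ.map-tabulate (λ x → x) (λ x → g (suc x)))))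

  𝟙 : Bool → Carrier
  𝟙 b = if b then 1# else 0#

  𝟙-nonneg : ∀ b → 0# ≤ 𝟙 b
  𝟙-nonneg true  = 0≤1
  𝟙-nonneg false = ≤-refl

  ∑-filter : {P : A → Set} (P? : Decidable P) (xs : List A) (g : A → Carrier) →
             ∑ (filter P? xs) g ≈ ∑ xs (λ x → g x * 𝟙 (does (P? x)))
  ∑-filter P? []       g = refl
  ∑-filter P? (x ∷ xs) g with does (P? x)
  ... | true  = +-cong (sym (*-identityʳ _)) (∑-filter P? xs g)
  ... | false = trans (∑-filter P? xs g) (trans (sym (+-identityˡ _)) (+-congʳ (sym (zeroʳ _))))

  term≤∑ : (xs : List A) {g : A → Carrier} → (∀ {x} → x ∈ xs → 0# ≤ g x) → ∀ {x} → x ∈ xs → g x ≤ ∑ xs g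
  term≤∑ (x ∷ xs) {g} e (here ≡.refl) = ≤-respˡ (+-identityʳ _) (+-monoʳ-≤ (g x) (∑-nonneg xs λ i → e (there i)))
  term≤∑ (x ∷ xs) {g} e (there i)     = ≤-respˡ (+-identityˡ _) (+-mono-≤ (e (here ≡.refl)) (term≤∑ xs (λ i → e (there i)) i))

  -- Cotransitivity places `g x` above 0 or below the whole sum, so a witness is found without
  -- deciding the sign of any term.
  ∑>0⇒term>0 : (xs : List A) {g : A → Carrier} → 0# < ∑ xs g → ∃ λ x → x ∈ xs × 0# < g x
  ∑>0⇒term>0 []       0<0 = ⊥-elim (<-irrefl refl 0<0)
  ∑>0⇒term>0 (x ∷ xs) {g} 0<s with <-cotransitive 0<s (g x)
  ... | inj₁ 0<gx = x , here ≡.refl , 0<gx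
  ... | inj₂ gx<s with ∑>0⇒term>0 xs {g} (<-respˡ-≈ (-‿inverseʳ (g x)) (<-respʳ-≈ (solve 2 (λ a b → (a :+ b) :- a := b) refl (g x) (∑ xs g)) (+-monoˡ-< (- g x) gx<s)))
  ...   | y , i , 0<gy = y , there i , 0<gy

-- Expectations, composition of random steps, possible outcomes.

module Expectation (ℝ : Reals) where
  open Reals ℝ hiding (zero)
  open Arithmetic ℝ hiding (_/_³)
  open OrderedField ℝ
  open Sums ℝ

  private variable
    A B : Set

  Nonneg : Weighted A → Set
  Nonneg d = ∀ {wa} → wa ∈ d → 0# ≤ proj₁ wa

  nonneg-weights : {d : Weighted A} → IsDistribution d → Nonneg d
  nonneg-weights (p , _) = All.lookup p

  𝔼-cong : (d : Weighted A) {g h : A → Carrier} → (∀ a → g a ≈ h a) → 𝔼 d g ≈ 𝔼 d h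
  𝔼-cong d e = ∑-cong d λ wa → *-congˡ (e (proj₂ wa))

  𝔼-mono : (d : Weighted A) → Nonneg d → {g h : A → Carrier} →
           (∀ a → Possible d a → g a ≤ h a) → 𝔼 d g ≤ 𝔼 d h
  𝔼-mono d nn {g} {h} e = ∑-mono d λ { {w , a} i → ≤-cases (0# < w)
    (λ 0<w → *-monoˡ-≤ w (<⇒≤ 0<w) (e a (w , i , 0<w)))
    (λ w≯0 → let w≈0 = 0≤x⇒¬0<x⇒x≈0 (nn i) w≯0 in
       ≈⇒≤ (trans (*-congʳ w≈0) (trans (zeroˡ (g a)) (sym (trans (*-congʳ w≈0) (zeroˡ (h a))))))) }

  𝔼-nonneg : (d : Weighted A) → Nonneg d → {g : A → Carrier} → (∀ a → 0# ≤ g a) → 0# ≤ 𝔼 d g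
  𝔼-nonneg d nn e = ∑-nonneg d λ { {w , a} i → 0≤* (nn i) (e a) }

  𝔼-+ : (d : Weighted A) (g h : A → Carrier) → 𝔼 d (λ a → g a + h a) ≈ 𝔼 d g + 𝔼 d h
  𝔼-+ d g h = trans (∑-cong d λ wa → distribˡ _ _ _) (∑-+ d _ _)

  𝔼-*ˡ : (d : Weighted A) (c : Carrier) (g : A → Carrier) → 𝔼 d (λ a → c * g a) ≈ c * 𝔼 d g
  𝔼-*ˡ d c g = trans (∑-cong d λ wa → solve 3 (λ w c g → w :* (c :* g) := c :* (w :* g)) refl (proj₁ wa) c (g (proj₂ wa))) (∑-*ˡ d c _)

  𝔼-const : (d : Weighted A) → IsDistribution d → ∀ c → 𝔼 d (λ _ → c) ≈ c
  𝔼-const d (_ , total) c = trans (∑-cong d λ wa → *-comm _ c) (trans (∑-*ˡ d c proj₁) (trans (*-congˡ total) (*-identityʳ c)))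

  𝔼-∑ : (d : Weighted A) (ys : List B) (g : B → A → Carrier) → 𝔼 d (λ a → ∑ ys (λ y → g y a)) ≈ ∑ ys (λ y → 𝔼 d (g y))
  𝔼-∑ d ys g = trans (∑-cong d λ wa → sym (∑-*ˡ ys (proj₁ wa) (λ y → g y (proj₂ wa)))) (∑-swap d ys _)

  𝔼-≤-const : (d : Weighted A) → IsDistribution d → {g : A → Carrier} {c : Carrier} →
              (∀ a → Possible d a → g a ≤ c) → 𝔼 d g ≤ c
  𝔼-≤-const d D {c = c} e = ≤-respʳ (𝔼-const d D c) (𝔼-mono d (nonneg-weights D) e)

  𝔼->>= : (d : Weighted A) (κ : A → Weighted B) (g : B → Carrier) → 𝔼 (d >>= κ) g ≈ 𝔼 d (λ a → 𝔼 (κ a) g)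
  𝔼->>= d κ g = trans (∑-concatMap _ d _) (∑-cong d λ { (w , a) →
    trans (reflexive (∑-map _ (κ a) _)) (trans (∑-cong (κ a) λ vb → *-assoc w _ _) (∑-*ˡ (κ a) w _)) })

  𝔼-point : (a : A) (g : A → Carrier) → 𝔼 (point a) g ≈ g a
  𝔼-point a g = trans (+-identityʳ _) (*-identityˡ _)

  ∈->>= : (d : Weighted A) (κ : A → Weighted B) {w v : Carrier} {a : A} {b : B} →
          (w , a) ∈ d → (v , b) ∈ κ a → (w * v , b) ∈ (d >>= κ)
  ∈->>= (x ∷ d) κ (here ≡.refl) j = ∈-++⁺ˡ (∈-map⁺ _ j)
  ∈->>= (x ∷ d) κ (there i)     j = ∈-++⁺ʳ (map _ (κ (proj₂ x))) (∈->>= d κ i j)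

  ∈->>=⁻ : (d : Weighted A) (κ : A → Weighted B) {u : Carrier} {b : B} → (u , b) ∈ (d >>= κ) →
           ∃ λ w → ∃ λ a → ∃ λ v → (w , a) ∈ d × (v , b) ∈ κ a × u ≡ w * v
  ∈->>=⁻ (x ∷ d) κ i with ∈-++⁻ (map _ (κ (proj₂ x))) i
  ... | inj₁ j with ∈-map⁻ _ j
  ...   | (v , _) , k , ≡.refl = proj₁ x , proj₂ x , v , here ≡.refl , k , ≡.refl
  ∈->>=⁻ (x ∷ d) κ i | inj₂ j with ∈->>=⁻ d κ j
  ...   | w , a , v , p , q , e = w , a , v , there p , q , e

  Possible->>= : (d : Weighted A) (κ : A → Weighted B) {a : A} {b : B} →
                 Possible d a → Possible (κ a) b → Possible (d >>= κ) b
  Possible->>= d κ (w , i , 0<w) (v , j , 0<v) = w * v , ∈->>= d κ i j , *-positive 0<w 0<v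

  factors-positive : ∀ {x y} → 0# ≤ x → 0# ≤ y → 0# < x * y → ¬ ¬ (0# < x × 0# < y)
  factors-positive {x} {y} 0≤x 0≤y 0<xy k = x≯0 λ 0<x → y≯0 λ 0<y → k (0<x , 0<y)
    where
    x≯0 : ¬ ¬ (0# < x)
    x≯0 n = <-irrefl (sym (trans (*-congʳ (0≤x⇒¬0<x⇒x≈0 0≤x n)) (zeroˡ y))) 0<xy
    y≯0 : ¬ ¬ (0# < y)
    y≯0 n = <-irrefl (sym (trans (*-congˡ (0≤x⇒¬0<x⇒x≈0 0≤y n)) (zeroʳ x))) 0<xy

  Possible->>=⁻ : (d : Weighted A) (κ : A → Weighted B) → Nonneg d → (∀ a → Nonneg (κ a)) → {b : B} →
                  Possible (d >>= κ) b → ¬ ¬ (∃ λ a → Possible d a × Possible (κ a) b)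
  Possible->>=⁻ d κ nn nnκ (u , i , 0<u) k with ∈->>=⁻ d κ i
  ... | w , a , v , p , q , ≡.refl =
    factors-positive (nn p) (nnκ a q) 0<u λ { (0<w , 0<v) → k (a , (w , p , 0<w) , (v , q , 0<v)) }

  >>=-distribution : (d : Weighted A) (κ : A → Weighted B) → IsDistribution d → (∀ a → IsDistribution (κ a)) → IsDistribution (d >>= κ)
  >>=-distribution d κ D K = nn d (proj₁ D) , total
    where
    nn : ∀ d → All (λ wa → 0# ≤ proj₁ wa) d → All (λ wa → 0# ≤ proj₁ wa) (d >>= κ)
    nn [] [] = []
    nn ((w , a) ∷ d) (p ∷ ps) = Allₚ.++⁺ (Allₚ.map⁺ (All.map (λ q → 0≤* p q) (proj₁ (K a)))) (nn d ps)
    mass : ∀ {C} (d : Weighted C) → sum (map proj₁ d) ≈ 𝔼 d (λ _ → 1#)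
    mass d = ∑-cong d λ wa → sym (*-identityʳ _)
    total : sum (map proj₁ (d >>= κ)) ≈ 1#
    total = trans (mass (d >>= κ)) (trans (𝔼->>= d κ _) (trans (𝔼-cong d λ a → 𝔼-const (κ a) (K a) 1#) (𝔼-const d D 1#)))

  point-distribution : (a : A) → IsDistribution (point a)
  point-distribution a = 0≤1 ∷ [] , +-identityʳ 1#

  module Probability (_≟_ : DecidableEquality A) where

    prob : Weighted A → A → Carrier
    prob d a = 𝔼 d (λ a′ → 𝟙 (does (a′ ≟ a)))

    prob>0⇒Possible : (d : Weighted A) {a : A} → 0# < prob d a → Possible d a
    prob>0⇒Possible d {a} 0<p with ∑>0⇒term>0 d 0<p
    ... | (w , a′) , i , 0<t with a′ ≟ a
    ...   | yes ≡.refl = w , i , <-respʳ-≈ (*-identityʳ w) 0<t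
    ...   | no _       = ⊥-elim (<-irrefl (sym (zeroʳ w)) 0<t)

    Possible⇒prob>0 : (d : Weighted A) → Nonneg d → {a : A} → Possible d a → 0# < prob d a
    Possible⇒prob>0 d nn {a} (w , i , 0<w) = <-≤-trans 0<w
      (≤-respˡ w*1≈w (term≤∑ d (λ { {v , b} j → 0≤* (nn j) (𝟙-nonneg (does (b ≟ a))) }) i))
      where
      w*1≈w : w * 𝟙 (does (a ≟ a)) ≈ w
      w*1≈w with a ≟ a
      ... | yes _  = *-identityʳ w
      ... | no a≢a = ⊥-elim (a≢a ≡.refl)

    prob≤1 : (d : Weighted A) → IsDistribution d → ∀ a → prob d a ≤ 1#
    prob≤1 d D a = 𝔼-≤-const d D λ a′ _ → 𝟙≤1 (does (a′ ≟ a))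
      where
      𝟙≤1 : ∀ b → 𝟙 b ≤ 1#
      𝟙≤1 true  = ≤-refl
      𝟙≤1 false = 0≤1

-- Powers and their convexity.

module Powers (ℝ : Reals) where
  open Reals ℝ hiding (zero)
  open OrderedField ℝ
  open SemiringExp semiring public using (_^_; ^-homo-*)

  ^-nonneg : ∀ {x} n → 0# ≤ x → 0# ≤ x ^ n
  ^-nonneg zero    0≤x = 0≤1
  ^-nonneg (suc n) 0≤x = 0≤* 0≤x (^-nonneg n 0≤x)

  ^≤1 : ∀ {x} n → 0# ≤ x → x ≤ 1# → x ^ n ≤ 1#
  ^≤1 zero    0≤x x≤1 = ≤-refl
  ^≤1 (suc n) 0≤x x≤1 = ≤-respʳ (*-identityˡ 1#) (*-mono-≤ (^-nonneg n 0≤x) 0≤1 x≤1 (^≤1 n 0≤x x≤1))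

  1≤^ : ∀ {x} n → 1# ≤ x → 1# ≤ x ^ n
  1≤^ zero    1≤x = ≤-refl
  1≤^ (suc n) 1≤x = ≤-respˡ (*-identityˡ 1#) (*-mono-≤ 0≤1 (≤-trans 0≤1 1≤x) 1≤x (1≤^ n 1≤x))

  ^-antimono : ∀ {x m n} → 0# ≤ x → x ≤ 1# → m ℕ.≤ n → x ^ n ≤ x ^ m
  ^-antimono {n = n} 0≤x x≤1 ℕ.z≤n = ^≤1 n 0≤x x≤1
  ^-antimono {x} 0≤x x≤1 (ℕ.s≤s m≤n) = *-monoˡ-≤ x 0≤x (^-antimono 0≤x x≤1 m≤n)

  -- Convexity of x ↦ x^(d-k) on (0,1], at x as a convex combination of y and 1;
  -- x⁻¹ and y⁻¹ supply the negative powers.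
  module _ {x x⁻¹ y y⁻¹ : Carrier} (0≤y : 0# ≤ y) (y≤x : y ≤ x) (x≤1 : x ≤ 1#)
           (xx⁻¹ : x * x⁻¹ ≈ 1#) (yy⁻¹ : y * y⁻¹ ≈ 1#) (0≤x⁻¹ : 0# ≤ x⁻¹) (1≤y⁻¹ : 1# ≤ y⁻¹) where

    private
      0≤x : 0# ≤ x
      0≤x = ≤-trans 0≤y y≤x

      slack : ∀ {z} → 0# ≤ z → 0# ≤ ((1# - x) * (x - y)) * z
      slack = 0≤* (0≤* (x≤y⇒0≤y-x x≤1) (x≤y⇒0≤y-x y≤x))

    convex-pos : ∀ d → (1# - y) * x ^ d ≤ (x - y) + (1# - x) * y ^ d
    convex-pos zero = ≈⇒≤ (solve 2 (λ x y → (con (+ 1) :- y) :* con (+ 1) := (x :- y) :+ (con (+ 1) :- x) :* con (+ 1)) refl x y)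
    convex-pos (suc d) = ≤-trans
      (≤-respˡ (solve 3 (λ x y X → x :* ((con (+ 1) :- y) :* X) := (con (+ 1) :- y) :* (x :* X)) refl x y (x ^ d))
        (*-monoˡ-≤ x 0≤x (convex-pos d)))
      (≤-by-difference (((1# - x) * (x - y)) * (1# - y ^ d))
        (solve 3 (λ x y Y → ((x :- y) :+ (con (+ 1) :- x) :* (y :* Y)) :- x :* ((x :- y) :+ (con (+ 1) :- x) :* Y)
                 := ((con (+ 1) :- x) :* (x :- y)) :* (con (+ 1) :- Y)) refl x y (y ^ d))
        (slack (x≤y⇒0≤y-x (^≤1 d 0≤y (≤-trans y≤x x≤1)))))

    convex-neg : ∀ k → (1# - y) * x⁻¹ ^ k ≤ (x - y) + (1# - x) * y⁻¹ ^ k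
    convex-neg zero = ≈⇒≤ (solve 2 (λ x y → (con (+ 1) :- y) :* con (+ 1) := (x :- y) :+ (con (+ 1) :- x) :* con (+ 1)) refl x y)
    convex-neg (suc k) = ≤-trans
      (≤-respˡ (solve 3 (λ z y X → z :* ((con (+ 1) :- y) :* X) := (con (+ 1) :- y) :* (z :* X)) refl x⁻¹ y (x⁻¹ ^ k))
        (*-monoˡ-≤ x⁻¹ 0≤x⁻¹ (convex-neg k)))
      (≤-by-difference ((((1# - x) * (x - y)) * x⁻¹) * (y⁻¹ * y⁻¹ ^ k - 1#)) difference
        (0≤* (slack 0≤x⁻¹) (x≤y⇒0≤y-x (1≤^ (suc k) 1≤y⁻¹))))
      where
      Y = y⁻¹ ^ k
      difference : ((x - y) + (1# - x) * (y⁻¹ * Y)) - x⁻¹ * ((x - y) + (1# - x) * Y)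
                   ≈ (((1# - x) * (x - y)) * x⁻¹) * (y⁻¹ * Y - 1#)
      difference = trans
        (solve 5 (λ x y x⁻¹ y⁻¹ Y →
          ((x :- y) :+ (con (+ 1) :- x) :* (y⁻¹ :* Y)) :- x⁻¹ :* ((x :- y) :+ (con (+ 1) :- x) :* Y)
          := (((con (+ 1) :- x) :* (x :- y)) :* x⁻¹) :* (y⁻¹ :* Y :- con (+ 1))
             :+ ((con (+ 1) :- x) :* (y⁻¹ :* Y) :+ (x :- y)) :* (con (+ 1) :- x :* x⁻¹)
             :+ ((con (+ 1) :- x) :* (x⁻¹ :* Y)) :* (y :* y⁻¹ :- con (+ 1))) refl x y x⁻¹ y⁻¹ Y)
        (trans (+-cong (+-congˡ (trans (*-congˡ (trans (+-congˡ (-‿cong xx⁻¹)) (-‿inverseʳ 1#))) (zeroʳ _)))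
                       (trans (*-congˡ (trans (+-congʳ yy⁻¹) (-‿inverseʳ 1#))) (zeroʳ _)))
          (trans (+-identityʳ _) (+-identityʳ _)))

    private
      peel : ∀ {z z⁻¹} k d → z * z⁻¹ ≈ 1# → z⁻¹ ^ suc k * z ^ suc d ≈ z⁻¹ ^ k * z ^ d
      peel {z} {z⁻¹} k d zz⁻¹ = trans
        (solve 4 (λ z z⁻¹ A B → (z⁻¹ :* A) :* (z :* B) := (z :* z⁻¹) :* (A :* B)) refl z z⁻¹ (z⁻¹ ^ k) (z ^ d))
        (trans (*-congʳ zz⁻¹) (*-identityˡ _))

    -- Common powers cancel in pairs until one of the two exponents is zero.
    convex : ∀ k d → (1# - y) * (x⁻¹ ^ k * x ^ d) ≤ (x - y) + (1# - x) * (y⁻¹ ^ k * y ^ d)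
    convex zero    d       = ≤-respˡ (*-congˡ (sym (*-identityˡ _))) (≤-respʳ (+-congˡ (*-congˡ (sym (*-identityˡ _)))) (convex-pos d))
    convex (suc k) zero    = ≤-respˡ (*-congˡ (sym (*-identityʳ _))) (≤-respʳ (+-congˡ (*-congˡ (sym (*-identityʳ _)))) (convex-neg (suc k)))
    convex (suc k) (suc d) = ≤-respˡ (*-congˡ (sym (peel k d xx⁻¹))) (≤-respʳ (+-congˡ (*-congˡ (sym (peel k d yy⁻¹)))) (convex k d))

-- The shares of the special elements and the inductive lower bound.

module Parameters (ℝ : Reals) where
  open Reals ℝ hiding (zero)
  open Arithmetic ℝ
  open OrderedField ℝ
  open Powers ℝ

  -- The increments of τ exceed 2 by η = Y / τ, where Y grows just fast enough for τ-growth.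
  Y : ℕ → Carrier
  Y n = ι 3 * (H (2 ℕ.+ n) - H 2)

  -- Each value carries its positivity because the next one divides by it.
  τ⁺ : ℕ → Σ Carrier (0# <_)
  η  : ℕ → Carrier
  0≤η : ∀ n → 0# ≤ η n
  0≤Y : ∀ n → 0# ≤ Y n

  τ⁺ zero    = ι 2 , ι-positive 2
  τ⁺ (suc n) = proj₁ (τ⁺ n) + (ι 2 + η n) , 0<+ (proj₂ (τ⁺ n)) (0≤+ (0≤ι 2) (0≤η n))

  η n = Y n * recip (proj₁ (τ⁺ n)) (proj₂ (τ⁺ n))

  0≤η n = 0≤* (0≤Y n) (<⇒≤ (recip-positive _ _))

  H-mono : ∀ m n → H m ≤ H (n ℕ.+ m)
  H-mono m zero    = ≤-refl
  H-mono m (suc n) = ≤-trans (H-mono m n) (≤-respˡ (+-identityʳ _) (+-monoʳ-≤ _ (<⇒≤ (recip-positive _ _))))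

  0≤Y n = 0≤* (0≤ι 3) (x≤y⇒0≤y-x (≤-respʳ (reflexive (≡.cong H (ℕₚ.+-comm n 2))) (H-mono 2 n)))

  τ : ℕ → Carrier
  τ n = proj₁ (τ⁺ n)

  0<τ : ∀ n → 0# < τ n
  0<τ n = proj₂ (τ⁺ n)

  τη≈Y : ∀ n → τ n * η n ≈ Y n
  τη≈Y n = trans (solve 3 (λ t y r → t :* (y :* r) := (t :* r) :* y) refl (τ n) (Y n) _)
    (trans (*-congʳ (recip-inverse (τ n) (0<τ n))) (*-identityˡ _))

  Y-suc : ∀ n → Y (suc n) ≈ Y n + ι 3 * 1/ (3 ℕ.+ n)
  Y-suc n = solve 3 (λ h d h₂ → con (+ 3) :* ((h :+ d) :- h₂) := con (+ 3) :* (h :- h₂) :+ con (+ 3) :* d) refl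
    (H (2 ℕ.+ n)) (1/ (3 ℕ.+ n)) (H 2)

  Y-zero : Y 0 ≈ 0#
  Y-zero = trans (*-congˡ (-‿inverseʳ (H 2))) (zeroʳ _)

  τ-lower : ∀ n → ι 2 + ι 2 * ι n ≤ τ n
  τ-lower zero    = ≈⇒≤ (trans (+-congˡ (zeroʳ _)) (+-identityʳ _))
  τ-lower (suc n) = ≤-by-difference ((τ n - (ι 2 + ι 2 * ι n)) + η n)
    (solve 3 (λ t e n → (t :+ (con (+ 2) :+ e)) :- (con (+ 2) :+ con (+ 2) :* (con (+ 1) :+ n))
                      := (t :- (con (+ 2) :+ con (+ 2) :* n)) :+ e) refl (τ n) (η n) (ι n))
    (0≤+ (x≤y⇒0≤y-x (τ-lower n)) (0≤η n))

  -- The left side grows by 24 times the new reciprocal, the right side by at least 6. This suffices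
  -- once the reciprocal is at most 1/4; the step from 0 to 1 has 1/3, so 1 is a base case of its
  -- own.
  8Y+4≤3τ : ∀ n → ι 8 * Y n + ι 4 ≤ ι 3 * τ n
  8Y+4≤3τ zero = ≤-by-difference (ι 2)
    (trans (+-congˡ (-‿cong (+-congʳ (*-congˡ Y-zero))))
      (solve 0 (con (+ 3) :* con (+ 2) :- (con (+ 8) :* con (+ 0) :+ con (+ 4)) := con (+ 2)) refl)) (0≤ι 2)
  8Y+4≤3τ (suc zero) = ≤-by-difference (ι 3 * η 0)
    (trans (+-congˡ (-‿cong (+-congʳ (*-congˡ (trans (Y-suc 0) (+-cong Y-zero (recip-inverse _ _)))))))
      (solve 1 (λ e → con (+ 3) :* (con (+ 2) :+ (con (+ 2) :+ e)) :- (con (+ 8) :* (con (+ 0) :+ con (+ 1)) :+ con (+ 4)) := con (+ 3) :* e) refl (η 0)))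
    (0≤* (0≤ι 3) (0≤η 0))
  8Y+4≤3τ (suc (suc n)) = ≤-by-difference ((ι 3 * t - (ι 8 * y + ι 4)) + (ι 6 * (1# - ι 4 * d) + ι 3 * e))
    (trans (+-congˡ (-‿cong (+-congʳ (*-congˡ (Y-suc (suc n))))))
      (solve 4 (λ t e y d → con (+ 3) :* (t :+ (con (+ 2) :+ e)) :- (con (+ 8) :* (y :+ con (+ 3) :* d) :+ con (+ 4))
         := (con (+ 3) :* t :- (con (+ 8) :* y :+ con (+ 4))) :+ (con (+ 6) :* (con (+ 1) :- con (+ 4) :* d) :+ con (+ 3) :* e)) refl t e y d))
    (0≤+ (x≤y⇒0≤y-x (8Y+4≤3τ (suc n))) (0≤+ (0≤* (0≤ι 6) (x≤y⇒0≤y-x 4d≤1)) (0≤* (0≤ι 3) (0≤η (suc n)))))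
    where
    t = τ (suc n)
    e = η (suc n)
    y = Y (suc n)
    d = 1/ (4 ℕ.+ n)
    4d≤1 : ι 4 * d ≤ 1#
    4d≤1 = ≤-respʳ (recip-inverse (ι (4 ℕ.+ n)) _)
      (*-monoʳ-≤ d (<⇒≤ (recip-positive _ _)) (ι-mono-≤ (ℕₚ.m≤m+n 4 n)))

  8η≤3 : ∀ n → ι 8 * η n ≤ ι 3
  8η≤3 n = *-cancelˡ-≤ (τ n) (0<τ n)
    (≤-respˡ (trans (*-congˡ (sym (τη≈Y n))) (solve 2 (λ t e → con (+ 8) :* (t :* e) := t :* (con (+ 8) :* e)) refl (τ n) (η n)))
      (≤-respʳ (*-comm _ _) (≤-trans (≤-respˡ (+-identityʳ _) (+-monoʳ-≤ _ (0≤ι 4))) (8Y+4≤3τ n))))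

  -- With s = τ (n+1), this is what makes the bounds of consecutive stages fit together.
  τ-growth : ∀ n → (τ (suc n) * τ (suc n)) * (ι 2 + η n) ≤
                   (τ (suc n) - 1#) * ((τ (suc n) + 1# + η (suc n)) * (ι 2 + η (suc n)))
  -- The difference contains `s * e - τ n * e′`, which is the increment `3 / (n + 3)` of `Y`. Its
  -- coefficient is at least `s + 2 ≥ 2 (n + 3)`, so it gains at least 6; the other two terms are
  -- losses bounded through `8η≤3`.
  τ-growth n = ≤-by-difference (((s + ι 2 + e + e′) * (ι 3 * d)) - ((ι 2 + e′) * e′ * (ι 2 + e′ + e)) - (1# + e) * (ι 2 + e))
    (trans
      (solve 3 (λ s′ e′ e → let s = s′ :+ (con (+ 2) :+ e′) in
        (s :- con (+ 1)) :* ((s :+ con (+ 1) :+ e) :* (con (+ 2) :+ e)) :- (s :* s) :* (con (+ 2) :+ e′)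
        := ((s :+ con (+ 2) :+ e :+ e′) :* (s :* e :- s′ :* e′)) :- ((con (+ 2) :+ e′) :* e′ :* (con (+ 2) :+ e′ :+ e)) :- (con (+ 1) :+ e) :* (con (+ 2) :+ e))
        refl (τ n) e′ e)
      (+-congʳ (+-congʳ (*-congˡ (trans (+-cong (τη≈Y (suc n)) (-‿cong (τη≈Y n))) (trans (+-congʳ (Y-suc n))
        (solve 2 (λ y z → (y :+ z) :- y := z) refl (Y n) (ι 3 * d))))))))
    (*-cancelˡ-≤ (ι 512) (ι-positive 512) (≤-respˡ (sym (zeroʳ _)) (≤-respʳ (sym rearrange)
      (0≤+ (0≤+ (x≤y⇒0≤y-x first) (x≤y⇒0≤y-x second)) (0≤+ (x≤y⇒0≤y-x third) (0≤ι 146))))))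
    where
    s  = τ (suc n)
    e  = η (suc n)
    e′ = η n
    d  = 1/ (3 ℕ.+ n)
    a  = ι 8 * e′
    b  = ι 8 * e
    A = (s + ι 2 + e + e′) * (ι 3 * d)
    B = (ι 16 + a) * a * (ι 16 + a + b)
    C = (ι 8 + b) * (ι 16 + b)
    0≤8η : ∀ m → 0# ≤ ι 8 * η m
    0≤8η m = 0≤* (0≤ι 8) (0≤η m)
    0≤d : 0# ≤ d
    0≤d = <⇒≤ (recip-positive _ _)
    -- The scale 8³ clears the denominators of a cubic in `e` and `e′`. As `a` and `b` are at most
    -- 3, the losses are at most 19 * 3 * 22 = 1254 and 8 * 11 * 19 = 1672; the gain 6 * 512 = 3072
    -- leaves 146.
    rearrange : ι 512 * (A - ((ι 2 + e′) * e′ * (ι 2 + e′ + e)) - (1# + e) * (ι 2 + e))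
                ≈ ((ι 512 * A - ι 3072) + (ι 1254 - B)) + ((ι 1672 - ι 8 * C) + ι 146)
    rearrange = solve 3 (λ A e′ e → let a = con (+ 8) :* e′ ; b = con (+ 8) :* e in
      con (+ 512) :* (A :- ((con (+ 2) :+ e′) :* e′ :* (con (+ 2) :+ e′ :+ e)) :- (con (+ 1) :+ e) :* (con (+ 2) :+ e))
      := ((con (+ 512) :* A :- con (+ 3072)) :+ (con (+ 1254) :- (con (+ 16) :+ a) :* a :* (con (+ 16) :+ a :+ b)))
         :+ ((con (+ 1672) :- con (+ 8) :* ((con (+ 8) :+ b) :* (con (+ 16) :+ b))) :+ con (+ 146))) refl A e′ e
    first : ι 3072 ≤ ι 512 * A
    first = ≤-respˡ (solve 0 (con (+ 512) :* con (+ 6) := con (+ 3072)) refl) (*-monoˡ-≤ (ι 512) (0≤ι 512)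
      (≤-trans (≈⇒≤ (trans (solve 0 (con (+ 6) := con (+ 6) :* con (+ 1)) refl) (trans (*-congˡ (sym (recip-inverse (ι (3 ℕ.+ n)) (ι-positive (3 ℕ.+ n)))))
          (solve 2 (λ n d → con (+ 6) :* ((con (+ 1) :+ (con (+ 1) :+ (con (+ 1) :+ n))) :* d) := (con (+ 6) :+ con (+ 2) :* n) :* (con (+ 3) :* d)) refl (ι n) d))))
        (*-monoʳ-≤ (ι 3 * d) (0≤* (0≤ι 3) 0≤d)
          (≤-by-difference ((s - (ι 2 + ι 2 * ι (suc n))) + (e + e′))
            (solve 4 (λ s e e′ n → (s :+ con (+ 2) :+ e :+ e′) :- (con (+ 6) :+ con (+ 2) :* n)
               := (s :- (con (+ 2) :+ con (+ 2) :* (con (+ 1) :+ n))) :+ (e :+ e′)) refl s e e′ (ι n))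
            (0≤+ (x≤y⇒0≤y-x (τ-lower (suc n))) (0≤+ (0≤η (suc n)) (0≤η n)))))))
    second : B ≤ ι 1254
    second = ≤-respʳ (solve 0 ((con (+ 16) :+ con (+ 3)) :* con (+ 3) :* (con (+ 16) :+ con (+ 3) :+ con (+ 3)) := con (+ 1254)) refl)
      (*-mono-≤ (0≤+ (0≤+ (0≤ι 16) (0≤8η n)) (0≤8η (suc n))) (0≤* (0≤+ (0≤ι 16) (0≤ι 3)) (0≤ι 3))
        (*-mono-≤ (0≤8η n) (0≤+ (0≤ι 16) (0≤ι 3)) (+-monoʳ-≤ _ (8η≤3 n)) (8η≤3 n))
        (+-mono-≤ (+-monoʳ-≤ _ (8η≤3 n)) (8η≤3 (suc n))))
    third : ι 8 * C ≤ ι 1672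
    third = ≤-respʳ (solve 0 (con (+ 8) :* ((con (+ 8) :+ con (+ 3)) :* (con (+ 16) :+ con (+ 3))) := con (+ 1672)) refl)
      (*-monoˡ-≤ (ι 8) (0≤ι 8) (*-mono-≤ (0≤+ (0≤ι 16) (0≤8η (suc n))) (0≤+ (0≤ι 8) (0≤ι 3))
        (+-monoʳ-≤ _ (8η≤3 (suc n))) (+-monoʳ-≤ _ (8η≤3 (suc n)))))

  κ : ℕ → Carrier
  κ n = recip (τ n) (0<τ n)

  τκ≈1 : ∀ n → τ n * κ n ≈ 1#
  τκ≈1 n = recip-inverse (τ n) (0<τ n)

  0<κ : ∀ n → 0# < κ n
  0<κ n = recip-positive (τ n) (0<τ n)

  ρ : ℕ → Carrier
  ρ n = 1# - κ n

  1-ρ≈κ : ∀ n → 1# - ρ n ≈ κ n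
  1-ρ≈κ n = solve 1 (λ k → con (+ 1) :- (con (+ 1) :- k) := k) refl (κ n)

  2κ≤1 : ∀ n → ι 2 * κ n ≤ 1#
  2κ≤1 n = ≤-respʳ (τκ≈1 n) (*-monoʳ-≤ (κ n) (<⇒≤ (0<κ n))
    (≤-trans (≤-respˡ (+-identityʳ _) (+-monoʳ-≤ (ι 2) (0≤* (0≤ι 2) (0≤ι n)))) (τ-lower n)))

  κ≤ρ : ∀ n → κ n ≤ ρ n
  κ≤ρ n = ≤-by-difference (1# - ι 2 * κ n)
    (solve 1 (λ k → (con (+ 1) :- k) :- k := con (+ 1) :- con (+ 2) :* k) refl (κ n)) (x≤y⇒0≤y-x (2κ≤1 n))

  0<ρ : ∀ n → 0# < ρ n
  0<ρ n = <-≤-trans (0<κ n) (κ≤ρ n)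

  0≤ρ : ∀ n → 0# ≤ ρ n
  0≤ρ n = <⇒≤ (0<ρ n)

  ρ≤1 : ∀ n → ρ n ≤ 1#
  ρ≤1 n = ≤-by-difference (κ n) (1-ρ≈κ n) (<⇒≤ (0<κ n))

  σ : ℕ → Carrier
  σ n = recip (ρ n) (0<ρ n)

  ρσ≈1 : ∀ n → ρ n * σ n ≈ 1#
  ρσ≈1 n = recip-inverse (ρ n) (0<ρ n)

  0≤σ : ∀ n → 0# ≤ σ n
  0≤σ n = <⇒≤ (recip-positive _ _)

  1≤σ : ∀ n → 1# ≤ σ n
  1≤σ n = ≤-respˡ (ρσ≈1 n) (≤-respʳ (*-identityˡ _) (*-monoʳ-≤ (σ n) (0≤σ n) (ρ≤1 n)))

  E : ℕ → Carrier
  E n = (τ n + 1# + η n) * (ι 2 + η n)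

  0<E : ∀ n → 0# < E n
  0<E n = *-positive (0<+ (0<+ (0<τ n) 0≤1) (0≤η n)) (0<+ (ι-positive 2) (0≤η n))

  -- This is the solution of `balance` in `lower-step`: with this factor the bound inherited from
  -- the later players becomes an exact multiple of the right side of `convex`. Its denominator
  -- `E n` equals `(τ (suc n) - 1) * (2 + η n)`.
  c : ℕ → Carrier
  c n = τ n * recip (E n) (0<E n)

  Ec≈τ : ∀ n → E n * c n ≈ τ n
  Ec≈τ n = trans (solve 3 (λ e t r → e :* (t :* r) := (e :* r) :* t) refl (E n) (τ n) _)
    (trans (*-congʳ (recip-inverse (E n) (0<E n))) (*-identityˡ _))

  0≤c : ∀ n → 0# ≤ c n
  0≤c n = 0≤* (<⇒≤ (0<τ n)) (<⇒≤ (recip-positive _ _))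

  -- A lower bound for the weight that b items leave uncovered when n + 1 senders
  -- (and the last player) remain.
  lower : ℕ → ℕ → Carrier
  lower n b = c n * (σ n ^ suc n * ρ n ^ b)

  lower-antimono : ∀ n {b b′} → b ℕ.≤ b′ → lower n b′ ≤ lower n b
  lower-antimono n b≤b′ = *-monoˡ-≤ (c n) (0≤c n)
    (*-monoˡ-≤ (σ n ^ suc n) (^-nonneg (suc n) (0≤σ n)) (^-antimono (0≤ρ n) (ρ≤1 n) b≤b′))

  lower-shift : ∀ n j d → ρ n ^ j * lower n d ≈ lower n (j ℕ.+ d)
  lower-shift n j d = trans
    (solve 4 (λ a c s b → a :* (c :* (s :* b)) := c :* (s :* (a :* b))) refl (ρ n ^ j) (c n) (σ n ^ suc n) (ρ n ^ d))
    (*-congˡ (*-congˡ (sym (^-homo-* (ρ n) j d))))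

  -- After the common factor `ρ ^ j` is removed, this is `convex` between `ρ n`, `ρ (suc n)` and 1
  -- at exponent `d - (n + 1)`. Convexity is an equality at exponents 0 and 1. The normalisation
  -- `σ n ^ suc n` of `lower` puts one pick per remaining player, `d = n + 2`, at exponent 1, so
  -- that convexity loses nothing in that case.
  lower-step : ∀ n j d {u} → lower n d ≤ u →
               lower (suc n) (j ℕ.+ d) ≤ ρ (suc n) ^ j * ((1# - ρ (suc n)) + ρ (suc n) * u)
  lower-step n j d {u} L≤u = ≤-respˡ (lower-shift (suc n) j d)
    (*-monoˡ-≤ (ρ (suc n) ^ j) (^-nonneg j (0≤ρ (suc n))) (*-cancelˡ-≤ (r - r′) 0<r-r′ main))
    where
    s = τ (suc n)
    s′ = τ n
    q = κ (suc n)
    q′ = κ n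
    r = ρ (suc n)
    r′ = ρ n
    Δ = ι 2 + η n
    X = σ (suc n) ^ suc n * r ^ d
    X′ = σ n ^ suc n * r′ ^ d
    0≤q : 0# ≤ q
    0≤q = <⇒≤ (0<κ (suc n))
    0≤qq′ : 0# ≤ q * q′
    0≤qq′ = 0≤* 0≤q (<⇒≤ (0<κ n))
    0≤X : 0# ≤ X
    0≤X = 0≤* (^-nonneg (suc n) (0≤σ (suc n))) (^-nonneg d (0≤ρ (suc n)))

    gap : r - r′ ≈ (q * q′) * Δ
    gap = trans (solve 2 (λ q q′ → (con (+ 1) :- q) :- (con (+ 1) :- q′) := q′ :* con (+ 1) :- q :* con (+ 1)) refl q q′)
      (trans (+-cong (*-congˡ (sym (τκ≈1 (suc n)))) (-‿cong (*-congˡ (sym (τκ≈1 n)))))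
        (solve 4 (λ s′ D q q′ → q′ :* ((s′ :+ D) :* q) :- q :* (s′ :* q′) := (q :* q′) :* D) refl s′ Δ q q′))

    0<r-r′ : 0# < r - r′
    0<r-r′ = <-respʳ-≈ (sym gap) (*-positive (*-positive (0<κ (suc n)) (0<κ n)) (0<+ (ι-positive 2) (0≤η n)))

    r≈q[s-1] : r ≈ q * (s - 1#)
    r≈q[s-1] = trans (+-congʳ (sym (τκ≈1 (suc n)))) (solve 2 (λ s q → s :* q :- q := q :* (s :- con (+ 1))) refl s q)

    balance : r * c n * (r - r′) ≈ q * q
    balance = trans (*-cong (*-congʳ r≈q[s-1]) gap)
      (trans (solve 5 (λ s′ e q q′ c → (q :* ((s′ :+ (con (+ 2) :+ e)) :- con (+ 1)) :* c) :* ((q :* q′) :* (con (+ 2) :+ e))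
                 := (q :* q) :* (q′ :* (((s′ :+ con (+ 1) :+ e) :* (con (+ 2) :+ e)) :* c))) refl s′ (η n) q q′ (c n))
        (trans (*-congˡ (trans (*-congˡ (Ec≈τ n)) (trans (*-comm _ _) (τκ≈1 n)))) (*-identityʳ _)))

    -- This is `τ-growth` in terms of `c` and `ρ`; it makes the factor of the new stage small enough
    -- for the left side of `convex` to dominate.
    cΔ≤r : c (suc n) * Δ ≤ r
    cΔ≤r = *-cancelˡ-≤ (E (suc n)) (0<E (suc n))
      (≤-respˡ (trans (solve 3 (λ s q D → q :* ((s :* s) :* D) := (s :* q) :* (s :* D)) refl s q Δ)
                 (trans (*-congʳ (τκ≈1 (suc n))) (trans (*-identityˡ _) (trans (*-congʳ (sym (Ec≈τ (suc n)))) (*-assoc _ _ _)))))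
        (≤-respʳ (trans (solve 3 (λ s q e → q :* ((s :- con (+ 1)) :* e) := e :* (q :* (s :- con (+ 1)))) refl s q (E (suc n)))
                   (*-congˡ (sym r≈q[s-1])))
          (*-monoˡ-≤ q 0≤q (τ-growth n))))

    convexity : q′ * X ≤ (r - r′) + q * X′
    convexity = ≤-respˡ (*-congʳ (1-ρ≈κ n)) (≤-respʳ (+-congˡ (*-congʳ (1-ρ≈κ (suc n))))
      (convex (0≤ρ n) (≤-by-difference (r - r′) refl (<⇒≤ 0<r-r′)) (ρ≤1 (suc n)) (ρσ≈1 (suc n)) (ρσ≈1 n) (0≤σ (suc n)) (1≤σ n) (suc n) d))

    main : (r - r′) * lower (suc n) d ≤ (r - r′) * ((1# - r) + r * u)
    main = ≤-trans (≤-respˡ (sym left) (*-monoʳ-≤ _ (0≤* 0≤qq′ (0≤* (0≤σ (suc n)) 0≤X)) cΔ≤r))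
      (≤-trans (≤-respˡ (sym middle) (*-monoˡ-≤ q 0≤q convexity))
        (≤-respˡ right (*-monoˡ-≤ (r - r′) (<⇒≤ 0<r-r′) (+-monoʳ-≤ (1# - r) (*-monoˡ-≤ r (0≤ρ (suc n)) L≤u)))))
      where
      left : (r - r′) * lower (suc n) d ≈ (c (suc n) * Δ) * ((q * q′) * (σ (suc n) * X))
      left = trans (*-congʳ gap) (solve 6 (λ k D c s S R → (k :* D) :* (c :* ((s :* S) :* R)) := (c :* D) :* (k :* (s :* (S :* R)))) refl
        (q * q′) Δ (c (suc n)) (σ (suc n)) (σ (suc n) ^ suc n) (r ^ d))
      middle : r * ((q * q′) * (σ (suc n) * X)) ≈ q * (q′ * X)
      middle = trans (solve 5 (λ r q q′ s X → r :* ((q :* q′) :* (s :* X)) := (r :* s) :* (q :* (q′ :* X))) refl r q q′ (σ (suc n)) X)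
        (trans (*-congʳ (ρσ≈1 (suc n))) (*-identityˡ _))
      right : (r - r′) * ((1# - r) + r * lower n d) ≈ q * ((r - r′) + q * X′)
      right = trans (*-congˡ (+-congʳ (1-ρ≈κ (suc n))))
        (trans (solve 5 (λ g q r c X → g :* (q :+ r :* (c :* X)) := q :* g :+ (r :* c :* g) :* X) refl (r - r′) q r (c n) X′)
          (trans (+-congˡ (*-congʳ balance)) (solve 3 (λ g q X → q :* g :+ (q :* q) :* X := q :* (g :+ q :* X)) refl (r - r′) q X′)))

  ρ₀≈κ₀ : ρ 0 ≈ κ 0
  ρ₀≈κ₀ = trans (+-congʳ (sym (τκ≈1 0))) (solve 1 (λ k → con (+ 2) :* k :- k := k) refl (κ 0))

  lower-base : ∀ b → lower 0 b ≤ ρ 0 ^ b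
  lower-base b = ≤-respʳ (*-identityˡ _) (≤-respˡ (trans (*-congʳ (*-congˡ (sym (*-identityʳ _)))) (*-assoc _ _ _))
    (*-monoʳ-≤ (ρ 0 ^ b) (^-nonneg b (0≤ρ 0)) cσ≤1))
    where
    c≤ρ : c 0 ≤ ρ 0
    c≤ρ = *-cancelˡ-≤ (E 0) (0<E 0) (≤-respˡ (sym (Ec≈τ 0)) (≤-by-difference (1# + ((ι 5 * e + e * e) * κ 0))
      (trans (+-congʳ (*-congˡ ρ₀≈κ₀)) (trans
        (solve 2 (λ e k → ((con (+ 2) :+ con (+ 1) :+ e) :* (con (+ 2) :+ e)) :* k :- con (+ 2)
            := (con (+ 3) :* (con (+ 2) :* k) :- con (+ 2)) :+ (con (+ 5) :* e :+ e :* e) :* k) refl e (κ 0))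
        (+-congʳ (trans (+-congʳ (*-congˡ (τκ≈1 0))) (solve 0 (con (+ 3) :* con (+ 1) :- con (+ 2) := con (+ 1)) refl)))))
      (0≤+ 0≤1 (0≤* (0≤+ (0≤* (0≤ι 5) (0≤η 0)) (0≤* (0≤η 0) (0≤η 0))) (<⇒≤ (0<κ 0))))))
      where e = η 0
    cσ≤1 : c 0 * σ 0 ≤ 1#
    cσ≤1 = ≤-respʳ (ρσ≈1 0) (*-monoʳ-≤ (σ 0) (0≤σ 0) c≤ρ)

  private
    σ^kρ^[1+k] : ∀ n k → σ n ^ k * ρ n ^ suc k ≈ ρ n
    σ^kρ^[1+k] n zero    = trans (*-identityˡ _) (*-identityʳ _)
    σ^kρ^[1+k] n (suc k) = trans
      (solve 4 (λ s r S R → (s :* S) :* (r :* R) := (r :* s) :* (S :* R)) refl (σ n) (ρ n) (σ n ^ k) (ρ n ^ suc k))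
      (trans (*-congʳ (ρσ≈1 n)) (trans (*-identityˡ _) (σ^kρ^[1+k] n k)))

    2H₂≈3 : ι 2 * H 2 ≈ ι 3
    2H₂≈3 = trans
      (solve 2 (λ a b → con (+ 2) :* ((con (+ 0) :+ a) :+ b) := con (+ 2) :* (con (+ 1) :* a) :+ con (+ 2) :* b) refl (1/ 1) (1/ 2))
      (trans (+-cong (*-congˡ (trans (*-congʳ (sym ι1≈1)) (recip-inverse _ _))) (recip-inverse _ _))
        (solve 0 (con (+ 2) :* con (+ 1) :+ con (+ 1) := con (+ 3)) refl))

  0≤H : ∀ n → 0# ≤ H n
  0≤H n = ≤-respʳ (reflexive (≡.cong H (ℕₚ.+-identityʳ n))) (H-mono 0 n)

  -- At `b = p` the powers cancel to a single `ρ q`, so the lower bound is `(τ - 1) / E`. Since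
  -- `1 - ratio` is `(p - h - h²) / (2 p - h)`, what remains is
  -- `(p - h - h²) * E ≤ (τ - 1) * (2 p - h)`.
  1-lower≤ratio : ∀ q → 1# - lower q (2 ℕ.+ q) ≤ ratio (2 ℕ.+ q)
  1-lower≤ratio q = *-cancelˡ-≤ D 0<D (*-cancelˡ-≤ (E q) (0<E q)
    (≤-by-difference ((t - 1#) * D - (p - h - h * h) * E q) difference
      (*-cancelˡ-≤ (ι 2) (ι-positive 2) (≤-respˡ (sym (zeroʳ _)) (≤-respʳ (sym certificate) certificate-nonneg)))))
    where
    p = ι (2 ℕ.+ q)
    h = H (2 ℕ.+ q)
    g = H 2
    δ = h - g
    t = τ q
    e = η q
    D = ι 2 * p - h
    0<D = 2p-H-positive (2 ℕ.+ q)

    lower≈cρ : lower q (2 ℕ.+ q) ≈ c q * ρ q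
    lower≈cρ = *-congˡ (σ^kρ^[1+k] q (suc q))

    EDratio : E q * (D * ratio (2 ℕ.+ q)) ≈ E q * (p + h * h)
    EDratio = *-congˡ (trans (solve 3 (λ D a r → D :* (a :* r) := (D :* r) :* a) refl D (p + h * h) _)
      (trans (*-congʳ (recip-inverse D 0<D)) (*-identityˡ _)))

    Ecρ : E q * (c q * ρ q) ≈ t - 1#
    Ecρ = trans (sym (*-assoc _ _ _)) (trans (*-congʳ (Ec≈τ q))
      (trans (solve 2 (λ t k → t :* (con (+ 1) :- k) := t :- t :* k) refl t (κ q)) (+-congˡ (-‿cong (τκ≈1 q)))))

    difference : E q * (D * ratio (2 ℕ.+ q)) - E q * (D * (1# - lower q (2 ℕ.+ q))) ≈ (t - 1#) * D - (p - h - h * h) * E q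
    difference = trans (+-cong EDratio (-‿cong (*-congˡ (*-congˡ (+-congˡ (-‿cong lower≈cρ))))))
      (trans (solve 4 (λ E p h x → E :* (p :+ h :* h) :- E :* ((con (+ 2) :* p :- h) :* (con (+ 1) :- x))
                := (E :* x) :* (con (+ 2) :* p :- h) :- (p :- h :- h :* h) :* E) refl (E q) p h (c q * ρ q))
        (+-congʳ (*-congʳ Ecρ)))

    0≤h = 0≤H (2 ℕ.+ q)
    0≤e = 0≤η q
    0≤δ : 0# ≤ δ
    0≤δ = x≤y⇒0≤y-x (≤-respʳ (reflexive (≡.cong H (ℕₚ.+-comm q 2))) (H-mono 2 q))

    rest = ι 2 * (h + ι 2 * (h * h)) * (t - p) + ι 2 * h + ι 2 * (h + h * h) * (ι 2 + ι 3 * e + t * e + e * e)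
           + p * ((ι 4 - ι 6 * e - ι 2 * (e * e)) + ι 8 * δ + ι 4 * (δ * δ))

    -- The identity holds modulo `t * e = 3 δ` and `2 g = 3`. The solver carries these two
    -- discrepancies as extra products, which then vanish. The summands of `rest` are nonnegative
    -- because `t ≥ p` and `8 e ≤ 3`.
    certificate : ι 2 * ((t - 1#) * D - (p - h - h * h) * E q) ≈ rest
    certificate = trans
      (trans (*-congˡ (+-cong (*-congˡ (+-congˡ (-‿cong h≈g+δ)))
          (-‿cong (*-congʳ (+-cong (+-congˡ (-‿cong h≈g+δ)) (-‿cong (*-cong h≈g+δ h≈g+δ)))))))
        (trans (solve 5 (λ t p g δ e → let h = g :+ δ in
            con (+ 2) :* ((t :- con (+ 1)) :* (con (+ 2) :* p :- h) :- (p :- h :- h :* h) :* ((t :+ con (+ 1) :+ e) :* (con (+ 2) :+ e)))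
            := (con (+ 2) :* (h :+ con (+ 2) :* (h :* h)) :* (t :- p) :+ con (+ 2) :* h
                 :+ con (+ 2) :* (h :+ h :* h) :* (con (+ 2) :+ con (+ 3) :* e :+ t :* e :+ e :* e)
                 :+ p :* ((con (+ 4) :- con (+ 6) :* e :- con (+ 2) :* (e :* e)) :+ con (+ 8) :* δ :+ con (+ 4) :* (δ :* δ)))
               :+ ((con (+ 2) :* p) :* (con (+ 3) :* δ :- t :* e) :+ (p :* (con (+ 2) :* g :+ con (+ 4) :+ con (+ 4) :* δ)) :* (con (+ 2) :* g :- con (+ 3))))
            refl t p g δ e)
          (trans (+-congˡ (trans (+-cong (trans (*-congˡ (trans (+-congˡ (-‿cong (τη≈Y q))) (-‿inverseʳ _))) (zeroʳ _))
              (trans (*-congˡ (trans (+-congʳ 2H₂≈3) (-‿inverseʳ _))) (zeroʳ _))) (+-identityˡ _))) (+-identityʳ _))))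
      (+-congʳ (+-cong (+-cong (*-congʳ (*-congˡ (+-cong (sym h≈g+δ) (*-congˡ (*-cong (sym h≈g+δ) (sym h≈g+δ)))))) (*-congˡ (sym h≈g+δ)))
        (*-congʳ (*-congˡ (+-cong (sym h≈g+δ) (*-cong (sym h≈g+δ) (sym h≈g+δ)))))))
      where
      h≈g+δ : h ≈ g + δ
      h≈g+δ = solve 2 (λ h g → h := g :+ (h :- g)) refl h g

    certificate-nonneg : 0# ≤ rest
    certificate-nonneg = 0≤+ (0≤+ (0≤+
      (0≤* (0≤* (0≤ι 2) (0≤+ 0≤h (0≤* (0≤ι 2) (0≤* 0≤h 0≤h)))) (x≤y⇒0≤y-x p≤t))
      (0≤* (0≤ι 2) 0≤h))
      (0≤* (0≤* (0≤ι 2) (0≤+ 0≤h (0≤* 0≤h 0≤h))) (0≤+ (0≤+ (0≤+ (0≤ι 2) (0≤* (0≤ι 3) 0≤e)) (0≤* (<⇒≤ (0<τ q)) 0≤e)) (0≤* 0≤e 0≤e))))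
      (0≤* (0≤ι (2 ℕ.+ q)) (0≤+ (0≤+ small (0≤* (0≤ι 8) 0≤δ)) (0≤* (0≤ι 4) (0≤* 0≤δ 0≤δ))))
      where
      p≤t : p ≤ t
      p≤t = ≤-trans (≤-by-difference (ι q)
        (solve 1 (λ q → (con (+ 2) :+ con (+ 2) :* q) :- (con (+ 1) :+ (con (+ 1) :+ q)) := q) refl (ι q)) (0≤ι q)) (τ-lower q)
      small : 0# ≤ ι 4 - ι 6 * e - ι 2 * (e * e)
      small = *-cancelˡ-≤ (ι 64) (ι-positive 64) (≤-respˡ (sym (zeroʳ _)) (≤-respʳ
        (solve 1 (λ e → (con (+ 48) :* (con (+ 3) :- con (+ 8) :* e) :+ con (+ 2) :* (con (+ 9) :- (con (+ 8) :* e) :* (con (+ 8) :* e))) :+ con (+ 94)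
             := con (+ 64) :* (con (+ 4) :- con (+ 6) :* e :- con (+ 2) :* (e :* e))) refl e)
        (0≤+ (0≤+ (0≤* (0≤ι 48) (x≤y⇒0≤y-x (8η≤3 q))) (0≤* (0≤ι 2) (x≤y⇒0≤y-x
          (≤-respʳ (solve 0 (con (+ 3) :* con (+ 3) := con (+ 9)) refl)
            (*-mono-≤ (0≤* (0≤ι 8) 0≤e) (0≤ι 3) (8η≤3 q) (8η≤3 q)))))) (0≤ι 94))))

  -- Cleared of the denominator, this is `2 p - h ≤ 2 p + 2 h²`. It turns slack in `ratio * ε` into
  -- slack in `ε`, and a guarantee of at most 1 into `ε ≤ 1`.
  1≤2*ratio : ∀ q → 1# ≤ ι 2 * ratio (2 ℕ.+ q)
  1≤2*ratio q = *-cancelˡ-≤ D 0<D (≤-by-difference (h + ι 2 * (h * h))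
    (trans (+-congʳ (trans (solve 3 (λ D a r → D :* (con (+ 2) :* (a :* r)) := con (+ 2) :* ((D :* r) :* a)) refl D (p + h * h) _)
        (*-congˡ (trans (*-congʳ (recip-inverse D 0<D)) (*-identityˡ _)))))
      (solve 2 (λ p h → con (+ 2) :* (p :+ h :* h) :- (con (+ 2) :* p :- h) :* con (+ 1) := h :+ con (+ 2) :* (h :* h)) refl p h))
    (0≤+ (0≤H (2 ℕ.+ q)) (0≤* (0≤ι 2) (0≤* (0≤H (2 ℕ.+ q)) (0≤H (2 ℕ.+ q))))))
    where
    p = ι (2 ℕ.+ q)
    h = H (2 ℕ.+ q)
    D = ι 2 * p - h
    0<D = 2p-H-positive (2 ℕ.+ q)

-- Boolean membership and intersection of subsets.

∈⇒lookup : ∀ {n} {S : Subset n} {x} → x Subset.∈ S → lookup S x ≡ true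
∈⇒lookup = Vecₚ.[]=⇒lookup

lookup⇒∈ : ∀ {n} {S : Subset n} {x} → lookup S x ≡ true → x Subset.∈ S
lookup⇒∈ {S = S} {x} = Vecₚ.lookup⇒[]= x S

∈⋃⁺ : ∀ {n} {x : Fin n} (Ss : List (Subset n)) {S} → S ∈ Ss → x Subset.∈ S → x Subset.∈ ⋃ Ss
∈⋃⁺ (_ ∷ Ss) (here ≡.refl) x∈S = x∈p∪q⁺ (inj₁ x∈S)
∈⋃⁺ (_ ∷ Ss) (there i)     x∈S = x∈p∪q⁺ (inj₂ (∈⋃⁺ Ss i x∈S))

∈⋃⁻ : ∀ {n} {x : Fin n} (Ss : List (Subset n)) → x Subset.∈ ⋃ Ss → ∃ λ S → S ∈ Ss × x Subset.∈ S
∈⋃⁻ []       x∈⊥ = ⊥-elim (∉⊥ x∈⊥)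
∈⋃⁻ (S ∷ Ss) x∈⋃ with x∈p∪q⁻ S (⋃ Ss) x∈⋃
... | inj₁ x∈S = S , here ≡.refl , x∈S
... | inj₂ x∈⋃Ss with ∈⋃⁻ Ss x∈⋃Ss
...   | T , i , x∈T = T , there i , x∈T

hit : ∀ {n} → Subset n → Subset n → Bool
hit []      []      = false
hit (a ∷ A) (s ∷ S) = (a ∧ s) ∨ hit A S

hit⁺ : ∀ {n} (A S : Subset n) x → lookup A x ≡ true → lookup S x ≡ true → hit A S ≡ true
hit⁺ (true ∷ A) (true ∷ S) zero    ≡.refl ≡.refl = ≡.refl
hit⁺ (a ∷ A)    (s ∷ S)    (suc x) p q with a ∧ s
... | true  = ≡.refl
... | false = hit⁺ A S x p q

hit⁻ : ∀ {n} (A S : Subset n) → hit A S ≡ true → ∃ λ x → lookup A x ≡ true × lookup S x ≡ true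
hit⁻ []          []          ()
hit⁻ (true ∷ A)  (true ∷ S)  _ = zero , ≡.refl , ≡.refl
hit⁻ (true ∷ A)  (false ∷ S) p with hit⁻ A S p
... | x , q , r = suc x , q , r
hit⁻ (false ∷ A) (s ∷ S)     p with hit⁻ A S p
... | x , q , r = suc x , q , r

hit-⊥ : ∀ {n} (S : Subset n) → hit Subset.⊥ S ≡ false
hit-⊥ []      = ≡.refl
hit-⊥ (s ∷ S) = hit-⊥ S

hit-⁅⁆ : ∀ {n} (u : Fin n) (S : Subset n) → hit ⁅ u ⁆ S ≡ lookup S u
hit-⁅⁆ zero (true ∷ S)  = ≡.refl
hit-⁅⁆ zero (false ∷ S) = hit-⊥ S
hit-⁅⁆ (suc u) (s ∷ S)  = hit-⁅⁆ u S

hit-∪ˡ : ∀ {n} (A B S : Subset n) → hit (A ∪ B) S ≡ hit A S ∨ hit B S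
hit-∪ˡ [] [] [] = ≡.refl
hit-∪ˡ (true ∷ A)  (b ∷ B)     (true ∷ S)  = ≡.refl
hit-∪ˡ (false ∷ A) (true ∷ B)  (true ∷ S) with hit A S
... | true  = ≡.refl
... | false = ≡.refl
hit-∪ˡ (false ∷ A) (false ∷ B) (true ∷ S)  = hit-∪ˡ A B S
hit-∪ˡ (true ∷ A)  (true ∷ B)  (false ∷ S) = hit-∪ˡ A B S
hit-∪ˡ (true ∷ A)  (false ∷ B) (false ∷ S) = hit-∪ˡ A B S
hit-∪ˡ (false ∷ A) (true ∷ B)  (false ∷ S) = hit-∪ˡ A B S
hit-∪ˡ (false ∷ A) (false ∷ B) (false ∷ S) = hit-∪ˡ A B S

hit-mono : ∀ {n} (A : Subset n) {S T} → S ⊆ T → hit A S ≡ true → hit A T ≡ true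
hit-mono A {S} {T} S⊆T p with hit⁻ A S p
... | x , q , r = hit⁺ A T x q (∈⇒lookup (S⊆T (lookup⇒∈ r)))

-- Avoidance probabilities of random patterns, and coverage functions.

module Survival (ℝ : Reals) where
  open Reals ℝ hiding (zero)
  open Arithmetic ℝ
  open Model ℝ
  open OrderedField ℝ
  open Sums ℝ
  open Expectation ℝ

  miss : ∀ {n} → Subset n → Subset n → Carrier
  miss A S = 𝟙 (not (hit A S))

  -- The probability that a random pattern avoids the argument.
  record IsSurvival {N} (U : Subset N → Carrier) : Set where
    field
      patterns     : Weighted (Subset N)
      distribution : IsDistribution patterns
      avoids       : ∀ S → U S ≈ 𝔼 patterns (λ A → miss A S)

  absent : ∀ {N} → Fin N → Subset N → Carrier
  absent u S = 𝟙 (not (lookup S u))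

  absent-survival : ∀ {N} (u : Fin N) → IsSurvival (absent u)
  absent-survival u = record
    { patterns     = point ⁅ u ⁆
    ; distribution = point-distribution ⁅ u ⁆
    ; avoids       = λ S → trans (reflexive (≡.cong (λ b → 𝟙 (not b)) (≡.sym (hit-⁅⁆ u S)))) (sym (𝔼-point ⁅ u ⁆ (λ A → miss A S)))
    }

  1-survival : ∀ {N} → IsSurvival {N} (λ _ → 1#)
  1-survival = record
    { patterns     = point Subset.⊥
    ; distribution = point-distribution Subset.⊥
    ; avoids       = λ S → trans (reflexive (≡.cong (λ b → 𝟙 (not b)) (≡.sym (hit-⊥ S)))) (sym (𝔼-point Subset.⊥ (λ A → miss A S)))
    }

  -- Draw the two patterns independently: a set avoids their union exactly when it avoids both.
  *-survival : ∀ {N} {U U′ : Subset N → Carrier} → IsSurvival U → IsSurvival U′ → IsSurvival (λ S → U S * U′ S)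
  *-survival {U = U} {U′} P Q = record
    { patterns     = P.patterns >>= λ A → Q.patterns >>= λ B → point (A ∪ B)
    ; distribution = >>=-distribution _ _ P.distribution λ A → >>=-distribution _ _ Q.distribution λ B → point-distribution _
    ; avoids       = λ S → sym (trans (𝔼->>= P.patterns (λ A → Q.patterns >>= λ B → point (A ∪ B)) _)
        (trans (𝔼-cong P.patterns λ A → trans (𝔼->>= Q.patterns (λ B → point (A ∪ B)) _)
            (trans (𝔼-cong Q.patterns λ B → trans (𝔼-point (A ∪ B) (λ C → miss C S)) (miss-∪ A B S))
              (trans (𝔼-*ˡ Q.patterns (miss A S) _) (trans (*-congˡ (sym (Q.avoids S))) (*-comm _ _)))))
          (trans (𝔼-*ˡ P.patterns (U′ S) _) (trans (*-congˡ (sym (P.avoids S))) (*-comm _ _)))))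
    }
    where
    module P = IsSurvival P
    module Q = IsSurvival Q
    miss-∪ : ∀ A B S → miss (A ∪ B) S ≈ miss A S * miss B S
    miss-∪ A B S rewrite hit-∪ˡ A B S with hit A S
    ... | true  = sym (zeroˡ _)
    ... | false = sym (*-identityˡ _)

  mixture-survival : ∀ {N} {U U′ : Subset N → Carrier} {a b} → 0# ≤ a → 0# ≤ b → a + b ≈ 1# →
                     IsSurvival U → IsSurvival U′ → IsSurvival (λ S → a * U S + b * U′ S)
  mixture-survival {N} {a = a} {b} 0≤a 0≤b a+b≈1 P Q = record
    { patterns     = coin >>= choose
    ; distribution = >>=-distribution coin choose (0≤a ∷ 0≤b ∷ [] , trans (+-congˡ (+-identityʳ b)) a+b≈1)
                       λ { true → P.distribution ; false → Q.distribution }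
    ; avoids       = λ S → sym (trans (𝔼->>= coin choose _)
                       (+-cong (*-congˡ (sym (P.avoids S))) (trans (+-identityʳ _) (*-congˡ (sym (Q.avoids S))))))
    }
    where
    module P = IsSurvival P
    module Q = IsSurvival Q
    coin : Weighted Bool
    coin = (a , true) ∷ (b , false) ∷ []
    choose : Bool → Weighted (Subset N)
    choose c = if c then P.patterns else Q.patterns

  module _ {N} {U : Subset N → Carrier} (P : IsSurvival U) where
    open IsSurvival P

    private
      nn : Nonneg patterns
      nn = nonneg-weights distribution

    1-U≈𝔼hit : ∀ S → 1# - U S ≈ 𝔼 patterns (λ A → 𝟙 (hit A S))
    1-U≈𝔼hit S = trans (+-cong (sym (𝔼-const patterns distribution 1#)) (-‿cong (avoids S)))
      (trans (+-congʳ (trans (𝔼-cong patterns λ A → sym (hit+miss (hit A S))) (𝔼-+ patterns _ _)))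
        (solve 2 (λ h m → (h :+ m) :- m := h) refl _ _))
      where
      hit+miss : ∀ b → 𝟙 b + 𝟙 (not b) ≈ 1#
      hit+miss true  = +-identityʳ 1#
      hit+miss false = +-identityˡ 1#

    0≤U : ∀ S → 0# ≤ U S
    0≤U S = ≤-respʳ (sym (avoids S)) (𝔼-nonneg patterns nn λ A → 𝟙-nonneg (not (hit A S)))

    -- The universe has one point per listed pattern, weighted by its probability, and `w` stands
    -- for the set of patterns containing it. A point is then covered exactly when its pattern hits
    -- `S`.
    1-U-coverage : IsWeightedCoverage (λ S → 1# - U S)
    1-U-coverage = record
      { u          = length patterns
      ; sets       = sets
      ; a          = λ j → proj₁ (List.lookup patterns j)
      ; a-nonneg   = λ j → nn (∈-lookup j)
      ; f-coverage = λ S → trans (1-U≈𝔼hit S)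
          (trans (reflexive (≡.trans (≡.cong (λ L → ∑ L (λ wA → proj₁ wA * 𝟙 (hit (proj₂ wA) S))) (≡.sym lookups)) (∑-map (List.lookup patterns) (allFin (length patterns)) _)))
            (trans (∑-cong (allFin (length patterns)) λ j → *-congˡ (reflexive (≡.cong 𝟙 (≡.sym (covered≡hit S j)))))
              (sym (∑-filter (_∈? covered S) (allFin (length patterns)) _))))
      }
      where
      sets : Fin N → Subset (length patterns)
      sets w = Vec.tabulate λ j → lookup (proj₂ (List.lookup patterns j)) w
      covered : Subset N → Subset (length patterns)
      covered S = ⋃ (map sets (filter (_∈? S) (allFin N)))
      lookups : map (List.lookup patterns) (allFin (length patterns)) ≡ patterns
      lookups = ≡.trans (Listₚ.map-tabulate (λ j → j) (List.lookup patterns)) (Listₚ.tabulate-lookup patterns)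
      covered≡hit : ∀ S j → does (j ∈? covered S) ≡ hit (proj₂ (List.lookup patterns j)) S
      covered≡hit S j with hit (proj₂ (List.lookup patterns j)) S in eq
      ... | true with hit⁻ (proj₂ (List.lookup patterns j)) S eq
      ...   | w , p , q = dec-true (j ∈? covered S) (∈⋃⁺ (map sets (filter (_∈? S) (allFin N)))
                (∈-map⁺ sets (∈-filter⁺ (_∈? S) (∈-allFin w) (lookup⇒∈ q)))
                (lookup⇒∈ (≡.trans (Vecₚ.lookup∘tabulate _ j) p)))
      covered≡hit S j | false = dec-false (j ∈? covered S) λ j∈ → uncovered (∈⋃⁻ (map sets (filter (_∈? S) (allFin N))) j∈)
        where
        uncovered : ¬ (∃ λ T → T ∈ map sets (filter (_∈? S) (allFin N)) × j Subset.∈ T)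
        uncovered (T , T∈ , j∈T) with ∈-map⁻ sets T∈
        ... | w , w∈ , ≡.refl with ≡.trans (≡.sym eq) (hit⁺ (proj₂ (List.lookup patterns j)) S w
                 (≡.trans (≡.sym (Vecₚ.lookup∘tabulate _ j)) (∈⇒lookup j∈T))
                 (∈⇒lookup (proj₂ (∈-filter⁻ (_∈? S) {xs = allFin N} w∈))))
        ...   | ()

    1-U-submodular : IsMonotoneSubmodular (λ S → 1# - U S)
    1-U-submodular = record
      { nonneg     = λ S → ≤-respʳ (sym (1-U≈𝔼hit S)) (𝔼-nonneg patterns nn λ A → 𝟙-nonneg (hit A S))
      ; monotone   = λ S T S⊆T → ≤-respˡ (sym (1-U≈𝔼hit S)) (≤-respʳ (sym (1-U≈𝔼hit T))
          (𝔼-mono patterns nn λ A _ → 𝟙-mono (hit-mono A S⊆T)))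
      ; submodular = λ S T → ≤-respˡ (trans (𝔼-+ patterns _ _) (sym (+-cong (1-U≈𝔼hit _) (1-U≈𝔼hit _))))
          (≤-respʳ (trans (𝔼-+ patterns _ _) (sym (+-cong (1-U≈𝔼hit _) (1-U≈𝔼hit _))))
            (𝔼-mono patterns nn λ A _ → 𝟙-submodular (hit-∪⁻ A S T)
               (hit-mono A (λ x∈ → proj₁ (x∈p∩q⁻ S T x∈))) (hit-mono A (λ x∈ → proj₂ (x∈p∩q⁻ S T x∈)))))
      }
      where
      𝟙-mono : ∀ {a b} → (a ≡ true → b ≡ true) → 𝟙 a ≤ 𝟙 b
      𝟙-mono {false} {b} _ = 𝟙-nonneg b
      𝟙-mono {true} h rewrite h ≡.refl = ≤-refl
      𝟙-submodular : ∀ {u i a b} → (u ≡ true → a ≡ true ⊎ b ≡ true) → (i ≡ true → a ≡ true) → (i ≡ true → b ≡ true) →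
                     𝟙 u + 𝟙 i ≤ 𝟙 a + 𝟙 b
      𝟙-submodular {u} {true}  {a} {b} h p q rewrite p ≡.refl | q ≡.refl = +-monoˡ-≤ 1# (𝟙≤1 u)
        where
        𝟙≤1 : ∀ b → 𝟙 b ≤ 1#
        𝟙≤1 true  = ≤-refl
        𝟙≤1 false = 0≤1
      𝟙-submodular {false} {false} {a} {b} h p q = ≤-respˡ (sym (+-identityʳ 0#)) (0≤+ (𝟙-nonneg a) (𝟙-nonneg b))
      𝟙-submodular {true} {false} {a} {b} h p q with h ≡.refl
      ... | inj₁ ≡.refl = +-monoʳ-≤ 1# (𝟙-nonneg b)
      ... | inj₂ ≡.refl = ≤-respˡ (+-comm 0# 1#) (+-monoˡ-≤ 1# (𝟙-nonneg a))
      hit-∪⁻ : ∀ A S T → hit A (S ∪ T) ≡ true → hit A S ≡ true ⊎ hit A T ≡ true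
      hit-∪⁻ A S T p with hit⁻ A (S ∪ T) p
      ... | x , q , r with x∈p∪q⁻ S T (lookup⇒∈ r)
      ...   | inj₁ x∈S = inj₁ (hit⁺ A S x q (∈⇒lookup x∈S))
      ...   | inj₂ x∈T = inj₂ (hit⁺ A T x q (∈⇒lookup x∈T))

-- Counting and removing the elements of one player.

bit : Bool → ℕ
bit b = if b then 1 else 0

count : ∀ {n N} → (Fin n → Fin N) → Subset N → ℕ
count {zero}  g S = 0
count {suc n} g S = bit (lookup S (g zero)) ℕ.+ count (g ∘ suc) S

remove : ∀ {n N} → (Fin n → Fin N) → Subset N → Subset N
remove {zero}  g S = S
remove {suc n} g S = remove (g ∘ suc) (S [ g zero ]≔ false)

count-cong : ∀ {n N} (g : Fin n → Fin N) {S T} → (∀ x → lookup S (g x) ≡ lookup T (g x)) → count g S ≡ count g T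
count-cong {zero}  g e = ≡.refl
count-cong {suc n} g e = ≡.cong₂ ℕ._+_ (≡.cong bit (e zero)) (count-cong (g ∘ suc) (e ∘ suc))

lookup-remove : ∀ {n N} (g : Fin n → Fin N) S u → (∀ x → u ≢ g x) → lookup (remove g S) u ≡ lookup S u
lookup-remove {zero}  g S u u≢ = ≡.refl
lookup-remove {suc n} g S u u≢ =
  ≡.trans (lookup-remove (g ∘ suc) _ u (u≢ ∘ suc)) (Vecₚ.lookup∘update′ (u≢ zero) S false)

∣update∣ : ∀ {N} (S : Subset N) u → bit (lookup S u) ℕ.+ ∣ S [ u ]≔ false ∣ ≡ ∣ S ∣
∣update∣ (true ∷ S)  zero    = ≡.refl
∣update∣ (false ∷ S) zero    = ≡.refl
∣update∣ (true ∷ S)  (suc u) = ≡.trans (ℕₚ.+-suc _ _) (≡.cong suc (∣update∣ S u))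
∣update∣ (false ∷ S) (suc u) = ∣update∣ S u

count+∣remove∣ : ∀ {n N} (g : Fin n → Fin N) → (∀ {x y} → g x ≡ g y → x ≡ y) → ∀ S →
                 count g S ℕ.+ ∣ remove g S ∣ ≡ ∣ S ∣
count+∣remove∣ {zero}  g inj S = ≡.refl
count+∣remove∣ {suc n} g inj S = ≡.trans (ℕₚ.+-assoc (bit (lookup S (g zero))) _ _)
  (≡.trans (≡.cong (bit (lookup S (g zero)) ℕ.+_)
      (≡.trans (≡.cong (ℕ._+ ∣ remove g S ∣) (count-cong (g ∘ suc) λ x → ≡.sym (Vecₚ.lookup∘update′ (λ e → distinct x (inj e)) S false)))
        (count+∣remove∣ (g ∘ suc) (λ e → Finₚ.suc-injective (inj e)) (S [ g zero ]≔ false))))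
    (∣update∣ S (g zero)))
  where
  distinct : ∀ (x : Fin n) → suc x ≢ zero
  distinct x ()

∈⇒1≤∣∣ : ∀ {N} (S : Subset N) u → lookup S u ≡ true → 1 ℕ.≤ ∣ S ∣
∈⇒1≤∣∣ (true ∷ S)  _       _ = ℕ.s≤s ℕ.z≤n
∈⇒1≤∣∣ (false ∷ S) (suc u) p = ∈⇒1≤∣∣ S u p

-- The hard coverage function.

module HardFunction (ℝ : Reals) where
  open Reals ℝ hiding (zero)
  open OrderedField ℝ
  open Sums ℝ
  open Powers ℝ
  open Parameters ℝ
  open Survival ℝ

  prod : ∀ {n} → (Fin n → Carrier) → Carrier
  prod {zero}  h = 1#
  prod {suc n} h = h zero * prod (h ∘ suc)

  -- Skipping a factor, instead of dividing by it, keeps the expression a product of avoidance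
  -- probabilities.
  prodBut : ∀ {n} → Fin n → (Fin n → Carrier) → Carrier
  prodBut zero            h = prod (h ∘ suc)
  prodBut (suc {suc n} t) h = h zero * prodBut t (h ∘ suc)

  prodBut-* : ∀ {n} (t : Fin n) h → prodBut t h * h t ≈ prod h
  prodBut-* zero            h = *-comm _ _
  prodBut-* (suc {suc n} t) h = trans (*-assoc _ _ _) (*-congˡ (prodBut-* t (h ∘ suc)))

  prod-cong : ∀ {n} {h k : Fin n → Carrier} → (∀ x → h x ≈ k x) → prod h ≈ prod k
  prod-cong {zero}  e = refl
  prod-cong {suc n} e = *-cong (e zero) (prod-cong (e ∘ suc))

  prodBut-cong : ∀ {n} (t : Fin n) {h k : Fin n → Carrier} → (∀ x → h x ≈ k x) → prodBut t h ≈ prodBut t k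
  prodBut-cong zero            e = prod-cong (e ∘ suc)
  prodBut-cong (suc {suc n} t) e = *-cong (e zero) (prodBut-cong t (e ∘ suc))

  prod-1 : ∀ n → prod {n} (λ _ → 1#) ≈ 1#
  prod-1 zero    = refl
  prod-1 (suc n) = trans (*-identityˡ _) (prod-1 n)

  prod-survival : ∀ {n N} (h : Fin n → Subset N → Carrier) → (∀ x → IsSurvival (h x)) → IsSurvival (λ S → prod (λ x → h x S))
  prod-survival {zero}  h P = 1-survival
  prod-survival {suc n} h P = *-survival (P zero) (prod-survival (h ∘ suc) (P ∘ suc))

  prodBut-survival : ∀ {n N} (t : Fin n) (h : Fin n → Subset N → Carrier) → (∀ x → IsSurvival (h x)) →
                     IsSurvival (λ S → prodBut t (λ x → h x S))
  prodBut-survival zero            h P = prod-survival (h ∘ suc) (P ∘ suc)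
  prodBut-survival (suc {suc n} t) h P = *-survival (P zero) (prodBut-survival t (h ∘ suc) (P ∘ suc))

  absent-∉ : ∀ {N} (u : Fin N) S → lookup S u ≡ false → absent u S ≈ 1#
  absent-∉ u S p rewrite p = refl

  absent-∈ : ∀ {N} (u : Fin N) S → lookup S u ≡ true → absent u S ≈ 0#
  absent-∈ u S p rewrite p = refl

  -- The factor `1#` stays so that the expression is literally a mixture of `1-survival` and
  -- `absent-survival`.
  keep : ∀ {N} → Carrier → Fin N → Subset N → Carrier
  keep x u S = x * 1# + (1# - x) * absent u S

  keep-∉ : ∀ {N} x (u : Fin N) S → lookup S u ≡ false → keep x u S ≈ 1#
  keep-∉ x u S p = trans (+-congˡ (*-congˡ (absent-∉ u S p))) (solve 1 (λ x → x :* con (+ 1) :+ (con (+ 1) :- x) :* con (+ 1) := con (+ 1)) refl x)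

  keep≈^ : ∀ {N} x (u : Fin N) S → keep x u S ≈ x ^ bit (lookup S u)
  keep≈^ x u S with lookup S u
  ... | true  = solve 1 (λ x → x :* con (+ 1) :+ (con (+ 1) :- x) :* con (+ 0) := x :* con (+ 1)) refl x
  ... | false = solve 1 (λ x → x :* con (+ 1) :+ (con (+ 1) :- x) :* con (+ 1) := con (+ 1)) refl x

  prod-keep : ∀ {n N} x (g : Fin n → Fin N) S → prod (λ y → keep x (g y) S) ≈ x ^ count g S
  prod-keep {zero}  x g S = refl
  prod-keep {suc n} x g S = trans (*-cong (keep≈^ x (g zero) S) (prod-keep x (g ∘ suc) S))
    (sym (^-homo-* x (bit (lookup S (g zero))) (count (g ∘ suc) S)))

  -- The uncovered fraction of the universe when the players 0, …, r own the elements e 0, …, e r.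
  -- The special elements e l (t l) split the universe among themselves; the other elements of a
  -- player are independent random sets, indistinguishable from the special one until a later
  -- player arrives.
  uncovered : ∀ {n N} r → (Fin (suc r) → Fin n → Fin N) → (Fin (suc r) → Fin n) → Subset N → Carrier
  uncovered zero    e t S = absent (e zero (t zero)) S
  uncovered (suc r) e t S = prodBut (t zero) (λ x → keep (ρ r) (e zero x) S) *
    ((1# - ρ r) * absent (e zero (t zero)) S + ρ r * uncovered r (e ∘ suc) (t ∘ suc) S)

  private
    1-x+x≈1 : ∀ x → 1# - x + x ≈ 1#
    1-x+x≈1 = solve 1 (λ x → con (+ 1) :- x :+ x := con (+ 1)) refl

    mix-1 : ∀ x {y z} → y ≈ 1# → z ≈ 1# → (1# - x) * y + x * z ≈ 1#
    mix-1 x p q = trans (+-cong (*-congˡ p) (*-congˡ q)) (trans (+-cong (*-identityʳ _) (*-identityʳ _)) (1-x+x≈1 x))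

    0≤1-ρ : ∀ r → 0# ≤ 1# - ρ r
    0≤1-ρ r = x≤y⇒0≤y-x (ρ≤1 r)

  uncovered-survival : ∀ {n N} r (e : Fin (suc r) → Fin n → Fin N) t → IsSurvival (uncovered r e t)
  uncovered-survival zero    e t = absent-survival _
  uncovered-survival (suc r) e t = *-survival
    (prodBut-survival (t zero) _ λ x → mixture-survival (0≤ρ r) (0≤1-ρ r) (trans (+-comm _ _) (1-x+x≈1 (ρ r))) 1-survival (absent-survival _))
    (mixture-survival (0≤1-ρ r) (0≤ρ r) (1-x+x≈1 (ρ r)) (absent-survival _) (uncovered-survival r (e ∘ suc) (t ∘ suc)))

  uncovered-cong : ∀ {n N} r (e : Fin (suc r) → Fin n → Fin N) t {S T} →
                   (∀ l x → lookup S (e l x) ≡ lookup T (e l x)) → uncovered r e t S ≈ uncovered r e t T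
  uncovered-cong zero    e t eq = reflexive (≡.cong (λ b → 𝟙 (not b)) (eq zero (t zero)))
  uncovered-cong (suc r) e t eq = *-cong
    (prodBut-cong (t zero) λ x → +-congˡ (*-congˡ (reflexive (≡.cong (λ b → 𝟙 (not b)) (eq zero x)))))
    (+-cong (*-congˡ (reflexive (≡.cong (λ b → 𝟙 (not b)) (eq zero (t zero))))) (*-congˡ (uncovered-cong r (e ∘ suc) (t ∘ suc) (eq ∘ suc))))

  uncovered-none : ∀ {n N} r (e : Fin (suc r) → Fin n → Fin N) t {S} →
                   (∀ l x → lookup S (e l x) ≡ false) → uncovered r e t S ≈ 1#
  uncovered-none zero    e t {S} none = absent-∉ (e zero (t zero)) S (none zero (t zero))
  uncovered-none {n} (suc r) e t {S} none = trans (*-cong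
      (trans (prodBut-cong (t zero) λ x → keep-∉ (ρ r) (e zero x) S (none zero x))
        (trans (sym (*-identityʳ _)) (trans (prodBut-* (t zero) (λ _ → 1#)) (prod-1 n))))
      (mix-1 (ρ r) (absent-∉ (e zero (t zero)) S (none zero (t zero))) (uncovered-none r (e ∘ suc) (t ∘ suc) (none ∘ suc))))
    (*-identityˡ 1#)

  uncovered-special : ∀ {n N} r (e : Fin (suc r) → Fin n → Fin N) t {S} →
                      (∀ l → lookup S (e l (t l)) ≡ true) → uncovered r e t S ≈ 0#
  uncovered-special zero    e t {S} all = absent-∈ (e zero (t zero)) S (all zero)
  uncovered-special (suc r) e t {S} all = trans (*-congˡ (trans
      (+-cong (trans (*-congˡ (absent-∈ (e zero (t zero)) S (all zero))) (zeroʳ _)) (trans (*-congˡ (uncovered-special r (e ∘ suc) (t ∘ suc) (all ∘ suc))) (zeroʳ _)))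
      (+-identityʳ 0#))) (zeroʳ _)

  -- Without elements of later players, the recursive term is 1 and the second factor becomes `keep`
  -- of the special element, which is exactly the factor missing from `prodBut`. All elements of
  -- player `i` then enter symmetrically.
  uncovered-indistinguishable : ∀ {n N} r (e : Fin (suc r) → Fin n → Fin N) {t t′} (i : Fin r) {S} →
    (∀ l → toℕ l ℕ.< toℕ i → t l ≡ t′ l) → (∀ l → toℕ i ℕ.< toℕ l → ∀ x → lookup S (e l x) ≡ false) →
    uncovered r e t S ≈ uncovered r e t′ S
  uncovered-indistinguishable (suc r) e {t} {t′} zero {S} agree none = trans (symmetric t) (sym (symmetric t′))
    where
    symmetric : ∀ t → uncovered (suc r) e t S ≈ prod (λ x → keep (ρ r) (e zero x) S)
    symmetric t = trans
      (*-congˡ (trans (+-comm _ _) (+-congʳ (*-congˡ (uncovered-none r (e ∘ suc) (t ∘ suc) λ l → none (suc l) (ℕ.s≤s ℕ.z≤n))))))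
      (prodBut-* (t zero) _)
  uncovered-indistinguishable (suc r) e {t} {t′} (suc i) {S} agree none =
    *-cong (reflexive (≡.cong (λ x → prodBut x (λ y → keep (ρ r) (e zero y) S)) t₀))
      (+-cong (*-congˡ (reflexive (≡.cong (λ x → absent (e zero x) S) t₀)))
        (*-congˡ (uncovered-indistinguishable r (e ∘ suc) i (λ l l<i → agree (suc l) (ℕ.s≤s l<i)) (λ l i<l → none (suc l) (ℕ.s≤s i<l)))))
    where
    t₀ : t zero ≡ t′ zero
    t₀ = agree zero (ℕ.s≤s ℕ.z≤n)

  Injective₂ : ∀ {k n N} → (Fin k → Fin n → Fin N) → Set
  Injective₂ e = ∀ {l l′ x x′} → e l x ≡ e l′ x′ → l ≡ l′ × x ≡ x′

  private
    prodBut-absent : ∀ {n N} x (g : Fin n → Fin N) t S → lookup S (g t) ≡ false → prodBut t (λ y → keep x (g y) S) ≈ x ^ count g S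
    prodBut-absent x g t S p = trans (sym (*-identityʳ _)) (trans (*-congˡ (sym (keep-∉ x (g t) S p)))
      (trans (prodBut-* t (λ y → keep x (g y) S)) (prod-keep x g S)))

    rest-disjoint : ∀ {k n N} {e : Fin (suc k) → Fin n → Fin N} → Injective₂ e → ∀ S l x → lookup (remove (e zero) S) (e (suc l) x) ≡ lookup S (e (suc l) x)
    rest-disjoint {e = e} inj S l x = lookup-remove (e zero) S (e (suc l) x) λ y eq → zero≢suc (≡.sym (proj₁ (inj eq)))
      where
      zero≢suc : ∀ {k} {l : Fin k} → zero ≢ suc l
      zero≢suc ()

  -- With the first special element absent, the `j` picks of the first player contribute `ρ ^ j`,
  -- and `lower-step` applies to the set that remains after their removal. The special element of
  -- the last player may be in `S`, since no message has to reveal it.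
  lower≤uncovered : ∀ {n N} r (e : Fin (suc (suc r)) → Fin n → Fin N) t → Injective₂ e → ∀ {S b} → ∣ S ∣ ℕ.≤ b →
                    (∀ (l : Fin (suc r)) → lookup S (e (inject₁ l) (t (inject₁ l))) ≡ false) →
                    lower r b ≤ uncovered (suc r) e t S
  lower≤uncovered zero e t inj {S} {b} ∣S∣≤b none = ≤-respʳ (sym value) (≤-trans (lower-base b) bound)
    where
    g = e zero
    j = count g S
    z = absent (e (suc zero) (t (suc zero))) S
    value : uncovered 1 e t S ≈ ρ 0 ^ j * ((1# - ρ 0) * 1# + ρ 0 * z)
    value = *-cong (prodBut-absent (ρ 0) g (t zero) S (none zero)) (+-congʳ (*-congˡ (absent-∉ (e zero (t zero)) S (none zero))))
    size : j ℕ.+ ∣ remove g S ∣ ≡ ∣ S ∣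
    size = count+∣remove∣ g (λ eq → proj₂ (inj eq)) S
    bound : ρ 0 ^ b ≤ ρ 0 ^ j * ((1# - ρ 0) * 1# + ρ 0 * z)
    bound with lookup S (e (suc zero) (t (suc zero))) in eq
    ... | false = ≤-respʳ (sym (trans (*-congˡ (mix-1 (ρ 0) refl refl)) (*-identityʳ _)))
      (^-antimono (0≤ρ 0) (ρ≤1 0) (ℕₚ.≤-trans (ℕₚ.≤-trans (ℕₚ.m≤m+n j _) (ℕₚ.≤-reflexive size)) ∣S∣≤b))
    -- As `ρ 0 = 1/2`, the last special element halves what is uncovered, which is the effect of one
    -- further ordinary pick.
    ... | true = ≤-respʳ (sym (trans (*-congˡ (trans (+-cong (trans (*-identityʳ _) (trans (1-ρ≈κ 0) (sym ρ₀≈κ₀))) (zeroʳ _)) (+-identityʳ _))) (*-comm _ _)))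
      (^-antimono {m = suc j} (0≤ρ 0) (ρ≤1 0) (ℕₚ.≤-trans (ℕₚ.≤-trans (ℕₚ.≤-reflexive (ℕₚ.+-comm 1 j))
        (ℕₚ.≤-trans (ℕₚ.+-monoʳ-≤ j (∈⇒1≤∣∣ (remove g S) _ (≡.trans (rest-disjoint inj S zero _) eq))) (ℕₚ.≤-reflexive size))) ∣S∣≤b))
  lower≤uncovered (suc r) e t inj {S} {b} ∣S∣≤b none = ≤-respʳ (sym value)
    (≤-trans (lower-antimono (suc r) (ℕₚ.≤-trans (ℕₚ.≤-reflexive size) ∣S∣≤b))
      (lower-step r j ∣ S′ ∣ (≤-respʳ (uncovered-cong (suc r) (e ∘ suc) (t ∘ suc) {S = S′} (rest-disjoint inj S))
        (lower≤uncovered r (e ∘ suc) (t ∘ suc) (λ eq → map₁ Finₚ.suc-injective (inj eq)) {S = S′} ℕₚ.≤-refl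
          λ l → ≡.trans (rest-disjoint inj S (inject₁ l) _) (none (suc l))))))
    where
    g = e zero
    j = count g S
    S′ = remove g S
    value : uncovered (suc (suc r)) e t S ≈ ρ (suc r) ^ j * ((1# - ρ (suc r)) + ρ (suc r) * uncovered (suc r) (e ∘ suc) (t ∘ suc) S)
    value = *-cong (prodBut-absent (ρ (suc r)) g (t zero) S (none zero))
      (+-congʳ (trans (*-congˡ (absent-∉ (e zero (t zero)) S (none zero))) (*-identityʳ _)))
    size : j ℕ.+ ∣ S′ ∣ ≡ ∣ S ∣
    size = count+∣remove∣ g (λ eq → proj₂ (inj eq)) S

-- Enumerating subsets and short bit strings.

allSubsets : ∀ n → List (Subset n)
allSubsets zero    = [] ∷ []
allSubsets (suc n) = map (true ∷_) (allSubsets n) ++ map (false ∷_) (allSubsets n)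

allBits : ℕ → List (List Bool)
allBits zero    = [] ∷ []
allBits (suc C) = [] ∷ (map (true ∷_) (allBits C) ++ map (false ∷_) (allBits C))

∈-allBits : ∀ C m → length m ℕ.≤ C → m ∈ allBits C
∈-allBits zero    []          _ = here ≡.refl
∈-allBits (suc C) []          _ = here ≡.refl
∈-allBits (suc C) (true ∷ m)  (ℕ.s≤s p) = there (∈-++⁺ˡ (∈-map⁺ _ (∈-allBits C m p)))
∈-allBits (suc C) (false ∷ m) (ℕ.s≤s p) = there (∈-++⁺ʳ (map (true ∷_) (allBits C)) (∈-map⁺ _ (∈-allBits C m p)))

allBits-length : ∀ C {m} → m ∈ allBits C → length m ℕ.≤ C
allBits-length zero    (here ≡.refl) = ℕ.z≤n
allBits-length (suc C) (here ≡.refl) = ℕ.z≤n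
allBits-length (suc C) (there i) with ∈-++⁻ (map (true ∷_) (allBits C)) i
... | inj₁ j with ∈-map⁻ _ j
...   | _ , k , ≡.refl = ℕ.s≤s (allBits-length C k)
allBits-length (suc C) (there i) | inj₂ j with ∈-map⁻ _ j
...   | _ , k , ≡.refl = ℕ.s≤s (allBits-length C k)

length-allBits : ∀ C → suc (length (allBits C)) ≡ 2 ℕ.^ suc C
length-allBits zero    = ≡.refl
length-allBits (suc C) = ≡.trans (≡.cong (λ k → suc (suc k)) (≡.trans (Listₚ.length-++ (map (true ∷_) (allBits C)))
    (≡.cong₂ ℕ._+_ (Listₚ.length-map (true ∷_) (allBits C)) (Listₚ.length-map (false ∷_) (allBits C)))))
  (≡.trans (double (length (allBits C))) (≡.cong (2 ℕ.*_) (length-allBits C)))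
  where
  double : ∀ k → suc (suc (k ℕ.+ k)) ≡ 2 ℕ.* suc k
  double k = ≡.cong suc (≡.trans (≡.sym (ℕₚ.+-suc k k)) (≡.cong (λ j → k ℕ.+ suc j) (≡.sym (ℕₚ.+-identityʳ k))))

length-allSubsets : ∀ n → length (allSubsets n) ≡ 2 ℕ.^ n
length-allSubsets zero    = ≡.refl
length-allSubsets (suc n) = ≡.trans (Listₚ.length-++ (map (true ∷_) (allSubsets n)))
  (≡.trans (≡.cong₂ ℕ._+_ (Listₚ.length-map _ (allSubsets n)) (Listₚ.length-map _ (allSubsets n)))
    (≡.trans (≡.cong (λ k → k ℕ.+ k) (length-allSubsets n)) (≡.cong (2 ℕ.^ n ℕ.+_) (≡.sym (ℕₚ.+-identityʳ _)))))

_⊆ᵇ_ : ∀ {n} → Subset n → Subset n → Bool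
[]      ⊆ᵇ []      = true
(a ∷ A) ⊆ᵇ (b ∷ B) = (not a ∨ b) ∧ (A ⊆ᵇ B)

⊆ᵇ-false : ∀ {n} (A B : Subset n) → (A ⊆ᵇ B) ≡ false → ∃ λ x → lookup A x ≡ true × lookup B x ≡ false
⊆ᵇ-false [] [] ()
⊆ᵇ-false (true ∷ A)  (false ∷ B) _ = zero , ≡.refl , ≡.refl
⊆ᵇ-false (true ∷ A)  (true ∷ B)  p with ⊆ᵇ-false A B p
... | x , q , r = suc x , q , r
⊆ᵇ-false (false ∷ A) (b ∷ B)     p with ⊆ᵇ-false A B p
... | x , q , r = suc x , q , r

-- From `n - C ≤ 2 ^ (n - C)`. Here `n` will be a number of certified elements, and `2 ^ n` is the
-- weight that exactly cancels the scarcity of sets containing them.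
n*2^C≤C*2^C+2^n : ∀ n C → n ℕ.* 2 ℕ.^ C ℕ.≤ C ℕ.* 2 ℕ.^ C ℕ.+ 2 ℕ.^ n
n*2^C≤C*2^C+2^n n C with ℕₚ.≤-total n C
... | inj₁ n≤C = ℕₚ.≤-trans (ℕₚ.*-monoˡ-≤ (2 ℕ.^ C) n≤C) (ℕₚ.m≤m+n _ _)
... | inj₂ C≤n = begin
  n ℕ.* 2 ℕ.^ C                             ≡⟨ ≡.cong (ℕ._* 2 ℕ.^ C) (≡.sym (ℕₚ.m+[n∸m]≡n C≤n)) ⟩
  (C ℕ.+ (n ℕ.∸ C)) ℕ.* 2 ℕ.^ C             ≡⟨ ℕₚ.*-distribʳ-+ (2 ℕ.^ C) C (n ℕ.∸ C) ⟩
  C ℕ.* 2 ℕ.^ C ℕ.+ (n ℕ.∸ C) ℕ.* 2 ℕ.^ C   ≤⟨ ℕₚ.+-monoʳ-≤ (C ℕ.* 2 ℕ.^ C) (ℕₚ.*-monoˡ-≤ (2 ℕ.^ C) (n≤2^n (n ℕ.∸ C))) ⟩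
  C ℕ.* 2 ℕ.^ C ℕ.+ 2 ℕ.^ (n ℕ.∸ C) ℕ.* 2 ℕ.^ C ≡⟨ ≡.cong (C ℕ.* 2 ℕ.^ C ℕ.+_) (≡.trans (≡.sym (ℕₚ.^-distribˡ-+-* 2 (n ℕ.∸ C) C)) (≡.cong (2 ℕ.^_) (ℕₚ.m∸n+n≡m C≤n))) ⟩
  C ℕ.* 2 ℕ.^ C ℕ.+ 2 ℕ.^ n                 ∎
  where
  open ℕₚ.≤-Reasoning
  n≤2^n : ∀ n → n ℕ.≤ 2 ℕ.^ n
  n≤2^n zero    = ℕ.z≤n
  n≤2^n (suc n) = ℕₚ.≤-trans (ℕₚ.+-mono-≤ (ℕₚ.m^n>0 2 n) (n≤2^n n)) (ℕₚ.≤-reflexive (≡.cong (2 ℕ.^ n ℕ.+_) (≡.sym (ℕₚ.+-identityʳ _))))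

-- Excluded middle for finitely many propositions.

module Classical {A : Set} (_≟_ : DecidableEquality A) where

  -- Finitely many instances of excluded middle hold jointly under one double negation. This
  -- supplies a Boolean table of certificates although positivity of a probability is undecidable.
  decide : (P : A → Set) (xs : List A) →
           ¬ ¬ (Σ (A → Bool) λ b → ∀ {x} → x ∈ xs → (b x ≡ true → P x) × (b x ≡ false → ¬ P x))
  decide P []       k = k ((λ _ → false) , λ ())
  decide P (x ∷ xs) k = decide P xs λ { (b , ok) →
    let p→⊥ : ¬ P x
        p→⊥ p = k (_ , correct b ok true (λ _ → p) (λ ()))
    in k (_ , correct b ok false (λ ()) (λ _ → p→⊥)) }
    where
    correct : ∀ b → (∀ {y} → y ∈ xs → (b y ≡ true → P y) × (b y ≡ false → ¬ P y)) →
              ∀ v → (v ≡ true → P x) → (v ≡ false → ¬ P x) →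
              ∀ {y} → y ∈ x ∷ xs → ((if does (x ≟ y) then v else b y) ≡ true → P y) × ((if does (x ≟ y) then v else b y) ≡ false → ¬ P y)
    correct b ok v t f {y} i with x ≟ y
    correct b ok v t f i         | yes ≡.refl = t , f
    correct b ok v t f (here e)  | no x≢y = ⊥-elim (x≢y (≡.sym e))
    correct b ok v t f (there i) | no _   = ok i

-- How many elements a short message certifies on average.

module Certificates (ℝ : Reals) where
  open Reals ℝ hiding (zero)
  open Arithmetic ℝ
  open OrderedField ℝ
  open Sums ℝ
  open Expectation ℝ

  _≟ᵇ_ : DecidableEquality (List Bool)
  _≟ᵇ_ = Listₚ.≡-dec Boolₚ._≟_

  open Probability _≟ᵇ_ public

  2^ : ℕ → Carrier
  2^ n = ι (2 ℕ.^ n)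

  0<2^ : ∀ n → 0# < 2^ n
  0<2^ n = ι-positive (2 ℕ.^ n) {{ℕₚ.m^n≢0 2 n}}

  2^-suc : ∀ n → 2^ (suc n) ≈ 2^ n + 2^ n
  2^-suc n = trans (ι-homo-+ (2 ℕ.^ n) _) (+-congˡ (reflexive (≡.cong ι (ℕₚ.+-identityʳ (2 ℕ.^ n)))))

  ∑-allSubsets-suc : ∀ n (g : Subset (suc n) → Carrier) →
    ∑ (allSubsets (suc n)) g ≈ ∑ (allSubsets n) (λ Y → g (true ∷ Y)) + ∑ (allSubsets n) (λ Y → g (false ∷ Y))
  ∑-allSubsets-suc n g = trans (∑-++ (map (true ∷_) (allSubsets n)) _ g)
    (+-cong (reflexive (∑-map (true ∷_) (allSubsets n) g)) (reflexive (∑-map (false ∷_) (allSubsets n) g)))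

  ∑-allSubsets-const : ∀ n c → ∑ (allSubsets n) (λ _ → c) ≈ 2^ n * c
  ∑-allSubsets-const n c = trans (∑-const (allSubsets n) c) (*-congʳ (reflexive (≡.cong ι (length-allSubsets n))))

  ∑-member : ∀ {n} (Y : Subset n) → ∑ (allFin n) (λ x → 𝟙 (lookup Y x)) ≈ ι ∣ Y ∣
  ∑-member [] = refl
  ∑-member {suc n} (y ∷ Y) = trans (reflexive (∑-allFin-suc n _)) (trans (+-congˡ (∑-member Y)) (step y))
    where
    step : ∀ y → 𝟙 y + ι ∣ Y ∣ ≈ ι ∣ y ∷ Y ∣
    step true  = refl
    step false = +-identityˡ _

  ∑-∣Y∣ : ∀ n → ι 2 * ∑ (allSubsets n) (λ Y → ι ∣ Y ∣) ≈ ι n * 2^ n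
  ∑-∣Y∣ zero = trans (*-congˡ (+-identityʳ 0#)) (trans (zeroʳ _) (sym (zeroˡ _)))
  ∑-∣Y∣ (suc n) = trans (*-congˡ (trans (∑-allSubsets-suc n (λ Y → ι ∣ Y ∣))
      (+-congʳ (trans (∑-+ (allSubsets n) (λ _ → 1#) _) (+-congʳ (∑-allSubsets-const n 1#))))))
    (trans (solve 2 (λ p s → con (+ 2) :* ((p :* con (+ 1) :+ s) :+ s) := (p :+ p) :+ (con (+ 2) :* s :+ con (+ 2) :* s)) refl (2^ n) _)
      (trans (+-congˡ (+-cong (∑-∣Y∣ n) (∑-∣Y∣ n)))
        (trans (solve 2 (λ p k → (p :+ p) :+ (k :* p :+ k :* p) := (con (+ 1) :+ k) :* (p :+ p)) refl (2^ n) (ι n))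
          (*-congˡ (sym (2^-suc n))))))

  ∑-supersets : ∀ {n} (B : Subset n) → ∑ (allSubsets n) (λ Y → 𝟙 (B ⊆ᵇ Y)) * 2^ ∣ B ∣ ≈ 2^ n
  ∑-supersets [] = trans (*-cong (+-identityʳ 1#) refl) (*-identityˡ _)
  ∑-supersets {suc n} (true ∷ B) = trans (*-cong (trans (∑-allSubsets-suc n _) (trans (+-congˡ (∑-0 (allSubsets n))) (+-identityʳ _))) (2^-suc ∣ B ∣))
    (trans (distribˡ _ _ _) (trans (+-cong (∑-supersets B) (∑-supersets B)) (sym (2^-suc n))))
  ∑-supersets {suc n} (false ∷ B) = trans (*-congʳ (∑-allSubsets-suc n _))
    (trans (distribʳ _ _ _) (trans (+-cong (∑-supersets B) (∑-supersets B)) (sym (2^-suc n))))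

  -- Passes from listed outcomes, which may repeat, to messages counted with their total
  -- probability, so that the summation can be exchanged with the one over sets.
  𝔼≤∑prob : (d : Weighted (List Bool)) → Nonneg d → (M : List (List Bool)) → (∀ m → Possible d m → m ∈ M) →
            (g : List Bool → Carrier) → (∀ m → 0# ≤ g m) → 𝔼 d g ≤ ∑ M (λ m → prob d m * g m)
  𝔼≤∑prob d nn M inM g 0≤g = ≤-respʳ
    (trans (𝔼-∑ d M (λ m m′ → g m * 𝟙 (does (m′ ≟ᵇ m)))) (∑-cong M λ m → trans (𝔼-*ˡ d (g m) _) (*-comm _ _)))
    (𝔼-mono d nn λ m poss → ≤-respˡ (self m)
      (term≤∑ M {λ m′ → g m′ * 𝟙 (does (m ≟ᵇ m′))} (λ {m′} _ → 0≤* (0≤g m′) (𝟙-nonneg (does (m ≟ᵇ m′)))) (inM m poss)))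
    where
    self : ∀ m → g m * 𝟙 (does (m ≟ᵇ m)) ≈ g m
    self m with m ≟ᵇ m
    ... | yes _  = *-identityʳ _
    ... | no m≢m = ⊥-elim (m≢m ≡.refl)

  -- Here b x m means that m certifies x.  The sets compatible with a message that certifies
  -- k elements are a 2^-k fraction of all sets, and k ≤ C + 2^k / 2^C.
  module _ {n C : ℕ} (d : Subset n → Weighted (List Bool)) (D : ∀ Y → IsDistribution (d Y))
           (short : ∀ Y m → Possible (d Y) m → length m ℕ.≤ C) (b : Fin n → List Bool → Bool)
           (sound : ∀ x m → length m ℕ.≤ C → b x m ≡ true → ∀ Y → lookup Y x ≡ false → ¬ Possible (d Y) m) where

    private
      certified : List Bool → Subset n
      certified m = Vec.tabulate (λ x → b x m)

      size : List Bool → ℕ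
      size m = ∣ certified m ∣

      -- A certifying message has probability zero at every set that lacks one of the certified
      -- elements.
      prob≤ : ∀ Y {m} → m ∈ allBits C → prob (d Y) m ≤ 𝟙 (certified m ⊆ᵇ Y)
      prob≤ Y {m} m∈ with certified m ⊆ᵇ Y in eq
      ... | true  = prob≤1 (d Y) (D Y) m
      ... | false with ⊆ᵇ-false (certified m) Y eq
      ...   | x , p , q = λ 0<prob → sound x m (allBits-length C m∈)
                (≡.trans (≡.sym (Vecₚ.lookup∘tabulate (λ x → b x m) x)) p) Y q (prob>0⇒Possible (d Y) 0<prob)

      ∑𝟙≈size : ∀ m → ∑ (allFin n) (λ x → 𝟙 (b x m)) ≈ ι (size m)
      ∑𝟙≈size m = trans (∑-cong (allFin n) λ x → reflexive (≡.cong 𝟙 (≡.sym (Vecₚ.lookup∘tabulate (λ x → b x m) x)))) (∑-member (certified m))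

      total : Carrier
      total = ∑ (allSubsets n) (λ Y → ∑ (allFin n) (λ x → 𝔼 (d Y) (λ m → 𝟙 (b x m))))

      total≈ : total ≈ ∑ (allSubsets n) (λ Y → 𝔼 (d Y) (λ m → ι (size m)))
      total≈ = ∑-cong (allSubsets n) λ Y → trans (sym (𝔼-∑ (d Y) (allFin n) (λ x m → 𝟙 (b x m)))) (𝔼-cong (d Y) ∑𝟙≈size)

      size-bound : ∀ m → 2^ C * ι (size m) ≤ ι C * 2^ C + 2^ (size m)
      size-bound m = ≤-respˡ (trans (ι-homo-* (size m) (2 ℕ.^ C)) (*-comm _ _))
        (≤-respʳ (trans (ι-homo-+ (C ℕ.* 2 ℕ.^ C) _) (+-congʳ (ι-homo-* C (2 ℕ.^ C)))) (ι-mono-≤ (n*2^C≤C*2^C+2^n (size m) C)))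

      one-set : ∀ Y → 2^ C * 𝔼 (d Y) (λ m → ι (size m)) ≤ ι C * 2^ C + ∑ (allBits C) (λ m → prob (d Y) m * 2^ (size m))
      one-set Y = ≤-trans
        (≤-respˡ (𝔼-*ˡ (d Y) (2^ C) _) (≤-respʳ (trans (𝔼-+ (d Y) (λ _ → ι C * 2^ C) _) (+-congʳ (𝔼-const (d Y) (D Y) _)))
          (𝔼-mono (d Y) (nonneg-weights (D Y)) λ m _ → size-bound m)))
        (+-monoʳ-≤ _ (𝔼≤∑prob (d Y) (nonneg-weights (D Y)) (allBits C) (λ m p → ∈-allBits C m (short Y m p))
          (λ m → 2^ (size m)) (λ m → <⇒≤ (0<2^ (size m)))))

      -- Each message contributes at most `2^ n`: the supersets of its certified set number `2^ n`
      -- divided by the weight `2^ (size m)`. There are fewer than `2 * 2^ C` messages.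
      messages : ∑ (allSubsets n) (λ Y → ∑ (allBits C) (λ m → prob (d Y) m * 2^ (size m))) ≤ (ι 2 * 2^ C) * 2^ n
      messages = ≤-respˡ (∑-swap (allBits C) (allSubsets n) (λ m Y → prob (d Y) m * 2^ (size m)))
        (≤-trans (∑-mono (allBits C) λ {m} m∈ →
            ≤-respʳ (trans (trans (∑-cong (allSubsets n) λ Y → *-comm _ _) (trans (∑-*ˡ (allSubsets n) (2^ (size m)) _) (*-comm _ _))) (∑-supersets (certified m)))
              (∑-mono (allSubsets n) λ {Y} _ → *-monoʳ-≤ (2^ (size m)) (<⇒≤ (0<2^ (size m))) (prob≤ Y m∈)))
          (≤-respˡ (sym (∑-const (allBits C) (2^ n))) (*-monoʳ-≤ (2^ n) (<⇒≤ (0<2^ n))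
            (≤-respʳ (ι-homo-* 2 (2 ℕ.^ C)) (ι-mono-≤ (ℕₚ.≤-trans (ℕₚ.n≤1+n _) (ℕₚ.≤-reflexive (length-allBits C))))))))

    certified-mass : ∑ (allSubsets n) (λ Y → ∑ (allFin n) (λ x → 𝔼 (d Y) (λ m → 𝟙 (b x m)))) ≤ 2^ n * (ι 2 + ι C)
    certified-mass = *-cancelˡ-≤ (2^ C) (0<2^ C) (≤-respˡ (*-congˡ (sym total≈))
      (≤-respˡ (∑-*ˡ (allSubsets n) (2^ C) _)
        (≤-trans (∑-mono (allSubsets n) λ {Y} _ → one-set Y)
          (≤-respˡ (sym (trans (∑-+ (allSubsets n) (λ _ → ι C * 2^ C) _) (+-congʳ (∑-allSubsets-const n _))))
            (≤-respʳ (solve 3 (λ p q c → p :* (c :* q) :+ (con (+ 2) :* q) :* p := q :* (p :* (con (+ 2) :+ c))) refl (2^ n) (2^ C) (ι C))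
              (+-monoʳ-≤ _ messages))))))

  -- The pairs with `x` in `Y` number `n * 2^ n / 2`. If `Bad` exceeded `δ` on all of them, the
  -- total would exceed `2^ n * K`.
  average : ∀ {n} (Bad : Subset n → Fin n → Carrier) → (∀ Y x → 0# ≤ Bad Y x) → ∀ {K δ} →
            ∑ (allSubsets n) (λ Y → ∑ (allFin n) (λ x → Bad Y x)) ≤ 2^ n * K → ι 2 * K < ι n * δ →
            ¬ (∀ Y x → lookup Y x ≡ true → ¬ (Bad Y x ≤ δ))
  average {n} Bad 0≤Bad {K} {δ} total≤ 2K<nδ bad = <-irrefl refl (<-≤-trans 2K<nδ
    (*-cancelˡ-≤ (2^ n) (0<2^ n) (≤-respˡ left (≤-respʳ right (*-monoˡ-≤ (ι 2) (0≤ι 2) (≤-trans lower-total total≤))))))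
    where
    pointwise : ∀ Y x → δ * 𝟙 (lookup Y x) ≤ Bad Y x
    pointwise Y x with lookup Y x in eq
    ... | true  = ≤-respˡ (sym (*-identityʳ δ)) (λ Bad<δ → bad Y x eq (<⇒≤ Bad<δ))
    ... | false = ≤-respˡ (sym (zeroʳ δ)) (0≤Bad Y x)
    lower-total : δ * ∑ (allSubsets n) (λ Y → ι ∣ Y ∣) ≤ ∑ (allSubsets n) (λ Y → ∑ (allFin n) (λ x → Bad Y x))
    lower-total = ≤-respˡ (trans (∑-cong (allSubsets n) λ Y → trans (∑-*ˡ (allFin n) δ _) (*-congˡ (∑-member Y))) (∑-*ˡ (allSubsets n) δ _))
      (∑-mono (allSubsets n) λ {Y} _ → ∑-mono (allFin n) λ {x} _ → pointwise Y x)
    left : ι 2 * (δ * ∑ (allSubsets n) (λ Y → ι ∣ Y ∣)) ≈ 2^ n * (ι n * δ)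
    left = trans (solve 2 (λ δ s → con (+ 2) :* (δ :* s) := (con (+ 2) :* s) :* δ) refl δ _)
      (trans (*-congʳ (∑-∣Y∣ n)) (solve 3 (λ k p δ → (k :* p) :* δ := p :* (k :* δ)) refl (ι n) (2^ n) δ))
    right : ι 2 * (2^ n * K) ≈ 2^ n * (ι 2 * K)
    right = solve 2 (λ p K → con (+ 2) :* (p :* K) := p :* (con (+ 2) :* K)) refl (2^ n) K

-- Unions of singletons and pointwise updates.

does≡true⁻ : ∀ {P : Set} (P? : Dec P) → does P? ≡ true → P
does≡true⁻ (yes p) _ = p

∣∪∣≤ : ∀ {n} (A B : Subset n) → ∣ A ∪ B ∣ ℕ.≤ ∣ A ∣ ℕ.+ ∣ B ∣
∣∪∣≤ []          []          = ℕ.z≤n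
∣∪∣≤ (false ∷ A) (false ∷ B) = ∣∪∣≤ A B
∣∪∣≤ (false ∷ A) (true ∷ B)  = ℕₚ.≤-trans (ℕ.s≤s (∣∪∣≤ A B)) (ℕₚ.≤-reflexive (≡.sym (ℕₚ.+-suc ∣ A ∣ ∣ B ∣)))
∣∪∣≤ (true ∷ A)  (false ∷ B) = ℕ.s≤s (∣∪∣≤ A B)
∣∪∣≤ (true ∷ A)  (true ∷ B)  = ℕ.s≤s (ℕₚ.≤-trans (∣∪∣≤ A B) (ℕₚ.+-monoʳ-≤ ∣ A ∣ (ℕₚ.n≤1+n ∣ B ∣)))

∣⋃-singletons∣≤ : ∀ {k N} (g : Fin k → Fin N) → ∣ ⋃ (List.tabulate (λ l → ⁅ g l ⁆)) ∣ ℕ.≤ k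
∣⋃-singletons∣≤ {zero} {N}  g = ℕₚ.≤-reflexive (∣⊥∣≡0 N)
∣⋃-singletons∣≤ {suc k} g = ℕₚ.≤-trans (∣∪∣≤ ⁅ g zero ⁆ _)
  (ℕₚ.+-mono-≤ (ℕₚ.≤-reflexive (∣⁅x⁆∣≡1 (g zero))) (∣⋃-singletons∣≤ (g ∘ suc)))

update : ∀ {k} {A : Set} → (Fin k → A) → Fin k → A → Fin k → A
update g i a = updateAt g i (const a)

update-same : ∀ {k} {A : Set} (g : Fin k → A) i a → update g i a i ≡ a
update-same g i a = updateAt-updates i g

update-other : ∀ {k} {A : Set} (g : Fin k → A) i a {l} → l ≢ i → update g i a l ≡ g l
update-other g i a {l} l≢i = updateAt-minimal l i g l≢i

update-below : ∀ {k} {A : Set} (g : Fin k → A) i a l → toℕ l ℕ.< toℕ i → g l ≡ update g i a l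
update-below g i a l l<i = ≡.sym (update-other g i a λ { ≡.refl → ℕₚ.<-irrefl ≡.refl l<i })

-- The laws of messages and results are distributions.

module Messages (ℝ : Reals) where
  open Reals ℝ hiding (zero)
  open Arithmetic ℝ
  open Model ℝ
  open Sums ℝ
  open Expectation ℝ

  some-possible : ∀ {A : Set} (d : Weighted A) → IsDistribution d → ∃ (Possible d)
  some-possible d (_ , total) with ∑>0⇒term>0 d (<-respʳ-≈ (sym total) 0<1)
  ... | (w , a) , i , 0<w = a , w , i , 0<w

  module _ {s N} (Π : Protocol s N) (G : Global (suc s) N) (J : Instance G) where
    open Protocol Π
    open Execution Π G J

    message-distribution : ∀ j j≤s → IsDistribution (message j j≤s)
    message-distribution zero    _   = point-distribution []
    message-distribution (suc j) j<s = >>=-distribution _ _ (message-distribution j _) λ m → send-dist G _ _ _ m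

    result-distribution : IsDistribution result
    result-distribution = >>=-distribution _ _ (message-distribution s ℕₚ.≤-refl) λ m → output-dist G _ _ m

-- The hard instances and the stagewise choice of special elements.

module Reduction (ℝ : Reals) {q N n : ℕ} (part-of : Fin N → Fin (suc (suc q)))
                 (e : Fin (suc (suc q)) → Fin n → Fin N)
                 (e-injective : HardFunction.Injective₂ ℝ e)
                 (part-e : ∀ i x → part-of (e i x) ≡ i) where
  open Reals ℝ hiding (zero)
  open Arithmetic ℝ
  open Model ℝ
  open OrderedField ℝ
  open Sums ℝ
  open Expectation ℝ
  open Parameters ℝ
  open Survival ℝ
  open HardFunction ℝ
  open Certificates ℝ
  open Messages ℝ

  s p : ℕ
  s = suc q
  p = suc s

  G : Global p N
  G = record { k = p ; k>0 = ℕ.s≤s ℕ.z≤n ; part-of = part-of }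

  open Global G using (W; W≤)

  Specials Choices : Set
  Specials = Fin p → Fin n
  Choices  = Fin p → Subset n

  embed : Fin p → Subset n → Subset N
  embed i Y = Vec.tabulate λ w → does (Finₚ.any? λ x → (w Finₚ.≟ e i x) ×-dec (lookup Y x Boolₚ.≟ true))

  ∈-embed⁺ : ∀ i Y {x} → lookup Y x ≡ true → e i x Subset.∈ embed i Y
  ∈-embed⁺ i Y {x} p = lookup⇒∈ (≡.trans (Vecₚ.lookup∘tabulate _ (e i x)) (dec-true (Finₚ.any? _) (x , ≡.refl , p)))

  ∈-embed⁻ : ∀ i Y {w} → w Subset.∈ embed i Y → ∃ λ x → w ≡ e i x × lookup Y x ≡ true
  ∈-embed⁻ i Y {w} w∈ = does≡true⁻ (Finₚ.any? _) (≡.trans (≡.sym (Vecₚ.lookup∘tabulate _ w)) (∈⇒lookup w∈))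

  embed⊆W : ∀ i Y → embed i Y ⊆ W i
  embed⊆W i Y {w} w∈ with ∈-embed⁻ i Y w∈
  ... | x , ≡.refl , _ = lookup⇒∈ (≡.trans (Vecₚ.lookup∘tabulate _ w) (dec-true (part-of w Finₚ.≟ i) (part-e i x)))

  f : Specials → SetFunction N
  f t S = 1# - uncovered s e t S

  f≤1 : ∀ t S → f t S ≤ 1#
  f≤1 t S = ≤-by-difference (uncovered s e t S)
    (solve 1 (λ u → con (+ 1) :- (con (+ 1) :- u) := u) refl _) (0≤U (uncovered-survival s e t) S)

  I : Specials → Choices → Instance G
  I t X = record { V = λ i → embed i (X i) ; V⊆W = λ i → embed⊆W i (X i) ; f = f t }

  Valid : Specials → Choices → Set
  Valid t X = ∀ i → lookup (X i) (t i) ≡ true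

  optimum : ∀ {t X} → Valid t X → Instance.IsOptimum (I t X) 1#
  optimum {t} {X} valid = (T , (T⊆ , ∣⋃-singletons∣≤ (λ l → e l (t l))) , f≈1) , λ S _ → f≤1 t S
    where
    T : Subset N
    T = ⋃ (List.tabulate (λ l → ⁅ e l (t l) ⁆))
    T⊆ : T ⊆ Instance.⋃V (I t X)
    T⊆ {w} w∈ with ∈⋃⁻ (List.tabulate (λ l → ⁅ e l (t l) ⁆)) w∈
    ... | _ , A∈ , w∈A with ∈-tabulate⁻ {f = λ l → ⁅ e l (t l) ⁆} A∈
    ...   | l , ≡.refl with x∈⁅y⁆⇒x≡y _ w∈A
    ...     | ≡.refl = ∈⋃⁺ (List.tabulate (λ i → embed i (X i))) (∈-tabulate⁺ {f = λ i → embed i (X i)} l) (∈-embed⁺ l (X l) (valid l))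
    f≈1 : f t T ≈ 1#
    f≈1 = trans (+-congˡ (-‿cong (uncovered-special s e t λ l →
        ∈⇒lookup (∈⋃⁺ (List.tabulate (λ l → ⁅ e l (t l) ⁆)) (∈-tabulate⁺ {f = λ l → ⁅ e l (t l) ⁆} l) (x∈⁅x⁆ (e l (t l)))))))
      (solve 0 (con (+ 1) :- con (+ 0) := con (+ 1)) refl)

  Agree : {A : Set} → ℕ → (g g′ : Fin p → A) → Set
  Agree j g g′ = ∀ l → toℕ l ℕ.< j → g l ≡ g′ l

  f-indistinguishable : ∀ (i : Fin s) {t t′} → Agree (toℕ i) t t′ → ∀ S → S ⊆ W≤ (inject₁ i) → f t S ≈ f t′ S
  f-indistinguishable i {t} {t′} agree S S⊆ = +-congˡ (-‿cong (uncovered-indistinguishable s e i agree none))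
    where
    none : ∀ l → toℕ i ℕ.< toℕ l → ∀ x → lookup S (e l x) ≡ false
    none l i<l x with lookup S (e l x) in eq
    ... | false = ≡.refl
    ... | true  = ⊥-elim (ℕₚ.<⇒≱ i<l (≡.subst₂ ℕ._≤_ (≡.cong toℕ (part-e l x)) (Finₚ.toℕ-inject₁ i)
            (does≡true⁻ (part-of (e l x) Finₚ.≤? inject₁ i)
              (≡.trans (≡.sym (Vecₚ.lookup∘tabulate _ (e l x))) (∈⇒lookup (S⊆ (lookup⇒∈ eq)))))))

  no-special⇒f≤ratio : ∀ t {S} → ∣ S ∣ ℕ.≤ p → (∀ (l : Fin s) → lookup S (e (inject₁ l) (t (inject₁ l))) ≡ false) → f t S ≤ ratio p
  no-special⇒f≤ratio t {S} ∣S∣≤p none = ≤-trans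
    (≤-by-difference (uncovered s e t S - lower q p)
      (solve 2 (λ l u → (con (+ 1) :- l) :- (con (+ 1) :- u) := u :- l) refl (lower q p) _)
      (x≤y⇒0≤y-x (lower≤uncovered q e t e-injective ∣S∣≤p none)))
    (1-lower≤ratio q)

  module _ (Π : Protocol s N) where
    open Protocol Π

    K : Specials → Fin s → Subset n → Bits → Weighted Bits
    K t i Y m = send G i (embed (inject₁ i) Y) (λ S _ → f t S) m

    K-distribution : ∀ t i Y m → IsDistribution (K t i Y m)
    K-distribution t i Y m = send-dist G i _ _ m

    K-cong : ∀ {t t′} i → Agree (toℕ i) t t′ → ∀ Y m → K t i Y m ≈ᴰ K t′ i Y m
    K-cong i agree Y m = send-cong G i (embed (inject₁ i) Y) m (f-indistinguishable i agree)

    M : Specials → Choices → ∀ j → j ℕ.≤ s → Weighted Bits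
    M t X = Execution.message Π G (I t X)

    sender : ∀ {j} → j ℕ.< s → Fin p
    sender j<s = inject₁ (fromℕ< j<s)

    toℕ-sender : ∀ {j} (j<s : j ℕ.< s) → toℕ (sender j<s) ≡ j
    toℕ-sender j<s = ≡.trans (Finₚ.toℕ-inject₁ _) (Finₚ.toℕ-fromℕ< j<s)

    M-distribution : ∀ t X j j≤s → IsDistribution (M t X j j≤s)
    M-distribution t X = message-distribution Π G (I t X)

    M-cong-X : ∀ t {X X′} j j≤s → Agree j X X′ → M t X j j≤s ≡ M t X′ j j≤s
    M-cong-X t zero    _   agree = ≡.refl
    M-cong-X t (suc j) j<s agree = ≡.cong₂ (λ d Y → d >>= K t (fromℕ< j<s) Y)
      (M-cong-X t j _ λ l l<j → agree l (ℕₚ.m<n⇒m<1+n l<j))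
      (agree (sender j<s) (≡.subst (ℕ._< suc j) (≡.sym (toℕ-sender j<s)) (ℕₚ.n<1+n j)))

    -- Unlike a change of `X`, a change of `t` gives oracles whose values are merely equal as reals,
    -- so only equality in law is available.
    M-cong-t : ∀ {t t′} X j j≤s → Agree j t t′ → M t X j j≤s ≈ᴰ M t′ X j j≤s
    M-cong-t X zero    _   agree g = refl
    M-cong-t {t} {t′} X (suc j) j<s agree g = trans (𝔼->>= (M t X j _) _ g)
      (trans (M-cong-t X j _ (λ l l<j → agree l (ℕₚ.m<n⇒m<1+n l<j)) _)
        (trans (𝔼-cong (M t′ X j _) λ m → K-cong (fromℕ< j<s)
            (λ l l<j → agree l (ℕₚ.m<n⇒m<1+n (≡.subst (toℕ l ℕ.<_) (Finₚ.toℕ-fromℕ< j<s) l<j))) (X (sender j<s)) m g)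
          (sym (𝔼->>= (M t′ X j _) _ g))))

    module _ (𝒞 : Class p N) (contains : ∀ t → 𝒞 G (f t)) {C : ℕ} (atMost : CommunicationAtMost 𝒞 Π C)
             (δ : Carrier) (δ-large : ι 2 * (ι 2 + ι C) < ι n * δ) where

      M-short : ∀ t X j j≤s m → Possible (M t X j j≤s) m → length m ℕ.≤ C
      M-short t X = atMost G (I t X) (contains t)

      -- When player j holds Y, its message fails with probability at least 1 - δ to certify x ∈ Y.
      record Good {j} (j<s : j ℕ.< s) (t : Specials) (X : Choices) (x : Fin n) (Y : Subset n) : Set where
        field
          certifies : Bits → Bits → Bool
          uncertain : ∀ m₀ m → length m₀ ℕ.≤ C → length m ℕ.≤ C → certifies m₀ m ≡ false →
                      ¬ (∀ Y′ → lookup Y′ x ≡ false → ¬ (0# < prob (K t (fromℕ< j<s) Y′ m₀) m))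
          rarely    : 𝔼 (M t X j (ℕₚ.<⇒≤ j<s)) (λ m₀ → 𝔼 (K t (fromℕ< j<s) Y m₀) (λ m → 𝟙 (certifies m₀ m))) ≤ δ

      -- Choices made at stage `j` or later leave goodness at `j` intact, because the laws involved
      -- depend only on earlier special elements. Goodness speaks of positive `prob` instead of
      -- `Possible` because `prob` is an expectation and thus transported by equality in law.
      Good-cong : ∀ {j} {j<s : j ℕ.< s} {t t′ X X′ x Y} → Agree j t t′ → Agree j X X′ → Good j<s t X x Y → Good j<s t′ X′ x Y
      Good-cong {j} {j<s} {t} {t′} {X} {X′} {x} {Y} agree-t agree-X good = record
        { certifies = certifies
        ; uncertain = λ m₀ m s₀ s eq k → uncertain m₀ m s₀ s eq λ Y′ x∉ 0<prob → k Y′ x∉ (<-respʳ-≈ (K≈ Y′ m₀ _) 0<prob)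
        ; rarely    = ≤-respˡ (trans (M-cong-t X j _ agree-t _)
            (trans (reflexive (≡.cong (λ d → 𝔼 d _) (M-cong-X t′ j _ agree-X))) (𝔼-cong (M t′ X′ j _) λ m₀ → K≈ Y m₀ _))) rarely
        }
        where
        open Good good
        K≈ : ∀ Y m → K t (fromℕ< j<s) Y m ≈ᴰ K t′ (fromℕ< j<s) Y m
        K≈ = K-cong (fromℕ< j<s) (λ l l<j → agree-t l (≡.subst (toℕ l ℕ.<_) (Finₚ.toℕ-fromℕ< j<s) l<j))

      -- The law `K` does not see the special element of player `j`, so pairs `Y`, `x` can be
      -- averaged over with `t` fixed. `certified-mass` holds for each possible incoming message,
      -- hence also after averaging over that message.
      stage : ∀ {j} (j<s : j ℕ.< s) t X → ¬ (∀ x Y → lookup Y x ≡ true → ¬ Good j<s t X x Y)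
      stage {j} j<s t X none = Classical.decide (Productₚ.≡-dec Finₚ._≟_ (Productₚ.≡-dec _≟ᵇ_ _≟ᵇ_)) Certified
          (cartesianProduct (allFin n) (cartesianProduct (allBits C) (allBits C))) λ { (b , ok) → conclude b ok }
        where
        i = fromℕ< j<s
        μ = M t X j (ℕₚ.<⇒≤ j<s)

        Certified : Fin n × Bits × Bits → Set
        Certified (x , m₀ , m) = ∀ Y → lookup Y x ≡ false → ¬ (0# < prob (K t i Y m₀) m)

        conclude : (b : Fin n × Bits × Bits → Bool) →
          (∀ {y} → y ∈ cartesianProduct (allFin n) (cartesianProduct (allBits C) (allBits C)) → (b y ≡ true → Certified y) × (b y ≡ false → ¬ Certified y)) → ⊥
        conclude b ok = average Bad Bad-nonneg total δ-large λ Y x x∈Y small → none x Y x∈Y record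
          { certifies = λ m₀ m → b (x , m₀ , m)
          ; uncertain = λ m₀ m s₀ s → proj₂ (correct x s₀ s)
          ; rarely    = small
          }
          where
          correct : ∀ x {m₀ m} → length m₀ ℕ.≤ C → length m ℕ.≤ C → (b (x , m₀ , m) ≡ true → Certified (x , m₀ , m)) × (b (x , m₀ , m) ≡ false → ¬ Certified (x , m₀ , m))
          correct x {m₀} {m} s₀ s = ok (∈-cartesianProduct⁺ (∈-allFin x) (∈-cartesianProduct⁺ (∈-allBits C m₀ s₀) (∈-allBits C m s)))

          Bad : Subset n → Fin n → Carrier
          Bad Y x = 𝔼 μ (λ m₀ → 𝔼 (K t i Y m₀) (λ m → 𝟙 (b (x , m₀ , m))))

          Bad-nonneg : ∀ Y x → 0# ≤ Bad Y x
          Bad-nonneg Y x = 𝔼-nonneg μ (nonneg-weights (M-distribution t X j _)) λ m₀ →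
            𝔼-nonneg (K t i Y m₀) (nonneg-weights (K-distribution t i Y m₀)) λ m → 𝟙-nonneg (b (x , m₀ , m))

          -- The communication bound is invoked for the instance where player `j` holds `Y`; the
          -- earlier sets are unchanged, so `m₀` is still possible there.
          short : ∀ m₀ → Possible μ m₀ → ∀ Y m → Possible (K t i Y m₀) m → length m ℕ.≤ C
          short m₀ p₀ Y m p = M-short t X′ (suc j) j<s m (Possible->>= (M t X′ j _) (K t i (X′ (sender j<s)))
              (≡.subst (λ d → Possible d m₀) (M-cong-X t j _ λ l l<j → update-below X (sender j<s) Y l (≡.subst (toℕ l ℕ.<_) (≡.sym (toℕ-sender j<s)) l<j)) p₀)
              (≡.subst (λ Z → Possible (K t i Z m₀) m) (≡.sym (update-same X (sender j<s) Y)) p))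
            where
            X′ = update X (sender j<s) Y

          total : ∑ (allSubsets n) (λ Y → ∑ (allFin n) (λ x → Bad Y x)) ≤ 2^ n * (ι 2 + ι C)
          total = ≤-respˡ (trans (𝔼-∑ μ (allSubsets n) _) (∑-cong (allSubsets n) λ Y → 𝔼-∑ μ (allFin n) _))
            (𝔼-≤-const μ (M-distribution t X j _) λ m₀ p₀ →
              certified-mass (λ Y → K t i Y m₀) (λ Y → K-distribution t i Y m₀) (short m₀ p₀) (λ x m → b (x , m₀ , m))
                λ x m s eq Y x∉ poss → proj₁ (correct x (M-short t X j _ m₀ p₀) s) eq Y x∉
                  (Possible⇒prob>0 (K t i Y m₀) (nonneg-weights (K-distribution t i Y m₀)) poss))

      AllGood : ℕ → Specials → Choices → Set
      AllGood j t X = ∀ {j′} (j′<s : j′ ℕ.< s) → j′ ℕ.< j → Good j′<s t X (t (sender j′<s)) (X (sender j′<s))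

      module _ {j} (j<s : j ℕ.< s) {t : Specials} {X : Choices} {x : Fin n} {Y : Subset n} where

        private
          i = sender j<s

          below : ∀ {A : Set} (g : Fin p → A) a {j′} → j′ ℕ.≤ j → Agree j′ g (update g i a)
          below g a j′≤j l l<j′ = update-below g i a l (≡.subst (toℕ l ℕ.<_) (≡.sym (toℕ-sender j<s)) (ℕₚ.<-≤-trans l<j′ j′≤j))

        valid-extend : Valid t X → lookup Y x ≡ true → Valid (update t i x) (update X i Y)
        valid-extend valid x∈Y l with l Finₚ.≟ i
        ... | yes ≡.refl = ≡.trans (≡.cong₂ lookup (update-same X i Y) (update-same t i x)) x∈Y
        ... | no l≢i     = ≡.trans (≡.cong₂ lookup (update-other X i Y l≢i) (update-other t i x l≢i)) (valid l)

        good-extend : AllGood j t X → Good j<s t X x Y → AllGood (suc j) (update t i x) (update X i Y)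
        good-extend good new {j′} j′<s (ℕ.s≤s j′≤j) with ℕₚ.m≤n⇒m<n∨m≡n j′≤j
        ... | inj₁ j′<j = ≡.subst₂ (Good j′<s (update t i x) (update X i Y))
          (below t x ℕₚ.≤-refl (sender j′<s) (≡.subst (ℕ._< j) (≡.sym (toℕ-sender j′<s)) j′<j))
          (below X Y ℕₚ.≤-refl (sender j′<s) (≡.subst (ℕ._< j) (≡.sym (toℕ-sender j′<s)) j′<j))
          (Good-cong (below t x j′≤j) (below X Y j′≤j) (good j′<s j′<j))
        ... | inj₂ ≡.refl = ≡.subst₂ (Good j′<s (update t i x) (update X i Y)) (≡.sym (update-same t i x)) (≡.sym (update-same X i Y))
          (Good-cong (below t x ℕₚ.≤-refl) (below X Y ℕₚ.≤-refl) (≡.subst (λ lt → Good lt t X x Y) (ℕₚ.≤-irrelevant j<s j′<s) new))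

      stages : Fin n → ∀ j → j ℕ.≤ s → ¬ (∀ t X → Valid t X → ¬ AllGood j t X)
      -- Singletons make every choice valid from the start; the last player, who is never updated,
      -- keeps its singleton.
      stages x₀ zero    _   k = k (λ _ → x₀) (λ _ → ⁅ x₀ ⁆) (λ _ → ∈⇒lookup (x∈⁅x⁆ x₀)) λ _ ()
      stages x₀ (suc j) j<s k = stages x₀ j (ℕₚ.<⇒≤ j<s) λ t X valid good → stage j<s t X λ x Y x∈Y new →
        k _ _ (valid-extend j<s valid x∈Y) (good-extend j<s good new)

      module _ (t : Specials) (X : Choices) (good : AllGood s t X) where

        -- If m stays possible when a sender loses its special element, feasibility forbids the
        -- output to contain that element.
        Ambiguous : ∀ j → j ℕ.≤ s → Bits → Set
        Ambiguous j j≤s m = Possible (M t X j j≤s) m × (∀ (l : Fin s) → toℕ l ℕ.< j →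
          ¬ (∀ Y → lookup Y (t (inject₁ l)) ≡ false → ¬ Possible (M t (update X (inject₁ l) Y) j j≤s) m))

        -- For an earlier sender, changing its set does not affect the set of player `j`, so the
        -- same next message remains possible. For player `j` itself, an uncertified message can
        -- arise from a set without its special element.
        ambiguous-step : ∀ {j} (j<s : j ℕ.< s) {m m′} → Ambiguous j (ℕₚ.<⇒≤ j<s) m → Possible (K t (fromℕ< j<s) (X (sender j<s)) m) m′ →
                         Good.certifies (good j<s j<s) m m′ ≡ false → Ambiguous (suc j) j<s m′
        ambiguous-step {j} j<s {m} {m′} (poss , amb) poss′ eq = next , amb′
          where
          i = sender j<s
          next : Possible (M t X (suc j) j<s) m′
          next = Possible->>= (M t X j _) (K t (fromℕ< j<s) (X i)) poss poss′
          amb′ : ∀ (l : Fin s) → toℕ l ℕ.< suc j → ¬ (∀ Y → lookup Y (t (inject₁ l)) ≡ false → ¬ Possible (M t (update X (inject₁ l) Y) (suc j) j<s) m′)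
          amb′ l (ℕ.s≤s l≤j) k with ℕₚ.m≤n⇒m<n∨m≡n l≤j
          ... | inj₁ l<j = amb l l<j λ Y x∉ pY → k Y x∉
            (Possible->>= (M t (update X (inject₁ l) Y) j _) (K t (fromℕ< j<s) (update X (inject₁ l) Y i)) pY
              (≡.subst (λ Z → Possible (K t (fromℕ< j<s) Z m) m′) (≡.sym (update-other X (inject₁ l) Y i≢l)) poss′))
            where
            i≢l : i ≢ inject₁ l
            i≢l i≡l = ℕₚ.<-irrefl (≡.trans (≡.sym (Finₚ.toℕ-inject₁ l)) (≡.trans (≡.cong toℕ (≡.sym i≡l)) (toℕ-sender j<s))) l<j
          ... | inj₂ l≡j with Finₚ.toℕ-injective {i = l} {j = fromℕ< j<s} (≡.trans l≡j (≡.sym (Finₚ.toℕ-fromℕ< j<s)))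
          ...   | ≡.refl = Good.uncertain (good j<s j<s) m m′ (M-short t X j _ m poss) (M-short t X (suc j) j<s m′ next) eq λ Y x∉ 0<prob → k Y x∉
            (Possible->>= (M t (update X i Y) j _) (K t (fromℕ< j<s) (update X i Y i))
              (≡.subst (λ d → Possible d m) (M-cong-X t j _ λ l′ l′<j → update-below X i Y l′ (≡.subst (toℕ l′ ℕ.<_) (≡.sym (toℕ-sender j<s)) l′<j)) poss)
              (≡.subst (λ Z → Possible (K t (fromℕ< j<s) Z m) m′) (≡.sym (update-same X i Y)) (prob>0⇒Possible (K t (fromℕ< j<s) Y m) 0<prob)))

        -- A union bound over the senders, by induction with a changing test function. On ambiguous
        -- messages the conditional expectation of `h` is at most `c + β`, where `β` is the
        -- conditional probability of a certificate. Subtracting `β` restores the same `c` for the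
        -- induction and costs `δ` on average. The difference may be negative, so only upper bounds
        -- on `h` are assumed.
        𝔼-message : ∀ j j≤s (h : Bits → Carrier) {c} → 0# ≤ c → (∀ m → h m ≤ 1#) → (∀ m → Ambiguous j j≤s m → h m ≤ c) →
                    𝔼 (M t X j j≤s) h ≤ c + ι j * δ
        𝔼-message zero j≤s h {c} 0≤c h≤1 h≤c = ≤-respˡ (sym (𝔼-point [] h)) (≤-respʳ (sym (trans (+-congˡ (zeroˡ δ)) (+-identityʳ c)))
          (h≤c [] ((1# , here ≡.refl , 0<1) , λ _ ())))
        𝔼-message (suc j) j<s h {c} 0≤c h≤1 h≤c = ≤-respˡ (sym (𝔼->>= μ κ′ h))
          (≤-by-difference ((c + ι j * δ - 𝔼 μ (λ m → h′ m + - 1# * β m)) + (δ - 𝔼 μ β))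
            (trans (solve 5 (λ c j δ a b → (c :+ (con (+ 1) :+ j) :* δ) :- a := (c :+ j :* δ :- (a :+ (:- con (+ 1)) :* b)) :+ (δ :- b)) refl c (ι j) δ (𝔼 μ h′) (𝔼 μ β))
              (+-congʳ (+-congˡ (-‿cong (sym (trans (𝔼-+ μ h′ _) (+-congˡ (𝔼-*ˡ μ (- 1#) β))))))))
            (0≤+ (x≤y⇒0≤y-x (𝔼-message j _ (λ m → h′ m + - 1# * β m) 0≤c
                (λ m → drop (0≤β m) (𝔼-≤-const (κ′ m) (K-distribution t (fromℕ< j<s) (X (sender j<s)) m) λ m′ _ → h≤1 m′))
                (λ m amb → move (ambiguous-bound m amb))))
              (x≤y⇒0≤y-x (Good.rarely (good j<s j<s)))))
          where
          μ  = M t X j (ℕₚ.<⇒≤ j<s)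
          κ′ = K t (fromℕ< j<s) (X (sender j<s))
          certifies = Good.certifies (good j<s j<s)
          h′ β : Bits → Carrier
          h′ m = 𝔼 (κ′ m) h
          β m  = 𝔼 (κ′ m) (λ m′ → 𝟙 (certifies m m′))
          0≤β : ∀ m → 0# ≤ β m
          0≤β m = 𝔼-nonneg (κ′ m) (nonneg-weights (K-distribution t (fromℕ< j<s) (X (sender j<s)) m)) λ m′ → 𝟙-nonneg (certifies m m′)
          drop : ∀ {a b c} → 0# ≤ b → a ≤ c → a + - 1# * b ≤ c
          drop {a} {b} {c} 0≤b a≤c = ≤-by-difference ((c - a) + b)
            (solve 3 (λ a b c → c :- (a :+ (:- con (+ 1)) :* b) := (c :- a) :+ b) refl a b c) (0≤+ (x≤y⇒0≤y-x a≤c) 0≤b)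
          move : ∀ {a b c} → a ≤ c + b → a + - 1# * b ≤ c
          move {a} {b} {c} a≤c+b = ≤-by-difference ((c + b) - a)
            (solve 3 (λ a b c → c :- (a :+ (:- con (+ 1)) :* b) := (c :+ b) :- a) refl a b c) (x≤y⇒0≤y-x a≤c+b)
          ambiguous-bound : ∀ m → Ambiguous j (ℕₚ.<⇒≤ j<s) m → h′ m ≤ c + β m
          ambiguous-bound m amb = ≤-respʳ (trans (𝔼-+ (κ′ m) (λ _ → c) _) (+-congʳ (𝔼-const (κ′ m) (K-distribution t (fromℕ< j<s) (X (sender j<s)) m) c)))
            (𝔼-mono (κ′ m) (nonneg-weights (K-distribution t (fromℕ< j<s) (X (sender j<s)) m)) pointwise)
            where
            pointwise : ∀ m′ → Possible (κ′ m) m′ → h m′ ≤ c + 𝟙 (certifies m m′)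
            pointwise m′ poss with certifies m m′ in eq
            ... | true  = ≤-trans (h≤1 m′) (≤-respˡ (+-identityˡ 1#) (+-monoˡ-≤ 1# 0≤c))
            ... | false = ≤-respʳ (sym (+-identityʳ c)) (h≤c m′ (ambiguous-step j<s amb poss eq))

        -- The last player sees the same set, oracle and message when a sender's set is replaced by
        -- one without its special element. An output after an ambiguous message is therefore
        -- possible there too, and feasibility in that instance excludes the element.
        𝔼-result : (∀ X → ∀ S → Possible (Execution.result Π G (I t X)) S → Instance.Feasible (I t X) S) →
                   𝔼 (Execution.result Π G (I t X)) (f t) ≤ ratio p + ι s * δ
        𝔼-result feasible = ≤-respˡ (sym (𝔼->>= (M t X s ℕₚ.≤-refl) final (f t)))
          (𝔼-message s ℕₚ.≤-refl (λ m → 𝔼 (final m) (f t)) 0≤ratio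
            (λ m → 𝔼-≤-const (final m) (output-dist G _ _ m) λ S _ → f≤1 t S)
            (λ m amb → 𝔼-≤-const (final m) (output-dist G _ _ m) λ S poss → no-special⇒f≤ratio t
              (proj₂ (feasible X S (Possible->>= (M t X s ℕₚ.≤-refl) final (proj₁ amb) poss))) (no-special m amb S poss)))
          where
          last = fromℕ s
          final : Bits → Weighted (Subset N)
          final = output G (embed last (X last)) (λ S _ → f t S)
          0≤ratio : 0# ≤ ratio p
          0≤ratio = *-cancelˡ-≤ (ι 2) (ι-positive 2) (≤-respˡ (sym (zeroʳ _)) (≤-trans 0≤1 (1≤2*ratio q)))
          no-special : ∀ m → Ambiguous s ℕₚ.≤-refl m → ∀ S → Possible (final m) S → ∀ (l : Fin s) → lookup S (e (inject₁ l) (t (inject₁ l))) ≡ false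
          no-special m (_ , amb) S poss l with lookup S (e (inject₁ l) (t (inject₁ l))) in eq
          ... | false = ≡.refl
          ... | true  = ⊥-elim (amb l (Finₚ.toℕ<n l) λ Y x∉ pY → contradict Y x∉ (proj₁ (feasible (X′ Y) S
                (Possible->>= (M t (X′ Y) s ℕₚ.≤-refl) (output G (embed last (X′ Y last)) (λ S _ → f t S)) pY
                  (≡.subst (λ Z → Possible (output G (embed last Z) (λ S _ → f t S) m) S) (≡.sym (update-other X (inject₁ l) Y Finₚ.fromℕ≢inject₁)) poss))) (lookup⇒∈ eq)))
            where
            X′ : Subset n → Choices
            X′ Y = update X (inject₁ l) Y
            contradict : ∀ Y → lookup Y (t (inject₁ l)) ≡ false → e (inject₁ l) (t (inject₁ l)) Subset.∈ Instance.⋃V (I t (X′ Y)) → ⊥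
            contradict Y x∉ u∈ with ∈⋃⁻ (List.tabulate (λ i → embed i (X′ Y i))) u∈
            ... | _ , A∈ , u∈A with ∈-tabulate⁻ {f = λ i → embed i (X′ Y i)} A∈
            ...   | i , ≡.refl with ∈-embed⁻ i (X′ Y i) u∈A
            ...     | x , eq′ , x∈ with e-injective eq′
            ...       | ≡.refl , ≡.refl with ≡.trans (≡.sym x∉) (≡.trans (≡.cong (λ Z → lookup Z (t (inject₁ l))) (≡.sym (update-same X (inject₁ l) Y))) x∈)
            ...         | ()

      guarantee-bound : Fin n → ∀ {α} → HasGuarantee 𝒞 Π α → α ≤ ratio p + ι s * δ
      guarantee-bound x₀ {α} guarantee = ≤-stable λ k → stages x₀ s ℕₚ.≤-refl λ t X valid good →
        k (≤-trans (≤-respˡ (*-identityʳ α) (proj₂ (guarantee G (I t X) (contains t)) 1# (optimum {t} {X} valid)))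
          (𝔼-result t X good λ X′ → proj₁ (guarantee G (I t X′) (contains t))))

-- Splitting the ground set into equal blocks.

element : ∀ {p n N} → p ℕ.* n ℕ.≤ N → Fin p → Fin n → Fin N
element {p} {n} fits i x = inject≤ (combine {p} {n} i x) fits

element-injective : ∀ {p n N} (fits : p ℕ.* n ℕ.≤ N) {i i′ x x′} →
                    element {p} {n} fits i x ≡ element {p} {n} fits i′ x′ → i ≡ i′ × x ≡ x′
element-injective {p} {n} fits {i} {i′} {x} {x′} eq = Finₚ.combine-injective i x i′ x′
  (Finₚ.inject≤-injective fits fits (combine {p} {n} i x) (combine {p} {n} i′ x′) eq)

-- Elements beyond the blocks go to the first player by default; no hard instance makes them
-- available.
owner : ∀ p n {N} → Fin N → Fin (suc p)
owner p n w with toℕ w ℕ.<? suc p ℕ.* n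
... | yes w< = proj₁ (remQuot {suc p} n (fromℕ< w<))
... | no _   = zero

owner-element : ∀ p n {N} (fits : suc p ℕ.* n ℕ.≤ N) i x → owner p n (element {suc p} {n} fits i x) ≡ i
owner-element p n fits i x with toℕ (element {suc p} {n} fits i x) ℕ.<? suc p ℕ.* n
... | yes w< = ≡.trans (≡.cong (λ w → proj₁ (remQuot {suc p} n w)) decoded) (≡.cong proj₁ (Finₚ.remQuot-combine i x))
  where
  decoded : fromℕ< w< ≡ combine i x
  decoded = Finₚ.toℕ-injective (≡.trans (Finₚ.toℕ-fromℕ< w<) (Finₚ.toℕ-inject≤ (combine i x) fits))
... | no w≮ = ⊥-elim (w≮ (≡.subst (ℕ._< suc p ℕ.* n) (≡.sym (Finₚ.toℕ-inject≤ (combine i x) fits)) (Finₚ.toℕ<n (combine i x))))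

-- An instance with one relevant element, for the degenerate bounds.

module SingleElement (ℝ : Reals) {q N : ℕ} where
  open Reals ℝ hiding (zero)
  open Arithmetic ℝ
  open Model ℝ
  open OrderedField ℝ
  open Sums ℝ
  open Expectation ℝ
  open Survival ℝ
  open Messages ℝ

  s p : ℕ
  s = suc q
  p = suc s

  G : Global p (suc N)
  G = record { k = p ; k>0 = ℕ.s≤s ℕ.z≤n ; part-of = λ _ → zero }

  f : SetFunction (suc N)
  f S = 1# - absent zero S

  V : Subset (suc N) → Fin p → Subset (suc N)
  V A zero    = A
  V A (suc _) = Subset.⊥

  I : Subset (suc N) → Instance G
  I A = record { V = V A ; V⊆W = V⊆W ; f = f }
    where
    V⊆W : ∀ i → V A i ⊆ Global.W G i
    V⊆W zero    {w} _  = lookup⇒∈ (Vecₚ.lookup∘tabulate _ w)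
    V⊆W (suc i) w∈ = ⊥-elim (∉⊥ w∈)

  f≤1 : ∀ S → f S ≤ 1#
  f≤1 S = ≤-by-difference (absent zero S) (solve 1 (λ u → con (+ 1) :- (con (+ 1) :- u) := u) refl _) (𝟙-nonneg (not (lookup S zero)))

  optimum : Instance.IsOptimum (I ⁅ zero ⁆) 1#
  optimum = (⁅ zero ⁆ , ((λ w∈ → ∈⋃⁺ (List.tabulate (V ⁅ zero ⁆)) (∈-tabulate⁺ {f = V ⁅ zero ⁆} zero) w∈) ,
      ℕₚ.≤-trans (ℕₚ.≤-reflexive (∣⁅x⁆∣≡1 {suc N} zero)) (ℕ.s≤s ℕ.z≤n)) ,
      solve 0 (con (+ 1) :- con (+ 0) := con (+ 1)) refl) , λ S _ → f≤1 S

  module _ (Π : Protocol s (suc N)) (𝒞 : Class p (suc N)) (contains : 𝒞 G f) {α : Carrier} (guarantee : HasGuarantee 𝒞 Π α) where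
    open Protocol Π

    private
      approximation : α ≤ 𝔼 (Execution.result Π G (I ⁅ zero ⁆)) f
      approximation = ≤-respˡ (*-identityʳ α) (proj₂ (guarantee G (I ⁅ zero ⁆) contains) 1# optimum)

    guarantee≤1 : α ≤ 1#
    guarantee≤1 = ≤-trans approximation (𝔼-≤-const _ (result-distribution Π G (I ⁅ zero ⁆)) λ S _ → f≤1 S)

    -- Without communication the last player cannot know that the element is available.
    silent⇒guarantee≤0 : CommunicationAtMost 𝒞 Π 0 → α ≤ 0#
    silent⇒guarantee≤0 atMost = ≤-trans approximation (𝔼-≤-const _ (result-distribution Π G (I ⁅ zero ⁆)) λ S poss → ≤-stable λ k →
      Possible->>=⁻ (message (I ⁅ zero ⁆)) final (nonneg-weights (message-distribution Π G (I ⁅ zero ⁆) s ℕₚ.≤-refl))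
        (λ m → nonneg-weights (output-dist G _ _ m)) poss λ { (m , poss-m , poss-S) →
          k (f≤0 S (misses S (proj₁ (proj₁ (guarantee G (I Subset.⊥) contains) S (Possible->>= (message (I Subset.⊥)) final (empty-possible (silent _ m poss-m)) poss-S))))) })
      where
      message : Instance G → Weighted Bits
      message J = Execution.message Π G J s ℕₚ.≤-refl
      final : Bits → Weighted (Subset (suc N))
      final = output G Subset.⊥ (λ S _ → f S)
      silent : ∀ A m → Possible (message (I A)) m → m ≡ []
      silent A m poss = length≤0 m (atMost G (I A) contains s ℕₚ.≤-refl m poss)
        where
        length≤0 : ∀ (m : Bits) → length m ℕ.≤ 0 → m ≡ []
        length≤0 [] _ = ≡.refl
      empty-possible : ∀ {m} → m ≡ [] → Possible (message (I Subset.⊥)) m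
      empty-possible ≡.refl with some-possible (message (I Subset.⊥)) (message-distribution Π G (I Subset.⊥) s ℕₚ.≤-refl)
      ... | m , poss with silent Subset.⊥ m poss
      ...   | ≡.refl = poss
      misses : ∀ S → S ⊆ Instance.⋃V (I Subset.⊥) → lookup S zero ≡ false
      misses S S⊆ with lookup S zero in eq
      ... | false = ≡.refl
      ... | true with ∈⋃⁻ (List.tabulate (V Subset.⊥)) (S⊆ (lookup⇒∈ eq))
      ...   | _ , A∈ , w∈A with ∈-tabulate⁻ {f = V Subset.⊥} A∈
      ...     | zero  , ≡.refl = ⊥-elim (∉⊥ w∈A)
      ...     | suc _ , ≡.refl = ⊥-elim (∉⊥ w∈A)
      f≤0 : ∀ S → lookup S zero ≡ false → f S ≤ 0#
      f≤0 S eq = ≈⇒≤ (trans (+-congˡ (-‿cong (reflexive (≡.cong (λ b → 𝟙 (not b)) eq)))) (-‿inverseʳ 1#))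

private
  4p4C≡16pC : ∀ p C → 4 ℕ.* (p ℕ.* (4 ℕ.* C)) ≡ 16 ℕ.* (p ℕ.* C)
  4p4C≡16pC = solve-∀

  np+np≡2pn : ∀ n p → n ℕ.* p ℕ.+ n ℕ.* p ≡ 2 ℕ.* p ℕ.* n
  np+np≡2pn = solve-∀

  2p16pC≡32p²C : ∀ p C → 2 ℕ.* p ℕ.* (16 ℕ.* (p ℕ.* C)) ≡ 32 ℕ.* (p ℕ.* (p ℕ.* 1) ℕ.* C)
  2p16pC≡32p²C = solve-∀

-- The quantitative communication bound.

module Communication (ℝ : Reals) where
  open Reals ℝ hiding (zero)
  open Arithmetic ℝ
  open Model ℝ
  open OrderedField ℝ
  open Parameters ℝ using (1≤2*ratio)
  open Survival ℝ
  open HardFunction ℝ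

  -- Both function classes of the theorem satisfy this, so one argument serves for both.
  Contains : ∀ {q N} → Class (suc (suc q)) N → Set
  Contains {q} 𝒞 = ∀ G f → Global.k G ≡ suc (suc q) → IsWeightedCoverage f → IsMonotoneSubmodular f → 𝒞 G f

  1+ε≤2ratio[1+ε] : ∀ q {ε} → 0# < ε → 1# + ε ≤ ι 2 * (ratio (suc (suc q)) * (1# + ε))
  1+ε≤2ratio[1+ε] q {ε} 0<ε = ≤-respˡ (*-identityˡ _) (≤-respʳ (*-assoc _ _ _) (*-monoʳ-≤ (1# + ε) (<⇒≤ (0<+ 0<1 (<⇒≤ 0<ε))) (1≤2*ratio q)))

  module _ {ε : Carrier} (0<ε : 0# < ε) {q N : ℕ} (Π : Protocol (suc q) (suc N)) (𝒞 : Class (suc (suc q)) (suc N))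
           (contains : Contains 𝒞) (guarantee : HasGuarantee 𝒞 Π (ratio (suc (suc q)) * (1# + ε))) where

    private
      contained : 𝒞 (SingleElement.G ℝ) (SingleElement.f ℝ {q})
      contained = contains _ _ ≡.refl (1-U-coverage (absent-survival zero)) (1-U-submodular (absent-survival zero))

    communicates : ∀ C → CommunicationAtMost 𝒞 Π C → 1 ℕ.≤ C
    communicates (suc _) _      = ℕ.s≤s ℕ.z≤n
    communicates zero    atMost = ⊥-elim (≤-trans (1+ε≤2ratio[1+ε] q 0<ε) (≤-respʳ (zeroʳ _) (*-monoˡ-≤ (ι 2) (0≤ι 2)
      (SingleElement.silent⇒guarantee≤0 ℝ Π 𝒞 contained guarantee atMost))) (0<+ 0<1 (<⇒≤ 0<ε)))

    ε≤1 : ε ≤ 1#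
    ε≤1 = ≤-by-difference (ι 2 * 1# - (1# + ε)) (solve 1 (λ e → con (+ 1) :- e := con (+ 2) :* con (+ 1) :- (con (+ 1) :+ e)) refl ε)
      (x≤y⇒0≤y-x (≤-trans (1+ε≤2ratio[1+ε] q 0<ε) (*-monoˡ-≤ (ι 2) (0≤ι 2) (SingleElement.guarantee≤1 ℝ Π 𝒞 contained guarantee))))

  module _ {ε : Carrier} (0<ε : 0# < ε) {q N : ℕ} (Π : Protocol (suc q) N) (𝒞 : Class (suc (suc q)) N)
           (contains : Contains 𝒞) (guarantee : HasGuarantee 𝒞 Π (ratio (suc (suc q)) * (1# + ε)))
           {C : ℕ} (atMost : CommunicationAtMost 𝒞 Π C) where

    private
      p : ℕ
      p = suc (suc q)
      α = ratio p * (1# + ε)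

    nε≤4s[C+3] : ∀ n → p ℕ.* suc n ℕ.≤ N → ι (suc n) * ε ≤ ι 4 * (ι (suc q) * (ι 3 + ι C))
    nε≤4s[C+3] n fits = ≤-respʳ rearrange (*-monoˡ-≤ (ι (suc n)) (0≤ι (suc n)) ε≤)
      where
      e : Fin p → Fin (suc n) → Fin N
      e = element {p} {suc n} fits
      e-injective : Injective₂ e
      e-injective {l} {l′} {x} {x′} = element-injective {p} {suc n} fits {l} {l′} {x} {x′}
      e-owner : ∀ i x → owner (suc q) (suc n) (e i x) ≡ i
      e-owner = owner-element (suc q) (suc n) fits
      module R = Reduction ℝ {q} {N} {suc n} (owner (suc q) (suc n)) e e-injective e-owner
      r = 1/ suc n
      -- The 3 in place of the 2 of `certified-mass` provides the strictness required by `δ-large`.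
      δ = ι 2 * (ι 3 + ι C) * r
      nr≈1 : ι (suc n) * r ≈ 1#
      nr≈1 = recip-inverse _ _
      nδ≈ : ι (suc n) * δ ≈ ι 2 * (ι 3 + ι C)
      nδ≈ = trans (solve 3 (λ n a r → n :* (a :* r) := (n :* r) :* a) refl (ι (suc n)) (ι 2 * (ι 3 + ι C)) r) (trans (*-congʳ nr≈1) (*-identityˡ _))
      δ-large : ι 2 * (ι 2 + ι C) < ι (suc n) * δ
      δ-large = <-respʳ-≈ (sym nδ≈) (<-respˡ-≈ (+-identityˡ _)
        (<-respʳ-≈ (solve 1 (λ c → con (+ 2) :+ con (+ 2) :* (con (+ 2) :+ c) := con (+ 2) :* (con (+ 3) :+ c)) refl (ι C)) (+-monoˡ-< _ (ι-positive 2))))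
      bound : α ≤ ratio p + ι (suc q) * δ
      bound = R.guarantee-bound Π 𝒞 (λ t → contains _ _ ≡.refl (1-U-coverage (uncovered-survival (suc q) e t)) (1-U-submodular (uncovered-survival (suc q) e t)))
        atMost δ δ-large zero guarantee
      ε≤ : ε ≤ ι 2 * (ι (suc q) * δ)
      ε≤ = ≤-trans (≤-respˡ (*-identityˡ ε) (*-monoʳ-≤ ε (<⇒≤ 0<ε) (1≤2*ratio q)))
        (≤-respˡ (sym (*-assoc _ _ _)) (*-monoˡ-≤ (ι 2) (0≤ι 2)
          (≤-by-difference (ratio p + ι (suc q) * δ - α)
            (solve 3 (λ a e d → d :- a :* e := a :+ d :- a :* (con (+ 1) :+ e)) refl (ratio p) ε (ι (suc q) * δ)) (x≤y⇒0≤y-x bound))))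
      rearrange : ι (suc n) * (ι 2 * (ι (suc q) * δ)) ≈ ι 4 * (ι (suc q) * (ι 3 + ι C))
      rearrange = trans (solve 3 (λ n s d → n :* (con (+ 2) :* (s :* d)) := con (+ 2) :* (s :* (n :* d))) refl (ι (suc n)) (ι (suc q)) δ)
        (trans (*-congˡ (*-congˡ nδ≈)) (solve 2 (λ s c → con (+ 2) :* (s :* (con (+ 2) :* (con (+ 3) :+ c))) := con (+ 4) :* (s :* (con (+ 3) :+ c))) refl (ι (suc q)) (ι C)))

  4s[C+3]≤16pC : ∀ q {C} → 1 ℕ.≤ C → ι 4 * (ι (suc q) * (ι 3 + ι C)) ≤ ι (16 ℕ.* (suc (suc q) ℕ.* C))
  4s[C+3]≤16pC q {C} 1≤C = ≤-respˡ (trans (ι-homo-* 4 (suc q ℕ.* (3 ℕ.+ C))) (*-congˡ (trans (ι-homo-* (suc q) (3 ℕ.+ C)) (*-congˡ (ι-homo-+ 3 C)))))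
    (ι-mono-≤ (ℕₚ.≤-trans (ℕₚ.*-monoʳ-≤ 4 (ℕₚ.*-mono-≤ (ℕₚ.n≤1+n (suc q)) 3+C≤4C)) (ℕₚ.≤-reflexive (4p4C≡16pC (suc (suc q)) C))))
    where
    3+C≤4C : 3 ℕ.+ C ℕ.≤ 4 ℕ.* C
    3+C≤4C = ℕₚ.≤-trans (ℕₚ.+-monoˡ-≤ C (ℕₚ.*-monoʳ-≤ 3 1≤C)) (ℕₚ.≤-reflexive (ℕₚ.+-comm (3 ℕ.* C) C))

  Nε≤32p³C : ∀ {ε} → 0# < ε → ∀ {q} N (Π : Protocol (suc q) N) (𝒞 : Class (suc (suc q)) N) → Contains 𝒞 →
             HasGuarantee 𝒞 Π (ratio (suc (suc q)) * (1# + ε)) → ∀ {C} → CommunicationAtMost 𝒞 Π C →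
             ι N * ε ≤ ι (32 ℕ.* (suc (suc q) ℕ.^ 3 ℕ.* C))
  Nε≤32p³C {ε} 0<ε {q} zero Π 𝒞 contains guarantee {C} atMost = ≤-respˡ (sym (zeroˡ ε)) (0≤ι (32 ℕ.* (suc (suc q) ℕ.^ 3 ℕ.* C)))
  Nε≤32p³C {ε} 0<ε {q} N@(suc _) Π 𝒞 contains guarantee {C} atMost with N ℕᵈ./ suc (suc q) in quot
  -- With fewer elements than players there are no blocks, but then `N < p ≤ p³`, and `ε ≤ 1` and
  -- `C ≥ 1` suffice.
  ... | zero = ≤-trans (≤-respʳ (*-identityʳ _) (*-monoˡ-≤ (ι N) (0≤ι N) (ε≤1 0<ε Π 𝒞 contains guarantee)))
    (ι-mono-≤ (ℕₚ.≤-trans (ℕₚ.<⇒≤ N<p) (ℕₚ.≤-trans p≤p³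
      (ℕₚ.≤-trans (ℕₚ.≤-reflexive (≡.sym (ℕₚ.*-identityʳ (p ℕ.^ 3)))) (ℕₚ.≤-trans (ℕₚ.*-monoʳ-≤ (p ℕ.^ 3) (communicates 0<ε Π 𝒞 contains guarantee C atMost)) (ℕₚ.m≤m+n (p ℕ.^ 3 ℕ.* C) (31 ℕ.* (p ℕ.^ 3 ℕ.* C))))))))
    where
    p : ℕ
    p = suc (suc q)
    p≤p³ : p ℕ.≤ p ℕ.^ 3
    p≤p³ = ℕₚ.≤-trans (ℕₚ.≤-reflexive (≡.sym (ℕₚ.^-identityʳ p))) (ℕₚ.^-monoʳ-≤ p {1} {3} (ℕ.s≤s ℕ.z≤n))
    N<p : N ℕ.< p
    N<p = ℕₚ.≰⇒> λ p≤N → ℕₚ.<-irrefl (≡.sym quot) (ℕᵈ.m≥n⇒m/n>0 p≤N)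
  ... | suc n = ≤-trans (≤-trans (*-monoʳ-≤ ε (<⇒≤ 0<ε) (≤-respʳ (ι-homo-* (2 ℕ.* p) (suc n)) (ι-mono-≤ N≤2pn)))
        (≤-respˡ (sym (*-assoc _ _ _)) (≤-respʳ (sym (ι-homo-* (2 ℕ.* p) (16 ℕ.* (p ℕ.* C)))) (*-monoˡ-≤ (ι (2 ℕ.* p)) (0≤ι (2 ℕ.* p))
          (≤-trans (nε≤4s[C+3] 0<ε Π 𝒞 contains guarantee atMost n pn≤N)
            (4s[C+3]≤16pC q (communicates 0<ε Π 𝒞 contains guarantee C atMost)))))))
      (ι-mono-≤ (ℕₚ.≤-trans (ℕₚ.≤-reflexive (2p16pC≡32p²C p C)) (ℕₚ.*-monoʳ-≤ 32 (ℕₚ.*-monoˡ-≤ C (ℕₚ.^-monoʳ-≤ p {2} {3} (ℕ.s≤s (ℕ.s≤s ℕ.z≤n)))))))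
    where
    p : ℕ
    p = suc (suc q)
    pn≤N : p ℕ.* suc n ℕ.≤ N
    pn≤N = ℕₚ.≤-trans (ℕₚ.≤-reflexive (≡.trans (ℕₚ.*-comm p (suc n)) (≡.cong (ℕ._* p) (≡.sym quot)))) (ℕᵈ.m/n*n≤m N p)
    N≤2pn : N ℕ.≤ 2 ℕ.* p ℕ.* suc n
    N≤2pn = begin
      N                                 ≡⟨ ℕᵈ.m≡m%n+[m/n]*n N p ⟩
      N ℕᵈ.% p ℕ.+ (N ℕᵈ./ p) ℕ.* p     ≡⟨ ≡.cong (λ k → N ℕᵈ.% p ℕ.+ k ℕ.* p) quot ⟩
      N ℕᵈ.% p ℕ.+ suc n ℕ.* p          ≤⟨ ℕₚ.+-monoˡ-≤ (suc n ℕ.* p) (ℕₚ.≤-trans (ℕₚ.<⇒≤ (ℕᵈ.m%n<n N p)) (ℕₚ.m≤m+n p (n ℕ.* p))) ⟩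
      suc n ℕ.* p ℕ.+ suc n ℕ.* p       ≡⟨ np+np≡2pn (suc n) p ⟩
      2 ℕ.* p ℕ.* suc n                 ∎
      where open ℕₚ.≤-Reasoning

  communication-bound : ∀ {ε} → 0# < ε → ∀ {q N} (Π : Protocol (suc q) N) (𝒞 : Class (suc (suc q)) N) → Contains 𝒞 →
                        HasGuarantee 𝒞 Π (ratio (suc (suc q)) * (1# + ε)) →
                        CommunicationAtLeast 𝒞 Π (1/ 32 * ((ι N * ε) / suc (suc q) ³))
  communication-bound 0<ε {q} {N} Π 𝒞 contains guarantee C atMost = ≤-respʳ cancel
    (*-monoˡ-≤ (1/ 32) (<⇒≤ (recip-positive _ _)) (*-monoʳ-≤ r (<⇒≤ (recip-positive _ _)) (Nε≤32p³C 0<ε N Π 𝒞 contains guarantee atMost)))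
    where
    p : ℕ
    p = suc (suc q)
    r = (1/ (p ℕ.^ 3)) {{ℕₚ.m^n≢0 p 3}}
    cancel : 1/ 32 * (ι (32 ℕ.* (p ℕ.^ 3 ℕ.* C)) * r) ≈ ι C
    cancel = trans (*-congˡ (*-congʳ (trans (ι-homo-* 32 (p ℕ.^ 3 ℕ.* C)) (*-congˡ (ι-homo-* (p ℕ.^ 3) C)))))
      (trans (solve 5 (λ a t P c r → a :* ((t :* (P :* c)) :* r) := (t :* a) :* ((P :* r) :* c)) refl (1/ 32) (ι 32) (ι (p ℕ.^ 3)) (ι C) r)
        (trans (*-cong (recip-inverse _ _) (trans (*-congʳ (recip-inverse _ _)) (*-identityˡ _))) (*-identityˡ _)))

theorem3 :
    (ℝ : Reals) →
    let open Reals ℝ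
        open Arithmetic ℝ
        open Model ℝ
    in
    Σ Carrier λ c → 0# < c ×
      ((ε : Carrier) → 0# < ε →
       (q : ℕ) →
       let s = suc q
           p = suc s
       in
       (N : ℕ) (Π : Protocol s N) →
         (HasGuarantee Submodular Π (ratio p * (1# + ε)) →
            CommunicationAtLeast Submodular Π (c * ((ι N * ε) / p ³)))
         ×
         (HasGuarantee Coverage-k≡p Π (ratio p * (1# + ε)) →
            CommunicationAtLeast Coverage-k≡p Π (c * ((ι N * ε) / p ³))))
theorem3 ℝ = 1/ 32 , recip-positive _ _ , λ ε 0<ε q N Π →
    communication-bound 0<ε Π Submodular (λ _ _ _ _ submodular → submodular) ,
    communication-bound 0<ε Π Coverage-k≡p (λ _ _ k≡p coverage _ → k≡p , coverage)
  where
  open Reals ℝ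
  open Arithmetic ℝ
  open Model ℝ
  open Communication ℝ
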